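{- Let $q\in\mathbb{C}$ with $|q|<1$. Then the following four identities hold: $$\sum_{n=0}^{\infty} \frac{(-q^2;q^2)_{n}\,q^{n^2}}{(q;q)_{2n+1}} =\frac{(-q;q^2)_{\infty}}{(q;q^2)_{\infty}},$$ $$\sum_{n=0}^{\infty} \frac{(-1;q)_{2n}\,q^{n^2+n}}{(q^2;q^2)_{n}(q^2;q^4)_{n}} =\frac{(-q^3;q^6)_{\infty}^2(q^6;q^6)_{\infty}(-q^2;q^2)_{\infty}}{(q^2;q^2)_{\infty}},$$ $$\sum_{n=0}^{\infty} \frac{(q;q^2)_{2n}\,q^{2n^2+4n}(-1)^n}{(q^8;q^8)_{n}(-q^2;q^4)_{n+1}} = (-q^9,-q^7,q^8;q^8)_{\infty}\frac{(q^2;q^4)_{\infty}}{(q^4;q^4)_{\infty}},$$ $$\sum_{n=0}^{\infty} \frac{(q;q^2)_{2n}\,q^{2n^2}(-1)^n}{(q^8;q^8)_{n}(-q^2;q^4)_{n}} = (-q^3,-q^5,q^8;q^8)_{\infty}\frac{(q^2;q^4)_{\infty}}{(q^4;q^4)_{\infty}}.$$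
   Context: For $|q|<1$, $x\in\mathbb{C}$ and an integer $n\ge 0$: $(x;q)_n=\prod_{j=0}^{n-1}(1-xq^j)$ (so $(x;q)_0=1$), $(x;q)_\infty=\prod_{j=0}^{\infty}(1-xq^j)$, and $(x_1,\dots,x_k;q)_\infty=\prod_{i=1}^k (x_i;q)_\infty$. The same notation is used with base $q^m$ in place of $q$. -}

module Defs where

open import Algebra.Bundles.Raw using (RawRing)
open import Data.Fin.Base using (toℕ)
open import Data.List.Base using (List; []; _∷_)
open import Data.Nat.Base as ℕ using (ℕ)
import Data.Nat.Properties as ℕ
open import Data.Product.Base using (Σ-syntax; ∃-syntax; _×_; _,_)
open import Data.Rational.Base as ℚ using (ℚ; 0ℚ; 1ℚ; ½)
import Data.Rational.Properties as ℚ
open import Data.Rational.Solver using (module +-*-Solver)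
open import Level using (0ℓ)
open import Relation.Binary.PropositionalEquality
  using (_≡_; refl; sym; trans; cong; subst)

-- Real numbers: Cauchy sequences of rationals, taken up to _≈ᵣ_.

IsCauchy : (ℕ → ℚ) → Set
IsCauchy f = ∀ ε → 0ℚ ℚ.< ε →
  ∃[ N ] (∀ m n → N ℕ.≤ m → N ℕ.≤ n → ℚ.∣ f m ℚ.- f n ∣ ℚ.< ε)

record ℝ : Set where
  constructor mkℝ
  field
    seq    : ℕ → ℚ
    cauchy : IsCauchy seq

open ℝ public

infix 4 _≈ᵣ_ _<ᵣ_

_≈ᵣ_ : ℝ → ℝ → Set
x ≈ᵣ y = ∀ ε → 0ℚ ℚ.< ε →
  ∃[ N ] (∀ n → N ℕ.≤ n → ℚ.∣ seq x n ℚ.- seq y n ∣ ℚ.< ε)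

-- The uniform gap δ makes this independent of the representing sequences.
_<ᵣ_ : ℝ → ℝ → Set
x <ᵣ y = ∃[ δ ] 0ℚ ℚ.< δ ×
  (∃[ N ] (∀ n → N ℕ.≤ n → seq x n ℚ.+ δ ℚ.< seq y n))

module CauchyLemmas where
  open +-*-Solver

  half-pos : ∀ {ε} → 0ℚ ℚ.< ε → 0ℚ ℚ.< ½ ℚ.* ε
  half-pos {ε} 0<ε = subst (ℚ._< ½ ℚ.* ε) (ℚ.*-zeroʳ ½) (ℚ.*-monoʳ-<-pos ½ 0<ε)

  halves : ∀ ε → ½ ℚ.* ε ℚ.+ ½ ℚ.* ε ≡ ε
  halves ε = trans (sym (ℚ.*-distribʳ-+ ε ½ ½)) (ℚ.*-identityˡ ε)

  +-rearrange : ∀ a b c d →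
    (a ℚ.+ b) ℚ.- (c ℚ.+ d) ≡ (a ℚ.- c) ℚ.+ (b ℚ.- d)
  +-rearrange = solve 4 (λ a b c d → (a :+ b) :- (c :+ d) := (a :- c) :+ (b :- d)) refl

  neg-rearrange : ∀ a b → (ℚ.- a) ℚ.- (ℚ.- b) ≡ ℚ.- (a ℚ.- b)
  neg-rearrange = solve 2 (λ a b → (:- a) :- (:- b) := :- (a :- b)) refl

  *-rearrange : ∀ a b c d →
    (a ℚ.* b) ℚ.- (c ℚ.* d) ≡ a ℚ.* (b ℚ.- d) ℚ.+ d ℚ.* (a ℚ.- c)
  *-rearrange = solve 4 (λ a b c d →
    (a :* b) :- (c :* d) := a :* (b :- d) :+ d :* (a :- c)) refl

  split : ∀ a b → a ≡ (a ℚ.- b) ℚ.+ b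
  split = solve 2 (λ a b → a := (a :- b) :+ b) refl

  EventuallyBounded : (ℕ → ℚ) → Set
  EventuallyBounded f =
    ∃[ B ] 0ℚ ℚ.< B × (∃[ N ] (∀ n → N ℕ.≤ n → ℚ.∣ f n ∣ ℚ.≤ B))

  bounded : ∀ f → IsCauchy f → EventuallyBounded f
  bounded f c with c 1ℚ (ℚ.positive⁻¹ 1ℚ)
  ... | N , h = 1ℚ ℚ.+ ℚ.∣ f N ∣
              , ℚ.+-mono-<-≤ (ℚ.positive⁻¹ 1ℚ) (ℚ.0≤∣p∣ (f N))
              , N , λ n N≤n → begin
                ℚ.∣ f n ∣                       ≡⟨ cong ℚ.∣_∣ (split (f n) (f N)) ⟩
                ℚ.∣ (f n ℚ.- f N) ℚ.+ f N ∣     ≤⟨ ℚ.∣p+q∣≤∣p∣+∣q∣ (f n ℚ.- f N) (f N) ⟩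
                ℚ.∣ f n ℚ.- f N ∣ ℚ.+ ℚ.∣ f N ∣ ≤⟨ ℚ.+-monoˡ-≤ ℚ.∣ f N ∣
                                                    (ℚ.<⇒≤ (h n N N≤n ℕ.≤-refl)) ⟩
                1ℚ ℚ.+ ℚ.∣ f N ∣                ∎
    where open ℚ.≤-Reasoning

  const-cauchy : ∀ p → IsCauchy (λ _ → p)
  const-cauchy p ε 0<ε = 0 , λ _ _ _ _ →
    subst (ℚ._< ε) (sym (cong ℚ.∣_∣ (ℚ.+-inverseʳ p))) 0<ε

  +-cauchy : ∀ f g → IsCauchy f → IsCauchy g → IsCauchy (λ n → f n ℚ.+ g n)
  +-cauchy f g cf cg ε 0<ε
    with cf (½ ℚ.* ε) (half-pos 0<ε) | cg (½ ℚ.* ε) (half-pos 0<ε)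
  ... | M , hf | N , hg = M ℕ.⊔ N , λ m n p q → begin-strict
      ℚ.∣ (f m ℚ.+ g m) ℚ.- (f n ℚ.+ g n) ∣
        ≡⟨ cong ℚ.∣_∣ (+-rearrange (f m) (g m) (f n) (g n)) ⟩
      ℚ.∣ (f m ℚ.- f n) ℚ.+ (g m ℚ.- g n) ∣
        ≤⟨ ℚ.∣p+q∣≤∣p∣+∣q∣ (f m ℚ.- f n) (g m ℚ.- g n) ⟩
      ℚ.∣ f m ℚ.- f n ∣ ℚ.+ ℚ.∣ g m ℚ.- g n ∣
        <⟨ ℚ.+-mono-< (hf m n (ℕ.m⊔n≤o⇒m≤o M N p) (ℕ.m⊔n≤o⇒m≤o M N q))
                      (hg m n (ℕ.m⊔n≤o⇒n≤o M N p) (ℕ.m⊔n≤o⇒n≤o M N q)) ⟩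
      ½ ℚ.* ε ℚ.+ ½ ℚ.* ε
        ≡⟨ halves ε ⟩
      ε ∎
    where open ℚ.≤-Reasoning

  neg-cauchy : ∀ f → IsCauchy f → IsCauchy (λ n → ℚ.- f n)
  neg-cauchy f cf ε 0<ε with cf ε 0<ε
  ... | N , h = N , λ m n p q →
    subst (ℚ._< ε)
      (sym (trans (cong ℚ.∣_∣ (neg-rearrange (f m) (f n))) (ℚ.∣-p∣≡∣p∣ (f m ℚ.- f n))))
      (h m n p q)

  divide : ∀ ε D → 0ℚ ℚ.< ε → 0ℚ ℚ.< D → ∃[ δ ] 0ℚ ℚ.< δ × D ℚ.* δ ≡ ε
  divide ε D 0<ε 0<D = D⁻¹ ℚ.* ε
    , subst (ℚ._< D⁻¹ ℚ.* ε) (ℚ.*-zeroʳ D⁻¹)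
        (ℚ.*-monoʳ-<-pos D⁻¹ {{ℚ.1/pos⇒pos D {{ℚ.positive 0<D}}}} 0<ε)
    , trans (sym (ℚ.*-assoc D D⁻¹ ε))
        (trans (cong (ℚ._* ε) (ℚ.*-inverseʳ D {{D≢0}})) (ℚ.*-identityˡ ε))
    where
    D≢0 : ℚ.NonZero D
    D≢0 = ℚ.pos⇒nonZero D {{ℚ.positive 0<D}}
    D⁻¹ : ℚ
    D⁻¹ = ℚ.1/_ D {{D≢0}}

  scale : ∀ a b {D δ} → 0ℚ ℚ.< D →
    ℚ.∣ a ∣ ℚ.≤ D → ℚ.∣ b ∣ ℚ.< δ → ℚ.∣ a ℚ.* b ∣ ℚ.< D ℚ.* δ
  scale a b {D} {δ} 0<D a≤D b<δ = begin-strict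
    ℚ.∣ a ℚ.* b ∣        ≡⟨ ℚ.∣p*q∣≡∣p∣*∣q∣ a b ⟩
    ℚ.∣ a ∣ ℚ.* ℚ.∣ b ∣  ≤⟨ ℚ.*-monoʳ-≤-nonNeg ℚ.∣ b ∣ {{ℚ.nonNegative (ℚ.0≤∣p∣ b)}} a≤D ⟩
    D ℚ.* ℚ.∣ b ∣        <⟨ ℚ.*-monoʳ-<-pos D {{ℚ.positive 0<D}} b<δ ⟩
    D ℚ.* δ              ∎
    where open ℚ.≤-Reasoning

  *-cauchy : ∀ f g → IsCauchy f → IsCauchy g → IsCauchy (λ n → f n ℚ.* g n)
  *-cauchy f g cf cg ε 0<ε =
    let B , 0<B , M₀ , bf = bounded f cf
        C , 0<C , N₀ , bg = bounded g cg
        δ , 0<δ , δ-eq = divide ε (B ℚ.+ C) 0<ε (ℚ.+-mono-< 0<B 0<C)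
        M₁ , hf = cf δ 0<δ
        N₁ , hg = cg δ 0<δ
    in (M₀ ℕ.⊔ N₀) ℕ.⊔ (M₁ ℕ.⊔ N₁) , λ m n p q →
      let p₀ = ℕ.m⊔n≤o⇒m≤o (M₀ ℕ.⊔ N₀) (M₁ ℕ.⊔ N₁) p
          p₁ = ℕ.m⊔n≤o⇒n≤o (M₀ ℕ.⊔ N₀) (M₁ ℕ.⊔ N₁) p
          q₀ = ℕ.m⊔n≤o⇒m≤o (M₀ ℕ.⊔ N₀) (M₁ ℕ.⊔ N₁) q
          q₁ = ℕ.m⊔n≤o⇒n≤o (M₀ ℕ.⊔ N₀) (M₁ ℕ.⊔ N₁) q
      in begin-strict
      ℚ.∣ f m ℚ.* g m ℚ.- f n ℚ.* g n ∣
        ≡⟨ cong ℚ.∣_∣ (*-rearrange (f m) (g m) (f n) (g n)) ⟩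
      ℚ.∣ f m ℚ.* (g m ℚ.- g n) ℚ.+ g n ℚ.* (f m ℚ.- f n) ∣
        ≤⟨ ℚ.∣p+q∣≤∣p∣+∣q∣ (f m ℚ.* (g m ℚ.- g n)) (g n ℚ.* (f m ℚ.- f n)) ⟩
      ℚ.∣ f m ℚ.* (g m ℚ.- g n) ∣ ℚ.+ ℚ.∣ g n ℚ.* (f m ℚ.- f n) ∣
        <⟨ ℚ.+-mono-<
             (scale (f m) (g m ℚ.- g n) 0<B (bf m (ℕ.m⊔n≤o⇒m≤o M₀ N₀ p₀))
               (hg m n (ℕ.m⊔n≤o⇒n≤o M₁ N₁ p₁) (ℕ.m⊔n≤o⇒n≤o M₁ N₁ q₁)))
             (scale (g n) (f m ℚ.- f n) 0<C (bg n (ℕ.m⊔n≤o⇒n≤o M₀ N₀ q₀))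
               (hf m n (ℕ.m⊔n≤o⇒m≤o M₁ N₁ p₁) (ℕ.m⊔n≤o⇒m≤o M₁ N₁ q₁))) ⟩
      B ℚ.* δ ℚ.+ C ℚ.* δ
        ≡⟨ ℚ.*-distribʳ-+ δ B C ⟨
      (B ℚ.+ C) ℚ.* δ
        ≡⟨ δ-eq ⟩
      ε ∎
    where open ℚ.≤-Reasoning

open CauchyLemmas

fromℚ : ℚ → ℝ
fromℚ p = mkℝ (λ _ → p) (const-cauchy p)

infixl 6 _+ᵣ_ _-ᵣ_
infixl 7 _*ᵣ_
infix  8 -ᵣ_

_+ᵣ_ : ℝ → ℝ → ℝ
x +ᵣ y = mkℝ (λ n → seq x n ℚ.+ seq y n) (+-cauchy (seq x) (seq y) (cauchy x) (cauchy y))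

-ᵣ_ : ℝ → ℝ
-ᵣ x = mkℝ (λ n → ℚ.- seq x n) (neg-cauchy (seq x) (cauchy x))

_-ᵣ_ : ℝ → ℝ → ℝ
x -ᵣ y = x +ᵣ (-ᵣ y)

_*ᵣ_ : ℝ → ℝ → ℝ
x *ᵣ y = mkℝ (λ n → seq x n ℚ.* seq y n) (*-cauchy (seq x) (seq y) (cauchy x) (cauchy y))

record ℂ : Set where
  constructor _+i_
  field
    re im : ℝ

open ℂ public

infix  4 _≈_
infixl 6 _+_ _-_
infixl 7 _*_
infix  8 -_

_≈_ : ℂ → ℂ → Set
z ≈ w = re z ≈ᵣ re w × im z ≈ᵣ im w

0ℂ 1ℂ : ℂ
0ℂ = fromℚ 0ℚ +i fromℚ 0ℚ
1ℂ = fromℚ 1ℚ +i fromℚ 0ℚ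

_+_ : ℂ → ℂ → ℂ
z + w = (re z +ᵣ re w) +i (im z +ᵣ im w)

-_ : ℂ → ℂ
- z = (-ᵣ re z) +i (-ᵣ im z)

_-_ : ℂ → ℂ → ℂ
z - w = z + (- w)

_*_ : ℂ → ℂ → ℂ
z * w = (re z *ᵣ re w -ᵣ im z *ᵣ im w) +i (re z *ᵣ im w +ᵣ im z *ᵣ re w)

ℂ-rawRing : RawRing 0ℓ 0ℓ
ℂ-rawRing = record
  { Carrier = ℂ ; _≈_ = _≈_ ; _+_ = _+_ ; _*_ = _*_ ; -_ = -_ ; 0# = 0ℂ ; 1# = 1ℂ }

open import Algebra.Definitions.RawSemiring (RawRing.rawSemiring ℂ-rawRing) public
  using (_^_; sum; product)

∣_∣² : ℂ → ℝ
∣ z ∣² = re z *ᵣ re z +ᵣ im z *ᵣ im z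

-- |z| < r, for a rational r ≥ 0.
infix 4 ∣_∣<_
∣_∣<_ : ℂ → ℚ → Set
∣ z ∣< r = ∣ z ∣² <ᵣ fromℚ (r ℚ.* r)

-- z ≠ 0 in its constructively meaningful form: z is apart from 0.
infix 4 _#0
_#0 : ℂ → Set
z #0 = fromℚ 0ℚ <ᵣ ∣ z ∣²

infix 4 _⟶_
_⟶_ : (ℕ → ℂ) → ℂ → Set
s ⟶ l = ∀ ε → 0ℚ ℚ.< ε → ∃[ N ] (∀ n → N ℕ.≤ n → ∣ s n - l ∣< ε)

-- Quotients and infinite sums and products are partial operations on ℂ, so
-- they are given as relations "the expression is defined and has value z".
-- Each relation determines z up to _≈_.

-- z = a / b
infix 4 _≈_÷_
_≈_÷_ : ℂ → ℂ → ℂ → Set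
z ≈ a ÷ b = b #0 × z * b ≈ a

-- S = ∑_{n ≥ 0} a n / b n
infix 4 _≈∑_÷_
_≈∑_÷_ : ℂ → (ℕ → ℂ) → (ℕ → ℂ) → Set
S ≈∑ a ÷ b = Σ[ t ∈ (ℕ → ℂ) ] (∀ n → t n ≈ a n ÷ b n) ×
                  ((λ N → sum {N} (λ i → t (toℕ i))) ⟶ S)

-- ⟨ x ⨾ q ⟩ n = (x;q)_n
⟨_⨾_⟩_ : ℂ → ℂ → ℕ → ℂ
⟨ x ⨾ q ⟩ n = product {n} (λ j → 1ℂ - x * q ^ toℕ j)

-- P = (x;q)_∞
infix 4 _≈⟨_⨾_⟩∞
_≈⟨_⨾_⟩∞ : ℂ → ℂ → ℂ → Set
P ≈⟨ x ⨾ q ⟩∞ = (λ n → ⟨ x ⨾ q ⟩ n) ⟶ P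

-- P = (x₁,…,x_k;q)_∞
infix 4 _≈⟪_⨾_⟫∞
_≈⟪_⨾_⟫∞ : ℂ → List ℂ → ℂ → Set
P ≈⟪ []     ⨾ q ⟫∞ = P ≈ 1ℂ
P ≈⟪ x ∷ xs ⨾ q ⟫∞ =
  ∃[ A ] ∃[ B ] (A ≈⟨ x ⨾ q ⟩∞) × (B ≈⟪ xs ⨾ q ⟫∞) × (P ≈ A * B)

{-# OPTIONS --safe #-}
module Submission where

-- All four sums reduce to one finite identity, the q-Chu–Vandermonde sum
--   ∑_{k+l=m} (a)_k (-x)^k Q^(k(k-1)/2) (a x Q^k)_l / ((Q)_k (Q)_l) = (x)_m / (Q)_m,
-- in which one Pascal step replaces x by x Q and splits off the factor 1 - x.  Its limit m → ∞ is
-- the first identity.  For the others, summing it against β_n = ∑_r α_r / ((Q)_{n-r} (Q)_{n+r+s})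
-- gives Bailey's lemma for the three Bailey pairs in question.  The pairs with
-- β_n = (q;q²)_{2n} / (q⁴;q⁴)_{2n} (s = 0, base q⁴) and its companion with s = 1 come from the finite
-- Jacobi triple product; β_n = 1 / (q;q)_{2n} (base q²) comes from
-- ∑_{j+k=m} q^T(j-k) / ((q²;q²)_j (q²;q²)_k) = 1 / (q;q)_m, T(d) = d(d+1)/2, which follows from
-- T(-1-d) = T(d).  The theta series produced by Bailey's lemma are evaluated by the limit of the
-- finite triple product.
--
-- Every limit occurring here is approached at a geometric rate r^n with |q| < r < 1, so the
-- analysis is a calculus of O(r^w) bounds.  The number q is never divided by, only the units 1 - q^m.

open import Algebra.Bundles using (CommutativeRing)
open import Algebra.Structures using (IsCommutativeRing)
open import Data.Empty using (⊥-elim)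
open import Data.Fin.Base as Fin using (Fin; toℕ)
open import Data.Integer.Base as ℤ using (ℤ; +_; -[1+_])
import Data.Integer.Properties as ℤ
open import Data.List.Base using ([]; _∷_)
open import Data.Maybe.Base using (Maybe; just; nothing)
open import Data.Nat.Base as ℕ using (ℕ; zero; suc)
import Data.Nat.Coprimality as Coprime
import Data.Nat.Properties as ℕ
open import Data.Nat.Tactic.RingSolver using (solve-∀)
open import Data.Product.Base using (Σ-syntax; ∃-syntax; _×_; _,_; proj₁; proj₂)
open import Data.Rational.Base as ℚ using (ℚ; 0ℚ; 1ℚ; ½; mkℚ)
import Data.Rational.Properties as ℚ
open import Data.Rational.Solver using (module +-*-Solver)
import Data.Rational.Unnormalised.Base as ℚᵘ
import Data.Rational.Unnormalised.Properties as ℚᵘ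
open import Data.Sum.Base using (inj₁; inj₂)
open import Function.Base using (id; _∘_)
open import Level using (0ℓ)
open import Relation.Binary.PropositionalEquality as ≡ using (_≡_)
open import Relation.Nullary using (yes; no)
open import Relation.Nullary.Decidable.Core using (dec⇒maybe)
open import Defs using (module CauchyLemmas)
open CauchyLemmas using (half-pos; halves; divide)

-- Summation is interchanged only in finite sums. Bailey's lemma is therefore kept finite by an
-- extra weight 1 / (Q;Q)_{N-n}, which is why the full Chu-Vandermonde sum is needed and not just
-- its limit. All limits of sums are then taken by one form of Tannery's theorem. It wants summands
-- of size r^(2n), which the quadratic exponents of q supply because 2n ≤ n^2 + 1.
--
-- The third identity resists a single triple product: the two candidates carry the unwanted factors
-- 1 - q^(4n+1) and 1 - q^(4n+3). Now q times the first factor plus the second is (1 + q)(1 -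
-- q^(4n+2)). The factor 1 - q^(4n+2) completes (q^2;q^4)_n to (q^2;q^4)_{n+1}, and 1 + q is divided
-- out at the end.
--
-- Division by q is avoided because q may be 0, and q = 0 cannot be decided. This shapes the triple
-- product: instead of x and Q/x it has two parameters x and y with x y = Q.

-- Ring solver with integer coefficients for an arbitrary commutative ring

module IntegerSolver (R : CommutativeRing 0ℓ 0ℓ) where
  open CommutativeRing R
  open import Algebra.Solver.Ring.AlmostCommutativeRing
    using (fromCommutativeRing; _-Raw-AlmostCommutative⟶_)
  open import Algebra.Properties.Semiring.Mult semiring using (×-homo-+; ×1-homo-*)
    renaming (_×_ to _·_)
  open import Algebra.Properties.Ring ring
    using (-0#≈0#; -‿involutive; -‿+-comm; -‿distribˡ-*; -‿distribʳ-*)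
  open import Relation.Binary.Reasoning.Setoid setoid

  ⟦_⟧ : ℤ → Carrier
  ⟦ + n ⟧      = n · 1#
  ⟦ -[1+ n ] ⟧ = - (suc n · 1#)

  neg-homo : ∀ i → ⟦ ℤ.- i ⟧ ≈ - ⟦ i ⟧
  neg-homo (+ zero)   = sym -0#≈0#
  neg-homo (+ suc n)  = refl
  neg-homo (-[1+ n ]) = sym (-‿involutive _)

  ⊖-homo : ∀ m n → ⟦ m ℤ.⊖ n ⟧ ≈ m · 1# - n · 1#
  ⊖-homo m zero = sym (trans (+-congˡ -0#≈0#) (+-identityʳ _))
  ⊖-homo zero (suc n) = sym (+-identityˡ _)
  ⊖-homo (suc m) (suc n) = begin
    ⟦ suc m ℤ.⊖ suc n ⟧             ≡⟨ ≡.cong ⟦_⟧ (ℤ.[1+m]⊖[1+n]≡m⊖n m n) ⟩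
    ⟦ m ℤ.⊖ n ⟧                     ≈⟨ ⊖-homo m n ⟩
    a - b                           ≈⟨ +-congʳ (+-identityˡ a) ⟨
    0# + a - b                      ≈⟨ +-congʳ (+-congʳ (-‿inverseʳ 1#)) ⟨
    1# - 1# + a - b                 ≈⟨ +-congʳ (trans (+-assoc _ _ _) (trans (+-congˡ (+-comm _ _)) (sym
        (+-assoc _ _ _)))) ⟩
    1# + a - 1# - b                 ≈⟨ +-assoc _ _ _ ⟩
    1# + a + (- 1# - b)             ≈⟨ +-congˡ (-‿+-comm 1# b) ⟩
    1# + a - (1# + b)               ∎
    where a = m · 1# ; b = n · 1#

  +-homo : ∀ i j → ⟦ i ℤ.+ j ⟧ ≈ ⟦ i ⟧ + ⟦ j ⟧
  +-homo (+ m)    (+ n)    = ×-homo-+ 1# m n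
  +-homo (+ m)    -[1+ n ] = ⊖-homo m (suc n)
  +-homo -[1+ m ] (+ n)    = trans (⊖-homo n (suc m)) (+-comm _ _)
  +-homo -[1+ m ] -[1+ n ] = begin
    - (suc (suc (m ℕ.+ n)) · 1#)     ≡⟨ ≡.cong (λ k → - (suc k · 1#)) (≡.sym (ℕ.+-suc m n)) ⟩
    - ((suc m ℕ.+ suc n) · 1#)       ≈⟨ -‿cong (×-homo-+ 1# (suc m) (suc n)) ⟩
    - (suc m · 1# + suc n · 1#)      ≈⟨ -‿+-comm _ _ ⟨
    - (suc m · 1#) - suc n · 1#      ∎

  pos*-homo : ∀ m j → ⟦ + m ℤ.* j ⟧ ≈ m · 1# * ⟦ j ⟧
  pos*-homo m (+ n) = trans (reflexive (≡.cong ⟦_⟧ (≡.sym (ℤ.pos-* m n)))) (×1-homo-* m n)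
  pos*-homo m -[1+ n ] = begin
    ⟦ + m ℤ.* -[1+ n ] ⟧       ≡⟨ ≡.cong ⟦_⟧ (≡.sym (ℤ.neg-distribʳ-* (+ m) (+ suc n))) ⟩
    ⟦ ℤ.- (+ m ℤ.* + suc n) ⟧  ≈⟨ neg-homo (+ m ℤ.* + suc n) ⟩
    - ⟦ + m ℤ.* + suc n ⟧      ≈⟨ -‿cong (pos*-homo m (+ suc n)) ⟩
    - (m · 1# * suc n · 1#)    ≈⟨ -‿distribʳ-* _ _ ⟩
    m · 1# * - (suc n · 1#)    ∎

  *-homo : ∀ i j → ⟦ i ℤ.* j ⟧ ≈ ⟦ i ⟧ * ⟦ j ⟧
  *-homo (+ m) j = pos*-homo m j
  *-homo -[1+ m ] j = begin
    ⟦ -[1+ m ] ℤ.* j ⟧        ≡⟨ ≡.cong ⟦_⟧ (≡.sym (ℤ.neg-distribˡ-* (+ suc m) j)) ⟩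
    ⟦ ℤ.- (+ suc m ℤ.* j) ⟧   ≈⟨ neg-homo (+ suc m ℤ.* j) ⟩
    - ⟦ + suc m ℤ.* j ⟧       ≈⟨ -‿cong (pos*-homo (suc m) j) ⟩
    - (suc m · 1# * ⟦ j ⟧)    ≈⟨ -‿distribˡ-* _ _ ⟩
    - (suc m · 1#) * ⟦ j ⟧    ∎

  -- ⟦ + 1 ⟧ unfolds to 1# + 0#; here the constant 1 has to evaluate to 1# itself.
  ⟦_⟧₁ : ℤ → Carrier
  ⟦ + 1 ⟧₁ = 1#
  ⟦ i ⟧₁   = ⟦ i ⟧

  ⟦⟧₁≈⟦⟧ : ∀ i → ⟦ i ⟧₁ ≈ ⟦ i ⟧
  ⟦⟧₁≈⟦⟧ (+ zero)          = refl
  ⟦⟧₁≈⟦⟧ (+ suc zero)      = sym (+-identityʳ 1#)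
  ⟦⟧₁≈⟦⟧ (+ suc (suc _))   = refl
  ⟦⟧₁≈⟦⟧ -[1+ _ ]          = refl

  ℤ⟶R : ℤ.+-*-rawRing -Raw-AlmostCommutative⟶ fromCommutativeRing R
  ℤ⟶R = record
    { ⟦_⟧    = ⟦_⟧₁
    ; +-homo = λ i j → trans (⟦⟧₁≈⟦⟧ (i ℤ.+ j)) (trans (+-homo i j) (sym (+-cong (⟦⟧₁≈⟦⟧ i) (⟦⟧₁≈⟦⟧ j))))
    ; *-homo = λ i j → trans (⟦⟧₁≈⟦⟧ (i ℤ.* j)) (trans (*-homo i j) (sym (*-cong (⟦⟧₁≈⟦⟧ i) (⟦⟧₁≈⟦⟧ j))))
    ; -‿homo = λ i → trans (⟦⟧₁≈⟦⟧ (ℤ.- i)) (trans (neg-homo i) (sym (-‿cong (⟦⟧₁≈⟦⟧ i))))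
    ; 0-homo = refl
    ; 1-homo = refl
    }

  ≟-sound : ∀ i j → Maybe (⟦ i ⟧₁ ≈ ⟦ j ⟧₁)
  ≟-sound i j with dec⇒maybe (i ℤ.≟ j)
  ... | just i≡j = just (reflexive (≡.cong ⟦_⟧₁ i≡j))
  ... | nothing  = nothing

  open import Algebra.Solver.Ring ℤ.+-*-rawRing (fromCommutativeRing R) ℤ⟶R ≟-sound public
    using (solve; _:=_; _:+_; _:*_; _:-_; :-_; con; _:^_; Polynomial)

  :0 :1 : ∀ {n} → Polynomial n
  :0 = con (+ 0)
  :1 = con (+ 1)

-- Finite identities in a commutative ring

module FiniteIdentities (R : CommutativeRing 0ℓ 0ℓ) where
  open CommutativeRing R
  open IntegerSolver R
  open import Algebra.Properties.CommutativeSemiring.Exp commutativeSemiring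
    using (_^_; ^-congˡ; ^-homo-*; ^-assocʳ; ^-distrib-*)
  open import Relation.Binary.Reasoning.Setoid setoid

  -- Antidiagonal sums

  Δ : ℕ → (ℕ → ℕ → Carrier) → Carrier
  Δ zero    F = F 0 0
  Δ (suc m) F = Δ m (λ j k → F j (suc k)) + F (suc m) 0

  Δ-cong : ∀ m {F G} → (∀ j k → j ℕ.+ k ≡ m → F j k ≈ G j k) → Δ m F ≈ Δ m G
  Δ-cong zero    h = h 0 0 ≡.refl
  Δ-cong (suc m) h = +-cong
    (Δ-cong m (λ j k e → h j (suc k) (≡.trans (ℕ.+-suc j k) (≡.cong suc e))))
    (h (suc m) 0 (ℕ.+-identityʳ (suc m)))

  Δ-+ : ∀ m F G → Δ m (λ j k → F j k + G j k) ≈ Δ m F + Δ m G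
  Δ-+ zero    F G = refl
  Δ-+ (suc m) F G = trans (+-congʳ (Δ-+ m _ _))
    (solve 4 (λ a b c d → (a :+ b) :+ (c :+ d) := (a :+ c) :+ (b :+ d)) refl _ _ _ _)

  Δ-*ˡ : ∀ m c F → c * Δ m F ≈ Δ m (λ j k → c * F j k)
  Δ-*ˡ zero    c F = refl
  Δ-*ˡ (suc m) c F = trans (distribˡ c _ _) (+-congʳ (Δ-*ˡ m c _))

  Δ-suc : ∀ m F → Δ (suc m) F ≈ F 0 (suc m) + Δ m (λ j k → F (suc j) k)
  Δ-suc zero    F = refl
  Δ-suc (suc m) F = trans (+-congʳ (Δ-suc m (λ j k → F j (suc k)))) (+-assoc _ _ _)

  Δ-swap : ∀ m F → Δ m F ≈ Δ m (λ j k → F k j)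
  Δ-swap zero    F = refl
  Δ-swap (suc m) F = begin
    Δ m (λ j k → F j (suc k)) + F (suc m) 0   ≈⟨ +-congʳ (Δ-swap m _) ⟩
    Δ m (λ j k → F k (suc j)) + F (suc m) 0   ≈⟨ +-comm _ _ ⟩
    F (suc m) 0 + Δ m (λ j k → F k (suc j))   ≈⟨ Δ-suc m (λ j k → F k j) ⟨
    Δ (suc m) (λ j k → F k j)                 ∎

  -- Both sides run over the triples r + k + l = N. The induction splits off the terms with l = 0.
  Δ-assoc : ∀ N (F : ℕ → ℕ → ℕ → Carrier) →
    Δ N (λ n l → Δ n (λ r k → F r k l)) ≈ Δ N (λ r m → Δ m (λ k l → F r k l))
  Δ-assoc zero    F = refl
  Δ-assoc (suc N) F = begin
    Δ N (λ n l → Δ n (λ r k → F r k (suc l))) + (Δ N (λ r k → F r (suc k) 0) + F (suc N) 0 0)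
      ≈⟨ +-congʳ (Δ-assoc N (λ r k l → F r k (suc l))) ⟩
    Δ N (λ r m → Δ m (λ k l → F r k (suc l))) + (Δ N (λ r k → F r (suc k) 0) + F (suc N) 0 0)
      ≈⟨ +-assoc _ _ _ ⟨
    Δ N (λ r m → Δ m (λ k l → F r k (suc l))) + Δ N (λ r k → F r (suc k) 0) + F (suc N) 0 0
      ≈⟨ +-congʳ (Δ-+ N _ _) ⟨
    Δ (suc N) (λ r m → Δ m (λ k l → F r k l))
      ∎

  -- Joins the two entries whose arguments differ by 2r in either direction. The diagonal r = 0
  -- stands alone, so that it is not counted twice.
  fold-even : (ℕ → ℕ → Carrier) → ℕ → ℕ → Carrier
  fold-even G zero    k = G k k
  fold-even G (suc r) k = G (k ℕ.+ 2 ℕ.* suc r) k + G k (k ℕ.+ 2 ℕ.* suc r)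

  -- On the antidiagonal of 2n the arguments differ by an even number 2r, and the smaller one is k =
  -- n - r. The induction peels off both ends, which form the pair r = n, k = 0.
  Δ-even : ∀ n G → Δ (2 ℕ.* n) G ≈ Δ n (fold-even G)
  Δ-even zero    G = refl
  Δ-even (suc n) G = begin
    Δ (2 ℕ.* suc n) G
      ≡⟨ ≡.cong (λ m → Δ m G) (ℕ.*-suc 2 n) ⟩
    Δ (suc (2 ℕ.* n)) (λ j k → G j (suc k)) + G (suc (suc (2 ℕ.* n))) 0
      ≈⟨ +-congʳ (Δ-suc (2 ℕ.* n) (λ j k → G j (suc k))) ⟩
    G 0 (suc (suc (2 ℕ.* n))) + Δ (2 ℕ.* n) (λ j k → G (suc j) (suc k)) + G (suc (suc (2 ℕ.* n))) 0
      ≈⟨ solve 3 (λ a b c → a :+ b :+ c := b :+ (c :+ a)) refl _ _ _ ⟩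
    Δ (2 ℕ.* n) (λ j k → G (suc j) (suc k)) + (G (suc (suc (2 ℕ.* n))) 0 + G 0 (suc (suc (2 ℕ.* n))))
      ≡⟨ ≡.cong (λ m → Δ (2 ℕ.* n) (λ j k → G (suc j) (suc k)) + (G m 0 + G 0 m)) (≡.sym (ℕ.*-suc 2 n)) ⟩
    Δ (2 ℕ.* n) (λ j k → G (suc j) (suc k)) + fold-even G (suc n) 0
      ≈⟨ +-congʳ (trans (Δ-even n (λ j k → G (suc j) (suc k))) (Δ-cong n (λ { zero k _ → refl ;
          (suc r) k _ → refl }))) ⟩
    Δ (suc n) (fold-even G)
      ∎

  Δ-odd : ∀ n G → Δ (suc (2 ℕ.* n)) G ≈
    Δ n (λ r k → G (k ℕ.+ suc (2 ℕ.* r)) k + G k (k ℕ.+ suc (2 ℕ.* r)))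
  Δ-odd zero    G = +-comm _ _
  Δ-odd (suc n) G = begin
    Δ (suc (2 ℕ.* suc n)) G
      ≡⟨ ≡.cong (λ m → Δ (suc m) G) (ℕ.*-suc 2 n) ⟩
    Δ (suc (suc (2 ℕ.* n))) (λ j k → G j (suc k)) + G (3 ℕ.+ 2 ℕ.* n) 0
      ≈⟨ +-congʳ (Δ-suc (suc (2 ℕ.* n)) (λ j k → G j (suc k))) ⟩
    G 0 (3 ℕ.+ 2 ℕ.* n) + Δ (suc (2 ℕ.* n)) (λ j k → G (suc j) (suc k)) + G (3 ℕ.+ 2 ℕ.* n) 0
      ≈⟨ solve 3 (λ a b c → a :+ b :+ c := b :+ (c :+ a)) refl _ _ _ ⟩
    Δ (suc (2 ℕ.* n)) (λ j k → G (suc j) (suc k)) + (G (3 ℕ.+ 2 ℕ.* n) 0 + G 0 (3 ℕ.+ 2 ℕ.* n))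
      ≡⟨ ≡.cong (λ m → Δ (suc (2 ℕ.* n)) (λ j k → G (suc j) (suc k)) + (G (suc m) 0 + G 0 (suc m))) (≡.sym
          (ℕ.*-suc 2 n)) ⟩
    Δ (suc (2 ℕ.* n)) (λ j k → G (suc j) (suc k)) + (G (suc (2 ℕ.* suc n)) 0 + G 0 (suc (2 ℕ.* suc n)))
      ≈⟨ +-congʳ (Δ-odd n (λ j k → G (suc j) (suc k))) ⟩
    _ ∎

  -- q-shifted factorials

  poch : Carrier → Carrier → ℕ → Carrier
  poch x q zero    = 1#
  poch x q (suc n) = poch x q n * (1# - x * q ^ n)

  poch-cong : ∀ {x y} q n → x ≈ y → poch x q n ≈ poch y q n
  poch-cong q zero    x≈y = refl
  poch-cong q (suc n) x≈y = *-cong (poch-cong q n x≈y) (+-congˡ (-‿cong (*-congʳ x≈y)))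

  poch-cong₂ : ∀ {x y p q} n → x ≈ y → p ≈ q → poch x p n ≈ poch y q n
  poch-cong₂ zero    x≈y p≈q = refl
  poch-cong₂ (suc n) x≈y p≈q =
    *-cong (poch-cong₂ n x≈y p≈q) (+-congˡ (-‿cong (*-cong x≈y (^-congˡ n p≈q))))

  poch-suc : ∀ x q n → poch x q (suc n) ≈ (1# - x) * poch (x * q) q n
  poch-suc x q zero    = solve 1 (λ x → :1 :* (:1 :- x :* :1) := (:1 :- x) :* :1) refl x
  poch-suc x q (suc n) = begin
    poch x q (suc n) * (1# - x * (q * q ^ n))            ≈⟨ *-congʳ (poch-suc x q n) ⟩
    (1# - x) * poch (x * q) q n * (1# - x * (q * q ^ n))
      ≈⟨ solve 4 (λ x q p t → (:1 :- x) :* p :* (:1 :- x :* (q :* t)) := (:1 :- x) :* (p :*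
          (:1 :- x :* q :* t))) refl x q _ _ ⟩
    (1# - x) * (poch (x * q) q n * (1# - x * q * q ^ n)) ∎

  poch-+ : ∀ x q m n → poch x q (m ℕ.+ n) ≈ poch x q m * poch (x * q ^ m) q n
  poch-+ x q m zero    = trans (reflexive (≡.cong (poch x q) (ℕ.+-identityʳ m))) (sym (*-identityʳ _))
  poch-+ x q m (suc n) = begin
    poch x q (m ℕ.+ suc n)                       ≡⟨ ≡.cong (poch x q) (ℕ.+-suc m n) ⟩
    poch x q (m ℕ.+ n) * (1# - x * q ^ (m ℕ.+ n))
      ≈⟨ *-cong (poch-+ x q m n) (+-congˡ (-‿cong (trans (*-congˡ (^-homo-* q m n)) (sym (*-assoc _ _ _))))) ⟩
    poch x q m * poch (x * q ^ m) q n * (1# - x * q ^ m * q ^ n)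
      ≈⟨ *-assoc _ _ _ ⟩
    poch x q m * poch (x * q ^ m) q (suc n)      ∎

  poch-zero : ∀ q n → poch 0# q n ≈ 1#
  poch-zero q zero    = refl
  poch-zero q (suc n) = trans (*-congʳ (poch-zero q n))
    (solve 1 (λ t → :1 :* (:1 :- :0 :* t) := :1) refl _)

  ^-2* : ∀ q n → q ^ (2 ℕ.* n) ≈ (q ^ 2) ^ n
  ^-2* q n = sym (^-assocʳ q 2 n)

  poch-even : ∀ x q n → poch x q (2 ℕ.* n) ≈ poch x (q ^ 2) n * poch (x * q) (q ^ 2) n
  poch-even x q zero    = sym (*-identityˡ 1#)
  poch-even x q (suc n) = begin
    poch x q (2 ℕ.* suc n)
      ≡⟨ ≡.cong (poch x q) (ℕ.*-suc 2 n) ⟩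
    poch x q (2 ℕ.* n) * (1# - x * q ^ (2 ℕ.* n)) * (1# - x * (q * q ^ (2 ℕ.* n)))
      ≈⟨ *-cong (*-cong (poch-even x q n) (+-congˡ (-‿cong (*-congˡ (^-2* q n)))))
           (+-congˡ (-‿cong (*-congˡ (*-congˡ (^-2* q n))))) ⟩
    poch x (q ^ 2) n * poch (x * q) (q ^ 2) n * (1# - x * (q ^ 2) ^ n) * (1# - x * (q * (q ^ 2) ^ n))
      ≈⟨ solve 5 (λ a b x q t → a :* b :* (:1 :- x :* t) :* (:1 :- x :* (q :* t)) :=
           a :* (:1 :- x :* t) :* (b :* (:1 :- x :* q :* t))) refl _ _ _ _ _ ⟩
    poch x (q ^ 2) (suc n) * poch (x * q) (q ^ 2) (suc n)
      ∎

  poch-odd : ∀ x q n → poch x q (suc (2 ℕ.* n)) ≈ poch x (q ^ 2) (suc n) * poch (x * q) (q ^ 2) n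
  poch-odd x q n = begin
    poch x q (2 ℕ.* n) * (1# - x * q ^ (2 ℕ.* n))
      ≈⟨ *-cong (poch-even x q n) (+-congˡ (-‿cong (*-congˡ (^-2* q n)))) ⟩
    poch x (q ^ 2) n * poch (x * q) (q ^ 2) n * (1# - x * (q ^ 2) ^ n)
      ≈⟨ solve 3 (λ a b c → a :* b :* c := a :* c :* b) refl _ _ _ ⟩
    poch x (q ^ 2) (suc n) * poch (x * q) (q ^ 2) n
      ∎

  poch-square : ∀ x q n → poch x q n * poch (- x) q n ≈ poch (x ^ 2) (q ^ 2) n
  poch-square x q zero    = *-identityˡ 1#
  poch-square x q (suc n) = begin
    poch x q n * (1# - x * q ^ n) * (poch (- x) q n * (1# - - x * q ^ n))
      ≈⟨ solve 4 (λ a b x t → a :* (:1 :- x :* t) :* (b :* (:1 :- :- x :* t)) :=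
           a :* b :* (:1 :- x :^ 2 :* t :^ 2)) refl _ _ _ _ ⟩
    poch x q n * poch (- x) q n * (1# - x ^ 2 * (q ^ n) ^ 2)
      ≈⟨ *-cong (poch-square x q n) (+-congˡ (-‿cong (*-congˡ (trans (^-assocʳ q n 2)
           (trans (reflexive (≡.cong (q ^_) (ℕ.*-comm n 2))) (^-2* q n)))))) ⟩
    poch (x ^ 2) (q ^ 2) (suc n)
      ∎

  -- wt x q n = (-x)ⁿ q^(n(n-1)/2)
  wt : Carrier → Carrier → ℕ → Carrier
  wt x q zero    = 1#
  wt x q (suc n) = wt x q n * (- x * q ^ n)

  wt-cong : ∀ {x y} q n → x ≈ y → wt x q n ≈ wt y q n
  wt-cong q zero    x≈y = refl
  wt-cong q (suc n) x≈y = *-cong (wt-cong q n x≈y) (*-congʳ (-‿cong x≈y))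

  wt-cong₂ : ∀ {x y p q} n → x ≈ y → p ≈ q → wt x p n ≈ wt y q n
  wt-cong₂ zero    x≈y p≈q = refl
  wt-cong₂ (suc n) x≈y p≈q = *-cong (wt-cong₂ n x≈y p≈q) (*-cong (-‿cong x≈y) (^-congˡ n p≈q))

  -- The signs of (-x)^n and (-y)^n cancel, hence the minus in the new parameter. This is how the
  -- weight of a Bailey pair fuses with that of the Bailey multiplier into a theta term of doubled
  -- base.
  wt-* : ∀ x y q n → wt x q n * wt y q n ≈ wt (- (x * y)) (q ^ 2) n
  wt-* x y q zero    = *-identityˡ 1#
  wt-* x y q (suc n) = begin
    wt x q n * (- x * q ^ n) * (wt y q n * (- y * q ^ n))
      ≈⟨ solve 5 (λ a b x y t → a :* (:- x :* t) :* (b :* (:- y :* t)) := a :* b :* (:- :-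
          (x :* y) :* t :^ 2)) refl _ _ _ _ _ ⟩
    wt x q n * wt y q n * (- - (x * y) * (q ^ n) ^ 2)
      ≈⟨ *-cong (wt-* x y q n) (*-congˡ (trans (^-assocʳ q n 2) (trans (reflexive (≡.cong (q ^_) (ℕ.*-comm n 2)))
          (^-2* q n)))) ⟩
    wt (- (x * y)) (q ^ 2) (suc n) ∎

  wt-scale : ∀ x y q n → wt (x * y) q n ≈ y ^ n * wt x q n
  wt-scale x y q zero    = sym (*-identityˡ 1#)
  wt-scale x y q (suc n) = trans (*-congʳ (wt-scale x y q n))
    (solve 5 (λ a b x y t → a :* b :* (:- (x :* y) :* t) := y :* a :* (b :* (:- x :* t))) refl _ _ _ _ _)

  wt-suc : ∀ x q n → wt x q (suc n) ≈ - x * wt (x * q) q n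
  wt-suc x q n = trans (solve 3 (λ a x t → a :* (:- x :* t) := :- x :* (t :* a)) refl _ _ _)
    (*-congˡ (sym (wt-scale x q q n)))

  wt-+ : ∀ x q m n → wt x q (m ℕ.+ n) ≈ wt x q m * wt (x * q ^ m) q n
  wt-+ x q m zero    = trans (reflexive (≡.cong (wt x q) (ℕ.+-identityʳ m))) (sym (*-identityʳ _))
  wt-+ x q m (suc n) = begin
    wt x q (m ℕ.+ suc n)                            ≡⟨ ≡.cong (wt x q) (ℕ.+-suc m n) ⟩
    wt x q (m ℕ.+ n) * (- x * q ^ (m ℕ.+ n))        ≈⟨ *-cong (wt-+ x q m n) (*-congˡ (^-homo-* q m n)) ⟩
    wt x q m * wt (x * q ^ m) q n * (- x * (q ^ m * q ^ n))
      ≈⟨ solve 5 (λ a b x s t → a :* b :* (:- x :* (s :* t)) := a :* (b :* (:- (x :* s) :* t))) refl _ _ _ _ _ ⟩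
    wt x q m * wt (x * q ^ m) q (suc n)             ∎

  -- Sums over j + k = m weighted by 1 / ((Q;Q)_j (Q;Q)_k)

  module Reciprocals (Q : Carrier) (u : ℕ → Carrier) (u-zero : u 0 ≈ 1#)
    (u-suc : ∀ n → u (suc n) * (1# - Q ^ suc n) ≈ u n) where

    u-inverse : ∀ n → u n * poch Q Q n ≈ 1#
    u-inverse zero    = trans (*-identityʳ _) u-zero
    u-inverse (suc n) = begin
      u (suc n) * (poch Q Q n * (1# - Q ^ suc n)) ≈⟨ solve 3 (λ a b c → a :* (b :* c) := a :* c :* b) refl _ _ _ ⟩
      u (suc n) * (1# - Q ^ suc n) * poch Q Q n   ≈⟨ *-congʳ (u-suc n) ⟩
      u n * poch Q Q n                            ≈⟨ u-inverse n ⟩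
      1#                                          ∎

    -- The factor is a unit with inverse `u (suc n) * poch Q Q n`. Every induction by a Pascal step
    -- ends by cancelling it.
    factor-cancel : ∀ n {x y} → (1# - Q ^ suc n) * x ≈ (1# - Q ^ suc n) * y → x ≈ y
    factor-cancel n {x} {y} h = begin
      x             ≈⟨ expand x ⟨
      c * (f * x)   ≈⟨ *-congˡ h ⟩
      c * (f * y)   ≈⟨ expand y ⟩
      y             ∎
      where
      f = 1# - Q ^ suc n
      c = u (suc n) * poch Q Q n
      expand : ∀ z → c * (f * z) ≈ z
      expand z = trans (solve 4 (λ a b f z → a :* b :* (f :* z) := a :* (b :* f) :* z) refl _ _ _ _)
        (trans (*-congʳ (u-inverse (suc n))) (*-identityˡ z))

    -- (Q;Q)_{n+l} = (Q;Q)_n (Q^(n+1);Q)_l. In Bailey's lemma this trades a reciprocal that depends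
    -- on the summation index for one that does not.
    u-tail : ∀ n l → u (n ℕ.+ l) * poch (Q ^ suc n) Q l ≈ u n
    u-tail n zero    = trans (*-identityʳ _) (reflexive (≡.cong u (ℕ.+-identityʳ n)))
    u-tail n (suc l) = begin
      u (n ℕ.+ suc l) * (poch (Q ^ suc n) Q l * (1# - Q ^ suc n * Q ^ l))
        ≡⟨ ≡.cong (λ m → u m * (poch (Q ^ suc n) Q l * (1# - Q ^ suc n * Q ^ l))) (ℕ.+-suc n l) ⟩
      u (suc (n ℕ.+ l)) * (poch (Q ^ suc n) Q l * (1# - Q ^ suc n * Q ^ l))
        ≈⟨ *-congˡ (*-congˡ (+-congˡ (-‿cong (sym (^-homo-* Q (suc n) l))))) ⟩
      u (suc (n ℕ.+ l)) * (poch (Q ^ suc n) Q l * (1# - Q ^ suc (n ℕ.+ l)))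
        ≈⟨ solve 3 (λ a b c → a :* (b :* c) := a :* c :* b) refl _ _ _ ⟩
      u (suc (n ℕ.+ l)) * (1# - Q ^ suc (n ℕ.+ l)) * poch (Q ^ suc n) Q l
        ≈⟨ *-congʳ (u-suc (n ℕ.+ l)) ⟩
      u (n ℕ.+ l) * poch (Q ^ suc n) Q l
        ≈⟨ u-tail n l ⟩
      u n ∎

    Γ : ℕ → (ℕ → ℕ → Carrier) → Carrier
    Γ m F = Δ m (λ j k → u j * u k * F j k)

    Γ-cong : ∀ m {F G} → (∀ j k → j ℕ.+ k ≡ m → F j k ≈ G j k) → Γ m F ≈ Γ m G
    Γ-cong m h = Δ-cong m (λ j k e → *-congˡ (h j k e))

    Γ-*ˡ : ∀ m c F → c * Γ m F ≈ Γ m (λ j k → c * F j k)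
    Γ-*ˡ m c F = trans (Δ-*ˡ m c _) (Δ-cong m (λ _ _ _ →
      solve 4 (λ c a b f → c :* (a :* b :* f) := a :* b :* (c :* f)) refl _ _ _ _))

    Γ-swap : ∀ m F → Γ m F ≈ Γ m (λ j k → F k j)
    Γ-swap m F = trans (Δ-swap m (λ j k → u j * u k * F j k)) (Δ-cong m (λ _ _ _ → *-congʳ (*-comm _ _)))

    -- From 1 - Q^(j+k) = Q^k (1 - Q^j) + (1 - Q^k): the factors 1 - Q^j and 1 - Q^k lower the index
    -- of `u j` and `u k`, and they vanish at the ends. This is Pascal's rule for Gaussian
    -- binomials.
    pascal : ∀ m F →
      (1# - Q ^ suc m) * Γ (suc m) F ≈ Γ m (λ j k → Q ^ k * F (suc j) k + F j (suc k))
    pascal m F = begin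
      (1# - Q ^ suc m) * Γ (suc m) F                ≈⟨ Δ-*ˡ (suc m) _ (λ j k → u j * u k * F j k) ⟩
      Δ (suc m) (λ j k → (1# - Q ^ suc m) * (u j * u k * F j k))
        ≈⟨ Δ-cong (suc m) (λ j k e → trans (*-congʳ (+-congˡ (-‿cong
             (trans (reflexive (≡.cong (Q ^_) (≡.sym e))) (^-homo-* Q j k)))))
             (solve 3 (λ s t f → (:1 :- s :* t) :* f := t :* (:1 :- s) :* f :+ (:1 :- t) :* f) refl (Q ^ j) (Q ^ k)
                 (u j * u k * F j k))) ⟩
      Δ (suc m) (λ j k → X j k + Y j k)             ≈⟨ Δ-+ (suc m) X Y ⟩
      Δ (suc m) X + Δ (suc m) Y                     ≈⟨ +-cong (Δ-suc m X) refl ⟩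
      X 0 (suc m) + Δ m (λ j k → X (suc j) k) + (Δ m (λ j k → Y j (suc k)) + Y (suc m) 0)
        ≈⟨ +-cong (+-cong X-zero (Δ-cong m (λ j k _ → X-suc j k)))
                  (+-cong (Δ-cong m (λ j k _ → Y-suc j k)) Y-zero) ⟩
      0# + Δ m X′ + (Δ m Y′ + 0#)
        ≈⟨ solve 2 (λ a b → :0 :+ a :+ (b :+ :0) := a :+ b) refl _ _ ⟩
      Δ m X′ + Δ m Y′                               ≈⟨ Δ-+ m X′ Y′ ⟨
      Δ m (λ j k → X′ j k + Y′ j k)                 ≈⟨ Δ-cong m (λ _ _ _ → sym (distribˡ _ _ _)) ⟩
      Γ m (λ j k → Q ^ k * F (suc j) k + F j (suc k)) ∎
      where
      X Y X′ Y′ : ℕ → ℕ → Carrier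
      X j k  = Q ^ k * (1# - Q ^ j) * (u j * u k * F j k)
      Y j k  = (1# - Q ^ k) * (u j * u k * F j k)
      X′ j k = u j * u k * (Q ^ k * F (suc j) k)
      Y′ j k = u j * u k * F j (suc k)
      X-zero : X 0 (suc m) ≈ 0#
      X-zero = solve 2 (λ t g → t :* (:1 :- :1) :* g := :0) refl _ _
      Y-zero : Y (suc m) 0 ≈ 0#
      Y-zero = solve 1 (λ g → (:1 :- :1) :* g := :0) refl _
      X-suc : ∀ j k → X (suc j) k ≈ X′ j k
      X-suc j k = trans (solve 5 (λ t c a b f → t :* c :* (a :* b :* f) := a :* c :* b :* (t :* f)) refl _ _ _ _ _)
        (*-congʳ (*-congʳ (u-suc j)))
      Y-suc : ∀ j k → Y j (suc k) ≈ Y′ j k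
      Y-suc j k = trans (solve 4 (λ c a b f → c :* (a :* b :* f) := a :* (b :* c) :* f) refl _ _ _ _)
        (*-congʳ (*-congˡ (u-suc k)))

    -- The other Pascal rule, from 1 - Q^(j+k) = (1 - Q^j) + Q^j (1 - Q^k).
    pascal′ : ∀ m F →
      (1# - Q ^ suc m) * Γ (suc m) F ≈ Γ m (λ j k → F (suc j) k + Q ^ j * F j (suc k))
    pascal′ m F = begin
      (1# - Q ^ suc m) * Γ (suc m) F                        ≈⟨ *-congˡ (Γ-swap (suc m) F) ⟩
      (1# - Q ^ suc m) * Γ (suc m) (λ j k → F k j)          ≈⟨ pascal m (λ j k → F k j) ⟩
      Γ m (λ j k → Q ^ k * F k (suc j) + F (suc k) j)       ≈⟨ Γ-swap m _ ⟩
      Γ m (λ j k → Q ^ j * F j (suc k) + F (suc j) k)       ≈⟨ Γ-cong m (λ _ _ _ → +-comm _ _) ⟩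
      Γ m (λ j k → F (suc j) k + Q ^ j * F j (suc k))       ∎

    -- At a = 0 this is the finite q-binomial theorem, from which the triple product starts. The
    -- first identity and Bailey's lemma use it with other a.
    chu-vandermonde : ∀ a x m →
      Γ m (λ k l → poch a Q k * wt x Q k * poch (a * x * Q ^ k) Q l) ≈ u m * poch x Q m
    chu-vandermonde a x zero = trans (*-congˡ (solve 0 (:1 :* :1 :* :1 := :1) refl))
      (trans (*-congʳ (*-congʳ u-zero)) (*-congʳ (*-identityˡ _)))
    chu-vandermonde a x (suc m) = factor-cancel m (begin
      (1# - Q ^ suc m) * Γ (suc m) (F x)                         ≈⟨ pascal′ m (F x) ⟩
      Γ m (λ k l → F x (suc k) l + Q ^ k * F x k (suc l))        ≈⟨ Γ-cong m (λ k l _ → shift k l) ⟩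
      Γ m (λ k l → (1# - x) * F (x * Q) k l)                     ≈⟨ Γ-*ˡ m _ _ ⟨
      (1# - x) * Γ m (F (x * Q))                                 ≈⟨ *-congˡ (chu-vandermonde a (x * Q) m) ⟩
      (1# - x) * (u m * poch (x * Q) Q m)
        ≈⟨ *-congˡ (*-congʳ (u-suc m)) ⟨
      (1# - x) * (u (suc m) * (1# - Q ^ suc m) * poch (x * Q) Q m)
        ≈⟨ solve 4 (λ x a f p → (:1 :- x) :* (a :* f :* p) := f :* (a :* ((:1 :- x) :* p))) refl _ _ _ _ ⟩
      (1# - Q ^ suc m) * (u (suc m) * ((1# - x) * poch (x * Q) Q m))
        ≈⟨ *-congˡ (*-congˡ (poch-suc x Q m)) ⟨
      (1# - Q ^ suc m) * (u (suc m) * poch x Q (suc m))          ∎)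
      where
      F : Carrier → ℕ → ℕ → Carrier
      F x k l = poch a Q k * wt x Q k * poch (a * x * Q ^ k) Q l
      -- Both terms contain (a x Q^(k+1))_l, the second one after its first factor 1 - a x t is
      -- split off, where t = Q^k. What remains is -x (1 - a t) + (1 - a x t) = 1 - x.
      shift : ∀ k l → F x (suc k) l + Q ^ k * F x k (suc l) ≈ (1# - x) * F (x * Q) k l
      shift k l = begin
        poch a Q k * (1# - a * Q ^ k) * (wt x Q k * (- x * Q ^ k)) * poch (a * x * (Q * Q ^ k)) Q l
          + Q ^ k * (poch a Q k * wt x Q k * poch (a * x * Q ^ k) Q (suc l))
          ≈⟨ +-cong (*-congˡ (poch-cong Q l (solve 4 (λ a x q t → a :* x :* (q :* t) := a :*
              (x :* q) :* t) refl _ _ _ _)))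
               (*-congˡ (*-congˡ (trans (poch-suc _ Q l) (*-congˡ (poch-cong Q l
                 (solve 4 (λ a x q t → a :* x :* t :* q := a :* (x :* q) :* t) refl _ _ _ _)))))) ⟩
        poch a Q k * (1# - a * Q ^ k) * (wt x Q k * (- x * Q ^ k)) * P
          + Q ^ k * (poch a Q k * wt x Q k * ((1# - a * x * Q ^ k) * P))
          ≈⟨ solve 6 (λ pa w p a x t → pa :* (:1 :- a :* t) :* (w :* (:- x :* t)) :* p
               :+ t :* (pa :* w :* ((:1 :- a :* x :* t) :* p)) := (:1 :- x) :* (pa :* (t :* w) :* p))
               refl _ _ _ _ _ _ ⟩
        (1# - x) * (poch a Q k * (Q ^ k * wt x Q k) * P)
          ≈⟨ *-congˡ (*-congʳ (*-congˡ (wt-scale x Q Q k))) ⟨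
        (1# - x) * F (x * Q) k l ∎
        where P = poch (a * (x * Q) * Q ^ k) Q l

    -- Finite Jacobi triple product

    module TripleProduct (x y : Carrier) (xy≈Q : x * y ≈ Q) where

      -- W j b is the coefficient (-x)^s Q^(s(s-1)/2) of index s = j - b, negative powers
      -- of x being written as powers of y.
      W : ℕ → ℕ → Carrier
      W zero    b       = wt y Q b
      W (suc j) zero    = wt x Q (suc j)
      W (suc j) (suc b) = W j b

      W-shift : ∀ c j b → W (c ℕ.+ j) (c ℕ.+ b) ≡ W j b
      W-shift zero    j b = ≡.refl
      W-shift (suc c) j b = W-shift c j b

      W-right : ∀ j → W j 0 ≡ wt x Q j
      W-right zero    = ≡.refl
      W-right (suc j) = ≡.refl

      -- The ratio of the coefficients of index s and s - 1 is -x Q^(s-1). Multiplying by -y Q^b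
      -- with x y = Q clears the division, since b + s = j for s = j - b.
      W-suc : ∀ j b → - y * Q ^ b * W j b ≈ Q ^ j * W j (suc b)
      W-suc zero b = solve 3 (λ y t w → :- y :* t :* w := :1 :* (w :* (:- y :* t))) refl _ _ _
      W-suc (suc j) zero = begin
        - y * 1# * (wt x Q j * (- x * Q ^ j))
          ≈⟨ solve 4 (λ x y w t → :- y :* :1 :* (w :* (:- x :* t)) := x :* y :* t :* w) refl _ _ _ _ ⟩
        x * y * Q ^ j * wt x Q j   ≈⟨ *-cong (*-congʳ xy≈Q) (reflexive (≡.sym (W-right j))) ⟩
        Q * Q ^ j * W j 0          ∎
      W-suc (suc j) (suc b) = begin
        - y * (Q * Q ^ b) * W j b      ≈⟨ solve 4 (λ y q t w → :- y :* (q :* t) :* w := q :*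
            (:- y :* t :* w)) refl _ _ _ _ ⟩
        Q * (- y * Q ^ b * W j b)      ≈⟨ *-congˡ (W-suc j b) ⟩
        Q * (Q ^ j * W j (suc b))      ≈⟨ *-assoc _ _ _ ⟨
        Q * Q ^ j * W j (suc b)        ∎

      -- Induction on b from the q-binomial theorem. By `W-suc` the two halves of a Pascal step are
      -- proportional and add up to the new factor 1 - y Q^b.
      triple-product : ∀ a b → Γ (a ℕ.+ b) (λ j k → W j b) ≈ u (a ℕ.+ b) * (poch x Q a * poch y Q b)
      triple-product a zero = begin
        Γ (a ℕ.+ 0) (λ j k → W j 0)
          ≈⟨ Γ-cong (a ℕ.+ 0) (λ j k _ → trans (reflexive (W-right j)) (sym (trans
               (*-cong (*-congʳ (poch-zero Q j)) (trans (poch-cong Q k (trans (*-congʳ (zeroˡ x)) (zeroˡ _)))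
                   (poch-zero Q k)))
               (trans (*-identityʳ _) (*-identityˡ _))))) ⟩
        Γ (a ℕ.+ 0) (λ k l → poch 0# Q k * wt x Q k * poch (0# * x * Q ^ k) Q l)
          ≈⟨ chu-vandermonde 0# x (a ℕ.+ 0) ⟩
        u (a ℕ.+ 0) * poch x Q (a ℕ.+ 0)
          ≈⟨ *-congˡ (trans (reflexive (≡.cong (poch x Q) (ℕ.+-identityʳ a))) (sym (*-identityʳ _))) ⟩
        u (a ℕ.+ 0) * (poch x Q a * 1#) ∎
      triple-product a (suc b) rewrite ℕ.+-suc a b = factor-cancel (a ℕ.+ b) (begin
        (1# - Q ^ suc (a ℕ.+ b)) * Γ (suc (a ℕ.+ b)) (λ j k → W j (suc b))
          ≈⟨ pascal′ (a ℕ.+ b) (λ j k → W j (suc b)) ⟩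
        Γ (a ℕ.+ b) (λ j k → W j b + Q ^ j * W j (suc b))
          ≈⟨ Γ-cong (a ℕ.+ b) (λ j k _ → trans (+-congˡ (sym (W-suc j b)))
               (solve 3 (λ y t w → w :+ :- y :* t :* w := (:1 :- y :* t) :* w) refl _ _ _)) ⟩
        Γ (a ℕ.+ b) (λ j k → (1# - y * Q ^ b) * W j b)
          ≈⟨ Γ-*ˡ (a ℕ.+ b) _ _ ⟨
        (1# - y * Q ^ b) * Γ (a ℕ.+ b) (λ j k → W j b)
          ≈⟨ *-congˡ (trans (triple-product a b) (*-congʳ (sym (u-suc (a ℕ.+ b))))) ⟩
        (1# - y * Q ^ b) * (u (suc (a ℕ.+ b)) * (1# - Q ^ suc (a ℕ.+ b)) * (poch x Q a * poch y Q b))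
          ≈⟨ solve 5 (λ e a f p r → e :* (a :* f :* (p :* r)) := f :* (a :* (p :* (r :* e)))) refl _ _ _ _ _ ⟩
        (1# - Q ^ suc (a ℕ.+ b)) * (u (suc (a ℕ.+ b)) * (poch x Q a * poch y Q (suc b)))
          ∎)

      -- The bilateral theta series folded to r ≥ 0. Index r is paired with -r in `θ-even` and with
      -- -1-r in `θ-odd`, because these pairs have the same weight u u in the finite triple product
      -- with a = b = n and with a = n, b = n + 1.
      θ-even θ-odd : ℕ → Carrier
      θ-even zero    = 1#
      θ-even (suc r) = wt x Q (suc r) + wt y Q (suc r)
      θ-odd r        = wt x Q r + wt y Q (suc r)

      -- Serves twice: read as a Bailey pair with s = 0 it computes β from α = `θ-even`, and its
      -- limit n → ∞ sums the theta series.
      triple-product-even : ∀ n →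
        Δ n (λ r k → θ-even r * (u k * u (k ℕ.+ 2 ℕ.* r))) ≈ u (2 ℕ.* n) * (poch x Q n * poch y Q n)
      triple-product-even n = sym (begin
        u (2 ℕ.* n) * (poch x Q n * poch y Q n)
          ≡⟨ ≡.cong (λ m → u m * (poch x Q n * poch y Q n)) 2n ⟩
        u (n ℕ.+ n) * (poch x Q n * poch y Q n)
          ≈⟨ triple-product n n ⟨
        Γ (n ℕ.+ n) (λ j k → W j n)
          ≡⟨ ≡.cong (λ m → Γ m (λ j k → W j n)) (≡.sym 2n) ⟩
        Γ (2 ℕ.* n) (λ j k → W j n)
          ≈⟨ Δ-even n _ ⟩
        Δ n (fold-even (λ j k → u j * u k * W j n))
          ≈⟨ Δ-cong n fold ⟩
        Δ n (λ r k → θ-even r * (u k * u (k ℕ.+ 2 ℕ.* r)))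
          ∎)
        where
        2n : 2 ℕ.* n ≡ n ℕ.+ n
        2n = ≡.cong (n ℕ.+_) (ℕ.+-identityʳ n)
        fold : ∀ r k → r ℕ.+ k ≡ n →
          fold-even (λ j k → u j * u k * W j n) r k ≈ θ-even r * (u k * u (k ℕ.+ 2 ℕ.* r))
        fold zero k ≡.refl = trans
          (*-congˡ (reflexive (≡.trans (≡.cong (λ i → W i i) (≡.sym (ℕ.+-identityʳ k))) (W-shift k 0 0))))
          (trans (*-comm _ _) (*-congˡ (*-congˡ (reflexive (≡.cong u (≡.sym (ℕ.+-identityʳ k)))))))
        fold (suc r) k ≡.refl = begin
          u (k ℕ.+ 2 ℕ.* suc r) * u k * W (k ℕ.+ 2 ℕ.* suc r) (suc r ℕ.+ k)
            + u k * u (k ℕ.+ 2 ℕ.* suc r) * W k (suc r ℕ.+ k)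
            ≡⟨ ≡.cong₂ (λ s t → u (k ℕ.+ 2 ℕ.* suc r) * u k * s + u k * u (k ℕ.+ 2 ℕ.* suc r) * t) right left ⟩
          u (k ℕ.+ 2 ℕ.* suc r) * u k * wt x Q (suc r) + u k * u (k ℕ.+ 2 ℕ.* suc r) * wt y Q (suc r)
            ≈⟨ solve 4 (λ a b s t → b :* a :* s :+ a :* b :* t := (s :+ t) :* (a :* b)) refl _ _ _ _ ⟩
          θ-even (suc r) * (u k * u (k ℕ.+ 2 ℕ.* suc r)) ∎
          where
          right : W (k ℕ.+ 2 ℕ.* suc r) (suc r ℕ.+ k) ≡ wt x Q (suc r)
          right = ≡.trans (≡.cong (W (k ℕ.+ 2 ℕ.* suc r)) (ℕ.+-comm (suc r) k)) (≡.trans (W-shift k (2 ℕ.* suc r)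
              (suc r))
            (≡.trans (≡.cong₂ W (≡.cong (suc r ℕ.+_) (ℕ.+-identityʳ (suc r))) (≡.sym (ℕ.+-identityʳ (suc r))))
            (W-shift (suc r) (suc r) 0)))
          left : W k (suc r ℕ.+ k) ≡ wt y Q (suc r)
          left = ≡.trans (≡.cong₂ W (≡.sym (ℕ.+-identityʳ k)) (ℕ.+-comm (suc r) k)) (W-shift k 0 (suc r))

      triple-product-odd : ∀ n →
        Δ n (λ r k → θ-odd r * (u k * u (k ℕ.+ suc (2 ℕ.* r)))) ≈ u (suc (2 ℕ.* n)) * (poch x Q n * poch y Q (suc n))
      triple-product-odd n = sym (begin
        u (suc (2 ℕ.* n)) * (poch x Q n * poch y Q (suc n))
          ≡⟨ ≡.cong (λ m → u m * (poch x Q n * poch y Q (suc n))) 2n ⟩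
        u (n ℕ.+ suc n) * (poch x Q n * poch y Q (suc n))
          ≈⟨ triple-product n (suc n) ⟨
        Γ (n ℕ.+ suc n) (λ j k → W j (suc n))
          ≡⟨ ≡.cong (λ m → Γ m (λ j k → W j (suc n))) (≡.sym 2n) ⟩
        Γ (suc (2 ℕ.* n)) (λ j k → W j (suc n))
          ≈⟨ Δ-odd n (λ j k → u j * u k * W j (suc n)) ⟩
        Δ n (λ r k → u (k ℕ.+ suc (2 ℕ.* r)) * u k * W (k ℕ.+ suc (2 ℕ.* r)) (suc n)
                   + u k * u (k ℕ.+ suc (2 ℕ.* r)) * W k (suc n))
          ≈⟨ Δ-cong n fold ⟩
        Δ n (λ r k → θ-odd r * (u k * u (k ℕ.+ suc (2 ℕ.* r))))
          ∎)
        where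
        2n : suc (2 ℕ.* n) ≡ n ℕ.+ suc n
        2n = ≡.trans (≡.cong suc (≡.cong (n ℕ.+_) (ℕ.+-identityʳ n))) (≡.sym (ℕ.+-suc n n))
        fold : ∀ r k → r ℕ.+ k ≡ n →
          u (k ℕ.+ suc (2 ℕ.* r)) * u k * W (k ℕ.+ suc (2 ℕ.* r)) (suc n)
            + u k * u (k ℕ.+ suc (2 ℕ.* r)) * W k (suc n)
          ≈ θ-odd r * (u k * u (k ℕ.+ suc (2 ℕ.* r)))
        fold r k ≡.refl = begin
          u (k ℕ.+ suc (2 ℕ.* r)) * u k * W (k ℕ.+ suc (2 ℕ.* r)) (suc r ℕ.+ k)
            + u k * u (k ℕ.+ suc (2 ℕ.* r)) * W k (suc r ℕ.+ k)
            ≡⟨ ≡.cong₂ (λ s t → u (k ℕ.+ suc (2 ℕ.* r)) * u k * s + u k * u (k ℕ.+ suc (2 ℕ.* r)) * t) right left ⟩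
          u (k ℕ.+ suc (2 ℕ.* r)) * u k * wt x Q r + u k * u (k ℕ.+ suc (2 ℕ.* r)) * wt y Q (suc r)
            ≈⟨ solve 4 (λ a b s t → b :* a :* s :+ a :* b :* t := (s :+ t) :* (a :* b)) refl _ _ _ _ ⟩
          θ-odd r * (u k * u (k ℕ.+ suc (2 ℕ.* r))) ∎
          where
          right : W (k ℕ.+ suc (2 ℕ.* r)) (suc r ℕ.+ k) ≡ wt x Q r
          right = ≡.trans (≡.cong (W (k ℕ.+ suc (2 ℕ.* r))) (ℕ.+-comm (suc r) k)) (≡.trans (W-shift k (suc (2 ℕ.* r))
              (suc r))
            (≡.trans (≡.cong₂ W (≡.cong (r ℕ.+_) (ℕ.+-identityʳ r)) (≡.sym (ℕ.+-identityʳ r)))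
            (≡.trans (W-shift r r 0) (W-right r))))
          left : W k (suc r ℕ.+ k) ≡ wt y Q (suc r)
          left = ≡.trans (≡.cong₂ W (≡.sym (ℕ.+-identityʳ k)) (ℕ.+-comm (suc r) k)) (W-shift k 0 (suc r))

    -- Bailey's lemma in finite form

    -- Bailey's lemma relative to Q^s, with one of its two free parameters sent to infinity. The
    -- parameter σ stands for the quotient Q^(1+s) / ρ.
    module Bailey (s : ℕ) (ρ σ : Carrier) (ρσ≈Q^1+s : ρ * σ ≈ Q ^ suc s) where

      -- With k = n - r the second index is n + r + s. The customary denominator (Q^(s+1);Q)_{n+r}
      -- is (Q;Q)_{n+r+s} / (Q;Q)_s, so β differs from the usual one only by the constant (Q;Q)_s.
      β : (ℕ → Carrier) → ℕ → Carrier
      β α n = Δ n (λ r k → α r * (u k * u (k ℕ.+ (s ℕ.+ 2 ℕ.* r))))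

      δ : ℕ → Carrier
      δ n = poch ρ Q n * wt σ Q n

      δ-+ : ∀ r k → δ (r ℕ.+ k) ≈ δ r * (poch (ρ * Q ^ r) Q k * wt (σ * Q ^ r) Q k)
      δ-+ r k = trans (*-cong (poch-+ ρ Q r k) (wt-+ σ Q r k))
        (solve 4 (λ a b c d → a :* b :* (c :* d) := a :* c :* (b :* d)) refl _ _ _ _)

      -- The inner Chu-Vandermonde sum has a = ρ Q^r and x = σ Q^r. Its parameter a x Q^k has to be
      -- the power of Q at which `u-tail` continues the reciprocal of index k + s + 2r.
      parameter : ∀ r k → ρ * Q ^ r * (σ * Q ^ r) * Q ^ k ≈ Q ^ suc (k ℕ.+ (s ℕ.+ 2 ℕ.* r))
      parameter r k = begin
        ρ * Q ^ r * (σ * Q ^ r) * Q ^ k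
          ≈⟨ solve 4 (λ p s t w → p :* t :* (s :* t) :* w := p :* s :* (t :* (t :* :1)) :* w) refl _ _ _ _ ⟩
        ρ * σ * (Q ^ r) ^ 2 * Q ^ k
          ≈⟨ *-congʳ (*-cong ρσ≈Q^1+s (trans (^-assocʳ Q r 2) (reflexive (≡.cong (Q ^_) (ℕ.*-comm r 2))))) ⟩
        Q ^ suc s * Q ^ (2 ℕ.* r) * Q ^ k
          ≈⟨ *-congʳ (^-homo-* Q (suc s) (2 ℕ.* r)) ⟨
        Q ^ suc (s ℕ.+ 2 ℕ.* r) * Q ^ k
          ≈⟨ ^-homo-* Q (suc (s ℕ.+ 2 ℕ.* r)) k ⟨
        Q ^ suc (s ℕ.+ 2 ℕ.* r ℕ.+ k)
          ≡⟨ ≡.cong (λ m → Q ^ suc m) (ℕ.+-comm (s ℕ.+ 2 ℕ.* r) k) ⟩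
        Q ^ suc (k ℕ.+ (s ℕ.+ 2 ℕ.* r)) ∎

      -- The weight `u l` with n + l = N truncates the lemma. After the triple sum is rearranged,
      -- the part with fixed r is a complete Chu-Vandermonde sum over k + l = m.
      bailey : ∀ α N →
        Δ N (λ n l → δ n * β α n * u l) ≈
        Δ N (λ r m → α r * δ r * poch (σ * Q ^ r) Q m * (u m * u (m ℕ.+ (s ℕ.+ 2 ℕ.* r))))
      bailey α N = begin
        Δ N (λ n l → δ n * β α n * u l)
          ≈⟨ Δ-cong N (λ n l _ → trans (solve 3 (λ a b c → a :* b :* c := a :* c :* b) refl _ _ _) (Δ-*ˡ n _ _)) ⟩
        Δ N (λ n l → Δ n (λ r k → δ n * u l * (α r * (u k * u (k ℕ.+ (s ℕ.+ 2 ℕ.* r))))))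
          ≈⟨ Δ-cong N (λ n l _ → Δ-cong n (λ r k e →
               *-congʳ (*-congʳ (reflexive (≡.cong δ (≡.sym e)))))) ⟩
        Δ N (λ n l → Δ n (λ r k → δ (r ℕ.+ k) * u l * (α r * (u k * u (k ℕ.+ (s ℕ.+ 2 ℕ.* r))))))
          ≈⟨ Δ-assoc N (λ r k l → δ (r ℕ.+ k) * u l * (α r * (u k * u (k ℕ.+ (s ℕ.+ 2 ℕ.* r))))) ⟩
        Δ N (λ r m → Δ m (λ k l → δ (r ℕ.+ k) * u l * (α r * (u k * u (k ℕ.+ (s ℕ.+ 2 ℕ.* r))))))
          ≈⟨ Δ-cong N (λ r m _ → inner r m) ⟩
        Δ N (λ r m → α r * δ r * poch (σ * Q ^ r) Q m * (u m * u (m ℕ.+ (s ℕ.+ 2 ℕ.* r)))) ∎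
        where
        inner : ∀ r m →
          Δ m (λ k l → δ (r ℕ.+ k) * u l * (α r * (u k * u (k ℕ.+ (s ℕ.+ 2 ℕ.* r))))) ≈
          α r * δ r * poch (σ * Q ^ r) Q m * (u m * u (m ℕ.+ (s ℕ.+ 2 ℕ.* r)))
        inner r m = begin
          Δ m (λ k l → δ (r ℕ.+ k) * u l * (α r * (u k * u (k ℕ.+ c))))
            ≈⟨ Δ-cong m (λ k l e → trans (*-cong (*-congʳ (δ-+ r k)) (*-congˡ (*-congˡ (tail k l e))))
                 (solve 8 (λ d p w ul a uk um t → d :* (p :* w) :* ul :* (a :* (uk :* (um :* t))) :=
                   a :* d :* um :* (uk :* ul :* (p :* w :* t))) refl _ _ _ _ _ _ _ _)) ⟩
          Δ m (λ k l → α r * δ r * u (m ℕ.+ c) * (u k * u l * (poch (ρ * Q ^ r) Q k * wt (σ * Q ^ r) Q k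
                 * poch (ρ * Q ^ r * (σ * Q ^ r) * Q ^ k) Q l)))
            ≈⟨ Δ-*ˡ m _ _ ⟨
          α r * δ r * u (m ℕ.+ c) * Γ m (λ k l → poch (ρ * Q ^ r) Q k * wt (σ * Q ^ r) Q k
                 * poch (ρ * Q ^ r * (σ * Q ^ r) * Q ^ k) Q l)
            ≈⟨ *-congˡ (chu-vandermonde (ρ * Q ^ r) (σ * Q ^ r) m) ⟩
          α r * δ r * u (m ℕ.+ c) * (u m * poch (σ * Q ^ r) Q m)
            ≈⟨ solve 5 (λ a d v w p → a :* d :* v :* (w :* p) := a :* d :* p :* (w :* v)) refl _ _ _ _ _ ⟩
          α r * δ r * poch (σ * Q ^ r) Q m * (u m * u (m ℕ.+ c)) ∎
          where
          c = s ℕ.+ 2 ℕ.* r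
          tail : ∀ k l → k ℕ.+ l ≡ m →
            u (k ℕ.+ c) ≈ u (m ℕ.+ c) * poch (ρ * Q ^ r * (σ * Q ^ r) * Q ^ k) Q l
          tail k l ≡.refl = begin
            u (k ℕ.+ c)
              ≈⟨ u-tail (k ℕ.+ c) l ⟨
            u (k ℕ.+ c ℕ.+ l) * poch (Q ^ suc (k ℕ.+ c)) Q l
              ≈⟨ *-cong (reflexive (≡.cong u (≡.trans (ℕ.+-assoc k c l)
                   (≡.trans (≡.cong (k ℕ.+_) (ℕ.+-comm c l)) (≡.sym (ℕ.+-assoc k l c))))))
                   (poch-cong Q l (sym (parameter r k))) ⟩
            u (k ℕ.+ l ℕ.+ c) * poch (ρ * Q ^ r * (σ * Q ^ r) * Q ^ k) Q l ∎

  -- Bailey pair with triangular exponents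

  module TriangularPair (q : Carrier) (u : ℕ → Carrier) (u-zero : u 0 ≈ 1#)
    (u-suc : ∀ n → u (suc n) * (1# - (q ^ 2) ^ suc n) ≈ u n)
    (p : ℕ → Carrier) (p-zero : p 0 ≈ 1#)
    (p-suc : ∀ n → p (suc n) * (1# - q ^ suc n) ≈ p n) where
    open Reciprocals (q ^ 2) u u-zero u-suc

    -- q^T(n) with T(n) = n(n+1)/2, and its extension q^T(j-k), where T(-n) = T(n-1).
    τ : ℕ → Carrier
    τ zero    = 1#
    τ (suc n) = τ n * q ^ suc n

    τ₂ : ℕ → ℕ → Carrier
    τ₂ j       zero    = τ j
    τ₂ zero    (suc k) = τ k
    τ₂ (suc j) (suc k) = τ₂ j k

    τ₂-zero : ∀ j → τ₂ j 0 ≡ τ j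
    τ₂-zero zero    = ≡.refl
    τ₂-zero (suc j) = ≡.refl

    τ₂-shift : ∀ c j k → τ₂ (c ℕ.+ j) (c ℕ.+ k) ≡ τ₂ j k
    τ₂-shift zero    j k = ≡.refl
    τ₂-shift (suc c) j k = τ₂-shift c j k

    -- T(-1-d) = T(d) at d = k - j.
    τ₂-reflect : ∀ j k → τ₂ j (suc k) ≡ τ₂ k j
    τ₂-reflect zero    zero    = ≡.refl
    τ₂-reflect zero    (suc k) = ≡.refl
    τ₂-reflect (suc j) zero    = τ₂-zero j
    τ₂-reflect (suc j) (suc k) = τ₂-reflect j k

    -- T(d+1) = T(d) + d + 1 at d = j - k. Adding 2k clears negative exponents, as 2k + d + 1 = j +
    -- k + 1.
    τ₂-suc : ∀ j k → (q ^ 2) ^ k * τ₂ (suc j) k ≈ q ^ suc (j ℕ.+ k) * τ₂ j k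
    τ₂-suc j zero = begin
      1# * (τ j * (q * q ^ j))          ≈⟨ solve 2 (λ a b → :1 :* (a :* b) := b :* a) refl _ _ ⟩
      q ^ suc j * τ j                   ≡⟨ ≡.cong₂ (λ m t → q ^ suc m * t) (≡.sym (ℕ.+-identityʳ j)) (≡.sym
          (τ₂-zero j)) ⟩
      q ^ suc (j ℕ.+ 0) * τ₂ j 0        ∎
    τ₂-suc zero (suc zero) = solve 1 (λ q → (q :* (q :* :1)) :* :1 :* :1 := q :* (q :* :1) :* :1) refl q
    τ₂-suc zero (suc (suc k)) = begin
      (q ^ 2) ^ suc (suc k) * τ k
        ≈⟨ *-congʳ (*-congˡ (^-distrib-* q (q ^ 1) (suc k))) ⟩
      q ^ 2 * (q ^ suc k * (q ^ 1) ^ suc k) * τ k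
        ≈⟨ *-congʳ (*-congˡ (*-congˡ (trans (^-assocʳ q 1 (suc k)) (reflexive (≡.cong (q ^_) (ℕ.*-identityˡ
            (suc k))))))) ⟩
      q ^ 2 * (q ^ suc k * q ^ suc k) * τ k
        ≈⟨ solve 3 (λ q a t → (q :* (q :* :1)) :* (a :* a) :* t := q :* (q :* a) :* (t :* a)) refl _ _ _ ⟩
      q ^ suc (suc (suc k)) * (τ k * q ^ suc k) ∎
    τ₂-suc (suc j) (suc k) = begin
      q ^ 2 * (q ^ 2) ^ k * τ₂ (suc j) k
        ≈⟨ *-assoc _ _ _ ⟩
      q ^ 2 * ((q ^ 2) ^ k * τ₂ (suc j) k)
        ≈⟨ *-congˡ (τ₂-suc j k) ⟩
      q ^ 2 * (q ^ suc (j ℕ.+ k) * τ₂ j k)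
        ≈⟨ solve 3 (λ q a t → (q :* (q :* :1)) :* (a :* t) := q :* (q :* a) :* t) refl _ _ _ ⟩
      q ^ suc (suc (suc (j ℕ.+ k))) * τ₂ j k
        ≡⟨ ≡.cong (λ m → q ^ suc (suc m) * τ₂ j k) (≡.sym (ℕ.+-suc j k)) ⟩
      q ^ suc (suc j ℕ.+ suc k) * τ₂ j k ∎

    -- On j + k = m the power q^(j+k+1) is constant, so a Pascal step multiplies the sum by 1 +
    -- q^(m+1). Since 1 - q^(2m+2) = (1 - q^(m+1)) (1 + q^(m+1)), this is the recurrence of `p`.
    τ-sum : ∀ m → Γ m τ₂ ≈ p m
    τ-sum zero    = trans (*-cong (*-cong u-zero u-zero) refl) (trans (solve 0 (:1 :* :1 :* :1 := :1) refl)
        (sym p-zero))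
    τ-sum (suc m) = factor-cancel m (begin
      (1# - (q ^ 2) ^ suc m) * Γ (suc m) τ₂
        ≈⟨ pascal m τ₂ ⟩
      Γ m (λ j k → (q ^ 2) ^ k * τ₂ (suc j) k + τ₂ j (suc k))
        ≈⟨ Γ-cong m (λ j k e → +-cong (trans (τ₂-suc j k) (*-congʳ (reflexive (≡.cong (λ n → q ^ suc n) e))))
             (reflexive (τ₂-reflect j k))) ⟩
      Γ m (λ j k → q ^ suc m * τ₂ j k + τ₂ k j)
        ≈⟨ trans (Δ-cong m (λ _ _ _ → distribˡ _ _ _)) (Δ-+ m _ _) ⟩
      Γ m (λ j k → q ^ suc m * τ₂ j k) + Γ m (λ j k → τ₂ k j)
        ≈⟨ +-cong (sym (Γ-*ˡ m _ _)) (sym (Γ-swap m τ₂)) ⟩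
      q ^ suc m * Γ m τ₂ + Γ m τ₂
        ≈⟨ solve 2 (λ a b → a :* b :+ b := (:1 :+ a) :* b) refl _ _ ⟩
      (1# + q ^ suc m) * Γ m τ₂
        ≈⟨ *-congˡ (trans (τ-sum m) (sym (p-suc m))) ⟩
      (1# + q ^ suc m) * (p (suc m) * (1# - q ^ suc m))
        ≈⟨ solve 2 (λ a b → (:1 :+ a) :* (b :* (:1 :- a)) := (:1 :- a :* (a :* :1)) :* b) refl _ _ ⟩
      (1# - (q ^ suc m) ^ 2) * p (suc m)
        ≈⟨ *-congʳ (+-congˡ (-‿cong (trans (^-assocʳ q (suc m) 2) (trans (reflexive (≡.cong (q ^_) (ℕ.*-comm
            (suc m) 2))) (^-2* q (suc m)))))) ⟩
      (1# - (q ^ 2) ^ suc m) * p (suc m)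
        ∎)

    -- The exponents T(2r) and T(-2r) = T(2r-1), hence the predecessor.
    τ-even : ℕ → Carrier
    τ-even zero    = 1#
    τ-even (suc r) = τ (2 ℕ.* suc r) + τ (ℕ.pred (2 ℕ.* suc r))

    τ-sum-even : ∀ n → Δ n (λ r k → τ-even r * (u k * u (k ℕ.+ 2 ℕ.* r))) ≈ p (2 ℕ.* n)
    τ-sum-even n = sym (begin
      p (2 ℕ.* n)                                            ≈⟨ τ-sum (2 ℕ.* n) ⟨
      Γ (2 ℕ.* n) τ₂                                         ≈⟨ Δ-even n _ ⟩
      Δ n (fold-even (λ j k → u j * u k * τ₂ j k))           ≈⟨ Δ-cong n (λ r k _ → fold r k) ⟩
      Δ n (λ r k → τ-even r * (u k * u (k ℕ.+ 2 ℕ.* r)))     ∎)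
      where
      fold : ∀ r k → fold-even (λ j k → u j * u k * τ₂ j k) r k ≈ τ-even r * (u k * u (k ℕ.+ 2 ℕ.* r))
      fold zero k = trans
        (*-congˡ (reflexive (≡.trans (≡.cong (λ i → τ₂ i i) (≡.sym (ℕ.+-identityʳ k))) (τ₂-shift k 0 0))))
        (trans (*-comm _ _) (*-congˡ (*-congˡ (reflexive (≡.cong u (≡.sym (ℕ.+-identityʳ k)))))))
      fold (suc r) k = begin
        u (k ℕ.+ 2 ℕ.* suc r) * u k * τ₂ (k ℕ.+ 2 ℕ.* suc r) k
          + u k * u (k ℕ.+ 2 ℕ.* suc r) * τ₂ k (k ℕ.+ 2 ℕ.* suc r)
          ≡⟨ ≡.cong₂ (λ s t → u (k ℕ.+ 2 ℕ.* suc r) * u k * s + u k * u (k ℕ.+ 2 ℕ.* suc r) * t) right left ⟩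
        u (k ℕ.+ 2 ℕ.* suc r) * u k * τ (2 ℕ.* suc r) + u k * u (k ℕ.+ 2 ℕ.* suc r) * τ (ℕ.pred (2 ℕ.* suc r))
          ≈⟨ solve 4 (λ a b s t → b :* a :* s :+ a :* b :* t := (s :+ t) :* (a :* b)) refl _ _ _ _ ⟩
        τ-even (suc r) * (u k * u (k ℕ.+ 2 ℕ.* suc r)) ∎
        where
        right : τ₂ (k ℕ.+ 2 ℕ.* suc r) k ≡ τ (2 ℕ.* suc r)
        right = ≡.trans (≡.cong (τ₂ (k ℕ.+ 2 ℕ.* suc r)) (≡.sym (ℕ.+-identityʳ k))) (τ₂-shift k (2 ℕ.* suc r) 0)
        left : τ₂ k (k ℕ.+ 2 ℕ.* suc r) ≡ τ (ℕ.pred (2 ℕ.* suc r))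
        left = ≡.trans (≡.cong (λ i → τ₂ i (k ℕ.+ 2 ℕ.* suc r)) (≡.sym (ℕ.+-identityʳ k))) (τ₂-shift k 0 (2 ℕ.* suc r))

-- Rational inequalities, powers and planar norms

module RationalBounds where
  open +-*-Solver

  0≤-+ : ∀ {a b} → 0ℚ ℚ.≤ a → 0ℚ ℚ.≤ b → 0ℚ ℚ.≤ a ℚ.+ b
  0≤-+ = ℚ.+-mono-≤

  0≤-* : ∀ {a b} → 0ℚ ℚ.≤ a → 0ℚ ℚ.≤ b → 0ℚ ℚ.≤ a ℚ.* b
  0≤-* {a} {b} 0≤a 0≤b = ℚ.≤-trans (ℚ.≤-reflexive (≡.sym (ℚ.*-zeroˡ b)))
    (ℚ.*-monoʳ-≤-nonNeg b {{ℚ.nonNegative 0≤b}} 0≤a)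

  0<-* : ∀ {a b} → 0ℚ ℚ.< a → 0ℚ ℚ.< b → 0ℚ ℚ.< a ℚ.* b
  0<-* {a} {b} 0<a 0<b = ℚ.≤-<-trans (ℚ.≤-reflexive (≡.sym (ℚ.*-zeroʳ a)))
    (ℚ.*-monoʳ-<-pos a {{ℚ.positive 0<a}} 0<b)

  *-mono-≤ : ∀ {a b c d} → 0ℚ ℚ.≤ b → 0ℚ ℚ.≤ c → a ℚ.≤ b → c ℚ.≤ d → a ℚ.* c ℚ.≤ b ℚ.* d
  *-mono-≤ {b = b} {c} 0≤b 0≤c a≤b c≤d = ℚ.≤-trans
    (ℚ.*-monoʳ-≤-nonNeg c {{ℚ.nonNegative 0≤c}} a≤b)
    (ℚ.*-monoˡ-≤-nonNeg b {{ℚ.nonNegative 0≤b}} c≤d)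

  -- Reduces an inequality to a polynomial identity, left to the ring solver, and the sign of the
  -- difference d.
  ≤-+-nonNeg : ∀ {a b d} → b ≡ a ℚ.+ d → 0ℚ ℚ.≤ d → a ℚ.≤ b
  ≤-+-nonNeg {a} {d = d} ≡.refl 0≤d =
    ℚ.≤-trans (ℚ.≤-reflexive (≡.sym (ℚ.+-identityʳ a))) (ℚ.+-monoʳ-≤ a 0≤d)

  <-+-pos : ∀ {a b d} → b ≡ a ℚ.+ d → 0ℚ ℚ.< d → a ℚ.< b
  <-+-pos {a} {d = d} ≡.refl 0<d =
    ℚ.≤-<-trans (ℚ.≤-reflexive (≡.sym (ℚ.+-identityʳ a))) (ℚ.+-monoʳ-< a 0<d)

  ∸-nonNeg : ∀ {a b} → a ℚ.≤ b → 0ℚ ℚ.≤ b ℚ.- a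
  ∸-nonNeg {a} {b} a≤b = ℚ.≤-trans (ℚ.≤-reflexive (≡.sym (ℚ.+-inverseʳ a))) (ℚ.+-monoˡ-≤ (ℚ.- a) a≤b)

  ∸-pos : ∀ {a b} → a ℚ.< b → 0ℚ ℚ.< b ℚ.- a
  ∸-pos {a} {b} a<b = ℚ.≤-<-trans (ℚ.≤-reflexive (≡.sym (ℚ.+-inverseʳ a))) (ℚ.+-monoˡ-< (ℚ.- a) a<b)

  square-nonNeg : ∀ a → 0ℚ ℚ.≤ a ℚ.* a
  square-nonNeg a with ℚ.≤-total 0ℚ a
  ... | inj₁ 0≤a = 0≤-* 0≤a 0≤a
  ... | inj₂ a≤0 = ℚ.≤-trans (0≤-* 0≤-a 0≤-a) (ℚ.≤-reflexive (solve 1 (λ a → (:- a) :* (:- a) := a :* a) ≡.refl a))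
    where 0≤-a = ℚ.neg-antimono-≤ a≤0

  ∣a∣²≡a² : ∀ a → ℚ.∣ a ∣ ℚ.* ℚ.∣ a ∣ ≡ a ℚ.* a
  ∣a∣²≡a² a = ≡.trans (≡.sym (ℚ.∣p*q∣≡∣p∣*∣q∣ a a)) (ℚ.0≤p⇒∣p∣≡p (square-nonNeg a))

  square-≤⇒∣∣≤ : ∀ {a b} → 0ℚ ℚ.≤ b → a ℚ.* a ℚ.≤ b ℚ.* b → ℚ.∣ a ∣ ℚ.≤ b
  square-≤⇒∣∣≤ {a} {b} 0≤b a²≤b² with ℚ.∣ a ∣ ℚ.≤? b
  ... | yes h = h
  ... | no ¬h = ⊥-elim (ℚ.<-irrefl ≡.refl (begin-strict
      b ℚ.* b                 ≤⟨ ℚ.*-monoˡ-≤-nonNeg b {{ℚ.nonNegative 0≤b}} (ℚ.<⇒≤ b<a) ⟩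
      b ℚ.* ℚ.∣ a ∣           <⟨ ℚ.*-monoˡ-<-pos ℚ.∣ a ∣ {{ℚ.positive (ℚ.≤-<-trans 0≤b b<a)}} b<a ⟩
      ℚ.∣ a ∣ ℚ.* ℚ.∣ a ∣     ≡⟨ ∣a∣²≡a² a ⟩
      a ℚ.* a                 ≤⟨ a²≤b² ⟩
      b ℚ.* b                 ∎))
    where
    open ℚ.≤-Reasoning
    b<a = ℚ.≰⇒> ¬h

  -- Built with the explicit denominator 1, so that numerator and denominator compute.
  ι : ℕ → ℚ
  ι n = mkℚ (+ n) 0 (Coprime.sym (Coprime.1-coprimeTo n))

  ι-suc : ∀ n → ι (suc n) ≡ 1ℚ ℚ.+ ι n
  ι-suc n = ℚ.toℚᵘ-injective (ℚᵘ.≃-sym (ℚᵘ.≃-trans (ℚ.toℚᵘ-homo-+ 1ℚ (ι n))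
    (ℚᵘ.*≡* (≡.cong (ℤ._* + 1) (≡.cong (ℤ._+_ (+ 1)) (ℤ.*-identityʳ (+ n)))))))

  ≤-ι : ∀ p → ∃[ n ] p ℚ.≤ ι n
  ≤-ι (mkℚ (+ a) d c) = a , ℚ.*≤* (ℤ.*-monoˡ-≤-nonNeg (+ a) (ℤ.+≤+ (ℕ.s≤s ℕ.z≤n)))
  ≤-ι (mkℚ -[1+ a ] d c) = 0 , ℚ.*≤* ℤ.-≤+

  infixr 8 _^ℚ_
  _^ℚ_ : ℚ → ℕ → ℚ
  r ^ℚ zero  = 1ℚ
  r ^ℚ suc n = r ℚ.* r ^ℚ n

  ^ℚ-+ : ∀ r m n → r ^ℚ (m ℕ.+ n) ≡ r ^ℚ m ℚ.* r ^ℚ n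
  ^ℚ-+ r zero    n = ≡.sym (ℚ.*-identityˡ _)
  ^ℚ-+ r (suc m) n = ≡.trans (≡.cong (r ℚ.*_) (^ℚ-+ r m n)) (≡.sym (ℚ.*-assoc r _ _))

  module Powers (r : ℚ) (0<r : 0ℚ ℚ.< r) (r<1 : r ℚ.< 1ℚ) where
    ^ℚ-pos : ∀ n → 0ℚ ℚ.< r ^ℚ n
    ^ℚ-pos zero    = ℚ.positive⁻¹ 1ℚ
    ^ℚ-pos (suc n) = 0<-* 0<r (^ℚ-pos n)

    ^ℚ-≤1 : ∀ n → r ^ℚ n ℚ.≤ 1ℚ
    ^ℚ-≤1 zero    = ℚ.≤-refl
    ^ℚ-≤1 (suc n) = *-mono-≤ (ℚ.<⇒≤ (ℚ.positive⁻¹ 1ℚ)) (ℚ.<⇒≤ (^ℚ-pos n)) (ℚ.<⇒≤ r<1) (^ℚ-≤1 n)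

    ^ℚ-antitone : ∀ {m n} → m ℕ.≤ n → r ^ℚ n ℚ.≤ r ^ℚ m
    ^ℚ-antitone {m} {n} m≤n = begin
      r ^ℚ n                          ≡⟨ ≡.cong (r ^ℚ_) (≡.sym (ℕ.m∸n+n≡m m≤n)) ⟩
      r ^ℚ (n ℕ.∸ m ℕ.+ m)            ≡⟨ ^ℚ-+ r (n ℕ.∸ m) m ⟩
      r ^ℚ (n ℕ.∸ m) ℚ.* r ^ℚ m       ≤⟨ ℚ.*-monoʳ-≤-nonNeg (r ^ℚ m) {{ℚ.nonNegative (ℚ.<⇒≤ (^ℚ-pos m))}} (^ℚ-≤1
          (n ℕ.∸ m)) ⟩
      1ℚ ℚ.* r ^ℚ m                   ≡⟨ ℚ.*-identityˡ _ ⟩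
      r ^ℚ m                          ∎
      where open ℚ.≤-Reasoning

    -- Bernoulli's inequality without 1/r. The left side decreases in n, its drop from n to n + 1
    -- being r^n (1 - r)^2 (1 + n).
    bernoulli : ∀ n → r ^ℚ n ℚ.* (1ℚ ℚ.+ (1ℚ ℚ.- r) ℚ.* ι n) ℚ.≤ 1ℚ
    bernoulli zero = ℚ.≤-reflexive (solve 1 (λ d → con 1ℚ :* (con 1ℚ :+ d :* con 0ℚ) := con 1ℚ) ≡.refl (1ℚ ℚ.- r))
    bernoulli (suc n) = ℚ.≤-trans
      (≤-+-nonNeg {d = r ^ℚ n ℚ.* ((1ℚ ℚ.- r) ℚ.* (1ℚ ℚ.- r) ℚ.* (1ℚ ℚ.+ ι n))}
        (≡.trans (solve 3 (λ r t n → t :* (con 1ℚ :+ (con 1ℚ :- r) :* n) :=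
            r :* t :* (con 1ℚ :+ (con 1ℚ :- r) :* (con 1ℚ :+ n)) :+ t :* ((con 1ℚ :- r) :* (con 1ℚ :- r) :*
                (con 1ℚ :+ n)))
            ≡.refl r (r ^ℚ n) (ι n))
          (≡.cong (λ m → r ℚ.* r ^ℚ n ℚ.* (1ℚ ℚ.+ (1ℚ ℚ.- r) ℚ.* m) ℚ.+ r ^ℚ n ℚ.* ((1ℚ ℚ.- r) ℚ.* (1ℚ ℚ.- r) ℚ.*
              (1ℚ ℚ.+ ι n))) (≡.sym (ι-suc n))))
        (0≤-* (ℚ.<⇒≤ (^ℚ-pos n)) (0≤-* (square-nonNeg (1ℚ ℚ.- r)) (0≤-+ (ℚ.<⇒≤ (ℚ.positive⁻¹ 1ℚ)) (ℚ.nonNegative⁻¹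
            (ι n))))))
      (bernoulli n)

    ^ℚ-vanishes : ∀ ε → 0ℚ ℚ.< ε → ∃[ N ] (∀ n → N ℕ.≤ n → r ^ℚ n ℚ.< ε)
    ^ℚ-vanishes ε 0<ε =
      let 0<εδ = 0<-* 0<ε (∸-pos r<1)
          -- An integer N ≥ 1 / (ε (1 - r)) makes ε (1 + (1 - r) N) exceed 1, whereas `bernoulli`
          -- keeps r^N (1 + (1 - r) N) at most 1.
          c , _ , εδc≡1 = divide 1ℚ (ε ℚ.* (1ℚ ℚ.- r)) (ℚ.positive⁻¹ 1ℚ) 0<εδ
          N , c≤N = ≤-ι c
          B = 1ℚ ℚ.+ (1ℚ ℚ.- r) ℚ.* ι N
          1≤εδN : 1ℚ ℚ.≤ ε ℚ.* (1ℚ ℚ.- r) ℚ.* ι N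
          1≤εδN = ℚ.≤-trans (ℚ.≤-reflexive (≡.sym εδc≡1))
            (ℚ.*-monoˡ-≤-nonNeg (ε ℚ.* (1ℚ ℚ.- r)) {{ℚ.nonNegative (ℚ.<⇒≤ 0<εδ)}} c≤N)
          1<εB : 1ℚ ℚ.< ε ℚ.* B
          1<εB = ℚ.≤-<-trans 1≤εδN (<-+-pos (solve 3 (λ e d n → e :* (con 1ℚ :+ d :* n) := e :* d :* n :+ e) ≡.refl ε
              (1ℚ ℚ.- r) (ι N)) 0<ε)
          0≤B : 0ℚ ℚ.≤ B
          0≤B = 0≤-+ (ℚ.<⇒≤ (ℚ.positive⁻¹ 1ℚ)) (0≤-* (ℚ.<⇒≤ (∸-pos r<1)) (ℚ.nonNegative⁻¹ (ι N)))
      in N , λ n N≤n → ℚ.≤-<-trans (^ℚ-antitone N≤n)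
           (ℚ.*-cancelʳ-<-nonNeg B {{ℚ.nonNegative 0≤B}} (ℚ.≤-<-trans (bernoulli N) 1<εB))

  ℓ¹ : ℚ → ℚ → ℚ
  ℓ¹ a b = ℚ.∣ a ∣ ℚ.+ ℚ.∣ b ∣

  ℓ¹-nonNeg : ∀ a b → 0ℚ ℚ.≤ ℓ¹ a b
  ℓ¹-nonNeg a b = 0≤-+ (ℚ.0≤∣p∣ a) (ℚ.0≤∣p∣ b)

  ∣fst∣≤ℓ¹ : ∀ a b → ℚ.∣ a ∣ ℚ.≤ ℓ¹ a b
  ∣fst∣≤ℓ¹ a b = ≤-+-nonNeg ≡.refl (ℚ.0≤∣p∣ b)

  ∣snd∣≤ℓ¹ : ∀ a b → ℚ.∣ b ∣ ℚ.≤ ℓ¹ a b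
  ∣snd∣≤ℓ¹ a b = ≤-+-nonNeg (ℚ.+-comm ℚ.∣ a ∣ _) (ℚ.0≤∣p∣ a)

  ℓ¹-neg : ∀ a b → ℓ¹ (ℚ.- a) (ℚ.- b) ≡ ℓ¹ a b
  ℓ¹-neg a b = ≡.cong₂ ℚ._+_ (ℚ.∣-p∣≡∣p∣ a) (ℚ.∣-p∣≡∣p∣ b)

  ℓ¹-+ : ∀ a b c d → ℓ¹ (a ℚ.+ c) (b ℚ.+ d) ℚ.≤ ℓ¹ a b ℚ.+ ℓ¹ c d
  ℓ¹-+ a b c d = ℚ.≤-trans (ℚ.+-mono-≤ (ℚ.∣p+q∣≤∣p∣+∣q∣ a c) (ℚ.∣p+q∣≤∣p∣+∣q∣ b d))
    (ℚ.≤-reflexive (solve 4 (λ a b c d → (a :+ c) :+ (b :+ d) := (a :+ b) :+ (c :+ d)) ≡.refl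
      ℚ.∣ a ∣ ℚ.∣ b ∣ ℚ.∣ c ∣ ℚ.∣ d ∣))

  ℓ¹-* : ∀ a b c d → ℓ¹ (a ℚ.* c ℚ.- b ℚ.* d) (a ℚ.* d ℚ.+ b ℚ.* c) ℚ.≤ ℓ¹ a b ℚ.* ℓ¹ c d
  ℓ¹-* a b c d = begin
    ℓ¹ (a ℚ.* c ℚ.- b ℚ.* d) (a ℚ.* d ℚ.+ b ℚ.* c)
      ≤⟨ ℚ.+-mono-≤ (ℚ.∣p-q∣≤∣p∣+∣q∣ (a ℚ.* c) (b ℚ.* d)) (ℚ.∣p+q∣≤∣p∣+∣q∣ (a ℚ.* d) (b ℚ.* c)) ⟩
    (ℚ.∣ a ℚ.* c ∣ ℚ.+ ℚ.∣ b ℚ.* d ∣) ℚ.+ (ℚ.∣ a ℚ.* d ∣ ℚ.+ ℚ.∣ b ℚ.* c ∣)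
      ≡⟨ ≡.cong₂ ℚ._+_ (≡.cong₂ ℚ._+_ (ℚ.∣p*q∣≡∣p∣*∣q∣ a c) (ℚ.∣p*q∣≡∣p∣*∣q∣ b d))
                       (≡.cong₂ ℚ._+_ (ℚ.∣p*q∣≡∣p∣*∣q∣ a d) (ℚ.∣p*q∣≡∣p∣*∣q∣ b c)) ⟩
    (A ℚ.* C ℚ.+ B ℚ.* D) ℚ.+ (A ℚ.* D ℚ.+ B ℚ.* C)
      ≡⟨ solve 4 (λ a b c d → (a :* c :+ b :* d) :+ (a :* d :+ b :* c) := (a :+ b) :* (c :+ d)) ≡.refl A B C D ⟩
    ℓ¹ a b ℚ.* ℓ¹ c d ∎
    where
    open ℚ.≤-Reasoning
    A = ℚ.∣ a ∣
    B = ℚ.∣ b ∣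
    C = ℚ.∣ c ∣
    D = ℚ.∣ d ∣

  norm² : ℚ → ℚ → ℚ
  norm² a b = a ℚ.* a ℚ.+ b ℚ.* b

  norm²-nonNeg : ∀ a b → 0ℚ ℚ.≤ norm² a b
  norm²-nonNeg a b = 0≤-+ (square-nonNeg a) (square-nonNeg b)

  -- The Brahmagupta-Fibonacci identity: the squared modulus is multiplicative.
  norm²-* : ∀ a b c d → norm² (a ℚ.* c ℚ.- b ℚ.* d) (a ℚ.* d ℚ.+ b ℚ.* c) ≡ norm² a b ℚ.* norm² c d
  norm²-* = solve 4 (λ a b c d → (a :* c :- b :* d) :* (a :* c :- b :* d) :+ (a :* d :+ b :* c) :* (a :* d :+ b :* c)
    := (a :* a :+ b :* b) :* (c :* c :+ d :* d)) ≡.refl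

  norm²≤ℓ¹² : ∀ a b → norm² a b ℚ.≤ ℓ¹ a b ℚ.* ℓ¹ a b
  norm²≤ℓ¹² a b = ℚ.≤-trans
    (ℚ.≤-reflexive (≡.cong₂ ℚ._+_ (≡.sym (∣a∣²≡a² a)) (≡.sym (∣a∣²≡a² b))))
    (≤-+-nonNeg (solve 2 (λ a b → (a :+ b) :* (a :+ b) := (a :* a :+ b :* b) :+ (a :* b :+ a :* b)) ≡.refl A B)
      (0≤-+ 0≤AB 0≤AB))
    where
    A = ℚ.∣ a ∣
    B = ℚ.∣ b ∣
    0≤AB = 0≤-* (ℚ.0≤∣p∣ a) (ℚ.0≤∣p∣ b)

  -- Each coordinate is at most r in absolute value. The factor 2 is harmless, being absorbed into
  -- the constants of the O-bounds.
  norm²≤⇒ℓ¹≤ : ∀ {r} a b → 0ℚ ℚ.≤ r → norm² a b ℚ.≤ r ℚ.* r → ℓ¹ a b ℚ.≤ r ℚ.+ r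
  norm²≤⇒ℓ¹≤ a b 0≤r h = ℚ.+-mono-≤
    (square-≤⇒∣∣≤ {a} 0≤r (ℚ.≤-trans (≤-+-nonNeg {a ℚ.* a} ≡.refl (square-nonNeg b)) h))
    (square-≤⇒∣∣≤ {b} 0≤r (ℚ.≤-trans (≤-+-nonNeg {b ℚ.* b} (ℚ.+-comm (a ℚ.* a) _) (square-nonNeg a)) h))

open RationalBounds using (_^ℚ_)

-- Complete normed rings

-- A norm known only through its rational upper bounds: `Bound z c` stands for |z| ≤ c. All
-- estimates then stay in ℚ. In `complete` the Cauchy rate e is inherited by the limit as an error
-- bound.
record CompleteNorm {A : Set} (_≈_ : A → A → Set) (_+_ _*_ : A → A → A) (-_ : A → A) (0# 1# : A) : Set₁ where
  field
    Bound           : A → ℚ → Set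
    bound-≈         : ∀ {z w c} → z ≈ w → Bound z c → Bound w c
    bound-mono      : ∀ {z c d} → c ℚ.≤ d → Bound z c → Bound z d
    bound-zero      : Bound 0# 0ℚ
    bound-one       : Bound 1# 1ℚ
    bound-neg       : ∀ {z c} → Bound z c → Bound (- z) c
    bound-+         : ∀ {z w c d} → Bound z c → Bound w d → Bound (z + w) (c ℚ.+ d)
    bound-*         : ∀ {z w c d} → 0ℚ ℚ.≤ c → 0ℚ ℚ.≤ d → Bound z c → Bound w d → Bound (z * w) (c ℚ.* d)
    bounded         : ∀ z → ∃[ c ] 0ℚ ℚ.≤ c × Bound z c
    bound-separated : ∀ {z w} → (∀ ε → 0ℚ ℚ.< ε → Bound (z + (- w)) ε) → z ≈ w
    complete        : (s : ℕ → A) (e : ℕ → ℚ) →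
      (∀ ε → 0ℚ ℚ.< ε → ∃[ N ] (∀ n → N ℕ.≤ n → e n ℚ.< ε)) →
      (∀ n k → Bound (s (k ℕ.+ n) + (- s n)) (e n)) →
      ∃[ l ] (∀ n → Bound (s n + (- l)) (e n))

CompleteNormOn : CommutativeRing 0ℓ 0ℓ → Set₁
CompleteNormOn R = CompleteNorm _≈_ _+_ _*_ -_ 0# 1#
  where open CommutativeRing R

-- Convergence at a geometric rate

module GeometricConvergence (R : CommutativeRing 0ℓ 0ℓ) (norm : CompleteNormOn R)
  (r : ℚ) (0<r : 0ℚ ℚ.< r) (r<1 : r ℚ.< 1ℚ) where
  open CommutativeRing R
  open CompleteNorm norm
  open RationalBounds
  open Powers r 0<r r<1
  open IntegerSolver R
  open FiniteIdentities R using (Δ; Δ-cong; Δ-+; Δ-*ˡ)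
  open import Relation.Binary.Reasoning.Setoid setoid
  open +-*-Solver using () renaming (solve to solveℚ; _:+_ to _⊕_; _:*_ to _⊛_; _:-_ to _⊖_; _:=_ to _⊜_; con to conℚ)

  0≤r^ : ∀ n → 0ℚ ℚ.≤ r ^ℚ n
  0≤r^ n = ℚ.<⇒≤ (^ℚ-pos n)

  0≤1 : 0ℚ ℚ.≤ 1ℚ
  0≤1 = ℚ.<⇒≤ (ℚ.positive⁻¹ 1ℚ)

  -- f i = O(r^(w i)), uniformly in i.
  record O {I : Set} (w : I → ℕ) (f : I → Carrier) : Set where
    constructor mkO
    field
      const   : ℚ
      0≤const : 0ℚ ℚ.≤ const
      bound   : ∀ i → Bound (f i) (const ℚ.* r ^ℚ w i)
  open O

  module _ {I : Set} where

    O-≈ : ∀ {w : I → ℕ} {f g} → (∀ i → f i ≈ g i) → O w f → O w g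
    O-≈ h (mkO c 0≤c b) = mkO c 0≤c (λ i → bound-≈ (h i) (b i))

    O-weaken : ∀ {v w : I → ℕ} {f} → (∀ i → w i ℕ.≤ v i) → O v f → O w f
    O-weaken h (mkO c 0≤c b) = mkO c 0≤c (λ i →
      bound-mono (ℚ.*-monoˡ-≤-nonNeg c {{ℚ.nonNegative 0≤c}} (^ℚ-antitone (h i))) (b i))

    -- One lost power of r is paid for by a factor 1/r in the constant.
    O-weaken-suc : ∀ {v w : I → ℕ} {f} → (∀ i → w i ℕ.≤ suc (v i)) → O v f → O w f
    O-weaken-suc {v} {w} h (mkO c 0≤c b) =
      let d , 0<d , rd≡1 = divide 1ℚ r (ℚ.positive⁻¹ 1ℚ) 0<r
          0≤cd = 0≤-* 0≤c (ℚ.<⇒≤ 0<d)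
      in mkO (c ℚ.* d) 0≤cd (λ i → bound-mono (ℚ.≤-trans
           (ℚ.≤-reflexive (≡.trans (≡.cong (λ x → x ℚ.* r ^ℚ v i) (≡.trans (≡.sym (ℚ.*-identityʳ c)) (≡.cong (c ℚ.*_)
               (≡.sym rd≡1))))
             (solveℚ 4 (λ c r d t → c ⊛ (r ⊛ d) ⊛ t ⊜ c ⊛ d ⊛ (r ⊛ t))
               ≡.refl c r d (r ^ℚ v i))))
           (ℚ.*-monoˡ-≤-nonNeg (c ℚ.* d) {{ℚ.nonNegative 0≤cd}} (^ℚ-antitone (h i)))) (b i))

    O-bounded : ∀ {w : I → ℕ} {f} → O w f → O {I} (λ _ → 0) f
    O-bounded = O-weaken (λ _ → ℕ.z≤n)

    O-const : ∀ z → O {I} (λ _ → 0) (λ _ → z)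
    O-const z = let c , 0≤c , b = bounded z in
      mkO c 0≤c (λ _ → bound-mono (ℚ.≤-reflexive (≡.sym (ℚ.*-identityʳ c))) b)

    O-neg : ∀ {w : I → ℕ} {f} → O w f → O w (λ i → - f i)
    O-neg (mkO c 0≤c b) = mkO c 0≤c (λ i → bound-neg (b i))

    O-+ : ∀ {w : I → ℕ} {f g} → O w f → O w g → O w (λ i → f i + g i)
    O-+ {w} (mkO c 0≤c b) (mkO d 0≤d b′) = mkO (c ℚ.+ d) (0≤-+ 0≤c 0≤d) (λ i →
      bound-mono (ℚ.≤-reflexive (≡.sym (ℚ.*-distribʳ-+ (r ^ℚ w i) c d))) (bound-+ (b i) (b′ i)))

    O-* : ∀ {v w : I → ℕ} {f g} → O v f → O w g → O (λ i → v i ℕ.+ w i) (λ i → f i * g i)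
    O-* {v} {w} (mkO c 0≤c b) (mkO d 0≤d b′) = mkO (c ℚ.* d) (0≤-* 0≤c 0≤d) (λ i →
      bound-mono (ℚ.≤-reflexive (≡.trans
        (solveℚ 4 (λ c s d t → (c ⊛ s) ⊛ (d ⊛ t) ⊜ (c ⊛ d) ⊛ (s ⊛ t))
          ≡.refl c (r ^ℚ v i) d (r ^ℚ w i))
        (≡.cong (λ x → c ℚ.* d ℚ.* x) (≡.sym (^ℚ-+ r (v i) (w i))))))
        (bound-* (0≤-* 0≤c (0≤r^ (v i))) (0≤-* 0≤d (0≤r^ (w i))) (b i) (b′ i)))

    O-*ʳ : ∀ {w : I → ℕ} {f g} → O w f → O {I} (λ _ → 0) g → O w (λ i → f i * g i)
    O-*ʳ {w} a b = O-weaken (λ i → ℕ.≤-reflexive (≡.sym (ℕ.+-identityʳ (w i)))) (O-* a b)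

    O-*ˡ : ∀ {w : I → ℕ} {f g} → O {I} (λ _ → 0) f → O w g → O w (λ i → f i * g i)
    O-*ˡ = O-*

  O-∘ : ∀ {I J : Set} {w : J → ℕ} {f} (φ : I → J) → O w f → O (w ∘ φ) (f ∘ φ)
  O-∘ φ (mkO c 0≤c b) = mkO c 0≤c (b ∘ φ)

  O-vanishes : ∀ {z w} → O {ℕ} id (λ _ → z - w) → z ≈ w
  O-vanishes (mkO c 0≤c b) = bound-separated (λ ε 0<ε →
    -- The divisor is c + 1 because the constant c may be 0.
    let δ , 0<δ , Dδ≡ε = divide ε (c ℚ.+ 1ℚ) 0<ε (ℚ.+-mono-≤-< 0≤c (ℚ.positive⁻¹ 1ℚ))
        N , h = ^ℚ-vanishes δ 0<δ
    in bound-mono (ℚ.≤-trans (ℚ.*-monoˡ-≤-nonNeg c {{ℚ.nonNegative 0≤c}} (ℚ.<⇒≤ (h N ℕ.≤-refl)))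
         (ℚ.≤-trans (≤-+-nonNeg (solveℚ 2 (λ c d → (c ⊕ conℚ 1ℚ) ⊛ d ⊜ c ⊛ d ⊕ d) ≡.refl c δ) (ℚ.<⇒≤ 0<δ))
             (ℚ.≤-reflexive Dδ≡ε)))
         (b N))

  O-eventually : ∀ {f : ℕ → Carrier} → O id f → ∀ ε → 0ℚ ℚ.< ε → ∃[ N ] (∀ n → N ℕ.≤ n → Bound (f n) ε)
  O-eventually (mkO c 0≤c b) ε 0<ε =
    let δ , 0<δ , Dδ≡ε = divide ε (c ℚ.+ 1ℚ) 0<ε (ℚ.+-mono-≤-< 0≤c (ℚ.positive⁻¹ 1ℚ))
        N , h = ^ℚ-vanishes δ 0<δ
    in N , λ n p → bound-mono (ℚ.≤-trans (ℚ.*-monoˡ-≤-nonNeg c {{ℚ.nonNegative 0≤c}} (ℚ.<⇒≤ (h n p)))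
         (ℚ.≤-trans (≤-+-nonNeg (solveℚ 2 (λ c d → (c ⊕ conℚ 1ℚ) ⊛ d ⊜ c ⊛ d ⊕ d) ≡.refl c δ) (ℚ.<⇒≤ 0<δ))
             (ℚ.≤-reflexive Dδ≡ε)))
         (b n)

  -- 1 / (1 - r), the sum of the geometric series.
  κ : ℚ
  κ = proj₁ (divide 1ℚ (1ℚ ℚ.- r) (ℚ.positive⁻¹ 1ℚ) (∸-pos r<1))

  0≤κ : 0ℚ ℚ.≤ κ
  0≤κ = ℚ.<⇒≤ (proj₁ (proj₂ (divide 1ℚ (1ℚ ℚ.- r) (ℚ.positive⁻¹ 1ℚ) (∸-pos r<1))))

  [1-r]κ≡1 : (1ℚ ℚ.- r) ℚ.* κ ≡ 1ℚ
  [1-r]κ≡1 = proj₂ (proj₂ (divide 1ℚ (1ℚ ℚ.- r) (ℚ.positive⁻¹ 1ℚ) (∸-pos r<1)))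

  -- The partial sums of Σ c r^j are c κ (1 - r^n). This is the passage from n to n + 1, with t =
  -- r^n.
  geometric-step : ∀ c t → c ℚ.* κ ℚ.* (1ℚ ℚ.- t) ℚ.+ c ℚ.* t ≡ c ℚ.* κ ℚ.* (1ℚ ℚ.- r ℚ.* t)
  geometric-step c t = ≡.trans
    (≡.cong (λ x → c ℚ.* κ ℚ.* (1ℚ ℚ.- t) ℚ.+ x) (≡.trans (≡.sym (ℚ.*-identityʳ (c ℚ.* t))) (≡.cong (c ℚ.* t ℚ.*_)
        (≡.sym [1-r]κ≡1))))
    (solveℚ 4 (λ c k t r → c ⊛ k ⊛ (conℚ 1ℚ ⊖ t) ⊕ c ⊛ t ⊛ ((conℚ 1ℚ ⊖ r) ⊛ k)
      ⊜ c ⊛ k ⊛ (conℚ 1ℚ ⊖ r ⊛ t)) ≡.refl c κ t r)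

  geometric-≤ : ∀ {c} t → 0ℚ ℚ.≤ c → 0ℚ ℚ.≤ t → c ℚ.* κ ℚ.* (1ℚ ℚ.- t) ℚ.≤ c ℚ.* κ
  geometric-≤ {c} t 0≤c 0≤t = ≤-+-nonNeg
    (solveℚ 2 (λ x t → x ⊜ x ⊛ (conℚ 1ℚ ⊖ t) ⊕ x ⊛ t) ≡.refl (c ℚ.* κ) t)
    (0≤-* (0≤-* 0≤c 0≤κ) 0≤t)

  bound-Δ : ∀ m F {c} → 0ℚ ℚ.≤ c → (∀ j k → j ℕ.+ k ≡ m → Bound (F j k) (c ℚ.* r ^ℚ j)) → Bound (Δ m F) (c ℚ.* κ)
  bound-Δ m F {c} 0≤c h = bound-mono (geometric-≤ (r ^ℚ suc m) 0≤c (0≤r^ (suc m))) (go m F h)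
    where
    -- The exact partial geometric sum is the invariant; the rounded bound c κ would not be
    -- inductive.
    go : ∀ m F → (∀ j k → j ℕ.+ k ≡ m → Bound (F j k) (c ℚ.* r ^ℚ j)) → Bound (Δ m F) (c ℚ.* κ ℚ.* (1ℚ ℚ.- r ^ℚ suc m))
    go zero F h = bound-mono (ℚ.≤-reflexive (≡.trans
      (solveℚ 2 (λ c k → c ⊛ conℚ 1ℚ ⊜ c ⊛ k ⊛ (conℚ 1ℚ ⊖ conℚ 1ℚ) ⊕ c ⊛ conℚ 1ℚ) ≡.refl c κ)
      (geometric-step c 1ℚ))) (h 0 0 ≡.refl)
    go (suc m) F h = bound-mono (ℚ.≤-reflexive (geometric-step c (r ^ℚ suc m)))
      (bound-+ (go m _ (λ j k e → h j (suc k) (≡.trans (ℕ.+-suc j k) (≡.cong suc e)))) (h (suc m) 0 (ℕ.+-identityʳ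
          (suc m))))

  infix 4 _⇝_
  _⇝_ : (ℕ → Carrier) → Carrier → Set
  s ⇝ l = O id (λ n → s n - l)

  ⇝-≈ : ∀ {s t l} → (∀ n → s n ≈ t n) → s ⇝ l → t ⇝ l
  ⇝-≈ h = O-≈ (λ n → +-congʳ (h n))

  ⇝-unique : ∀ {s l m} → s ⇝ l → s ⇝ m → l ≈ m
  ⇝-unique a b = O-vanishes (O-≈ (λ n → solve 3 (λ s l m → (s :- m) :+ :- (s :- l) := l :- m) refl _ _ _) (O-+ b
      (O-neg a)))

  ⇝-const : ∀ z → (λ _ → z) ⇝ z
  ⇝-const z = mkO 0ℚ ℚ.≤-refl (λ n → bound-mono (ℚ.≤-reflexive (≡.sym (ℚ.*-zeroˡ (r ^ℚ n))))
    (bound-≈ (sym (-‿inverseʳ z)) bound-zero))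

  ⇝-bounded : ∀ {s l} → s ⇝ l → O (λ _ → 0) s
  ⇝-bounded {l = l} a = O-≈ (λ n → solve 2 (λ s l → (s :- l) :+ l := s) refl _ _) (O-+ (O-bounded a) (O-const l))

  ⇝-∘ : ∀ {s l} (φ : ℕ → ℕ) → (∀ n → n ℕ.≤ φ n) → s ⇝ l → (s ∘ φ) ⇝ l
  ⇝-∘ φ h a = O-weaken h (O-∘ φ a)

  ⇝-* : ∀ {s t l m} → s ⇝ l → t ⇝ m → (λ n → s n * t n) ⇝ l * m
  ⇝-* {l = l} a b = O-≈ (λ n → solve 4 (λ s l t m → (s :- l) :* t :+ l :* (t :- m) := s :* t :- l :* m) refl _ _ _ _)
    (O-+ (O-*ʳ a (⇝-bounded b)) (O-*ˡ (O-const l) b))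

  -- Stated for families so that one constant serves all i. The uniform bound on the inverses `G`
  -- depends on this.
  converges : ∀ {I : Set} (s : I → ℕ → Carrier) →
    O {I × ℕ} proj₂ (λ (i , n) → s i (suc n) - s i n) →
    Σ[ l ∈ (I → Carrier) ] O {I × ℕ} proj₂ (λ (i , n) → s i n - l i)
  converges s (mkO c 0≤c b) = (λ i → proj₁ (lim i)) , mkO (c ℚ.* κ) (0≤-* 0≤c 0≤κ) (λ (i , n) → proj₂ (lim i) n)
    where
    e : ℕ → ℚ
    e n = c ℚ.* κ ℚ.* r ^ℚ n
    e→0 : ∀ ε → 0ℚ ℚ.< ε → ∃[ N ] (∀ n → N ℕ.≤ n → e n ℚ.< ε)
    e→0 ε 0<ε =
      let δ , 0<δ , Dδ≡ε = divide ε (c ℚ.* κ ℚ.+ 1ℚ) 0<ε (ℚ.+-mono-≤-< (0≤-* 0≤c 0≤κ) (ℚ.positive⁻¹ 1ℚ))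
          N , h = ^ℚ-vanishes δ 0<δ
      in N , λ n p → ℚ.≤-<-trans (ℚ.*-monoˡ-≤-nonNeg (c ℚ.* κ) {{ℚ.nonNegative (0≤-* 0≤c 0≤κ)}} (ℚ.<⇒≤ (h n p)))
           (<-+-pos (≡.trans (≡.sym Dδ≡ε) (solveℚ 2 (λ c d → (c ⊕ conℚ 1ℚ) ⊛ d ⊜ c ⊛ d ⊕ d) ≡.refl (c ℚ.* κ) δ)) 0<δ)
    telescope : ∀ i n k → Bound (s i (k ℕ.+ n) - s i n) (c ℚ.* r ^ℚ n ℚ.* κ ℚ.* (1ℚ ℚ.- r ^ℚ k))
    telescope i n zero = bound-mono (ℚ.≤-reflexive (solveℚ 1 (λ x → conℚ 0ℚ ⊜ x ⊛ (conℚ 1ℚ ⊖ conℚ 1ℚ)) ≡.refl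
        (c ℚ.* r ^ℚ n ℚ.* κ)))
      (bound-≈ (sym (-‿inverseʳ _)) bound-zero)
    telescope i n (suc k) = bound-≈ (solve 3 (λ a b c → (b :- c) :+ (a :- b) := a :- c) refl _ _ _)
      (bound-mono (ℚ.≤-reflexive (≡.trans
        (≡.cong (λ x → c ℚ.* r ^ℚ n ℚ.* κ ℚ.* (1ℚ ℚ.- r ^ℚ k) ℚ.+ x) (≡.trans (≡.cong (c ℚ.*_) (≡.trans (≡.cong
            (r ^ℚ_) (ℕ.+-comm k n)) (^ℚ-+ r n k))) (≡.sym (ℚ.*-assoc c _ _))))
        (geometric-step (c ℚ.* r ^ℚ n) (r ^ℚ k))))
        (bound-+ (telescope i n k) (b (i , k ℕ.+ n))))
    lim : ∀ i → ∃[ l ] (∀ n → Bound (s i n - l) (e n))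
    lim i = complete (s i) e e→0 (λ n k → bound-mono (ℚ.≤-trans
      (geometric-≤ (r ^ℚ k) (0≤-* 0≤c (0≤r^ n)) (0≤r^ k))
      (ℚ.≤-reflexive (solveℚ 3 (λ c t k → c ⊛ t ⊛ k ⊜ c ⊛ k ⊛ t) ≡.refl c (r ^ℚ n) κ)))
      (telescope i n k))

  converges₁ : ∀ s → O id (λ n → s (suc n) - s n) → ∃[ l ] s ⇝ l
  converges₁ s a =
    let l , b = converges {ℕ} (λ _ → s) (O-∘ proj₂ a) in l 0 , O-∘ (λ n → 0 , n) b

  -- Runs over i < n and grows at its last term, as `Δ` does. `Σ≤≈Σ` passes to sums that grow at the
  -- first term.
  Σ≤ : (ℕ → Carrier) → ℕ → Carrier
  Σ≤ f zero    = 0#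
  Σ≤ f (suc n) = Σ≤ f n + f n

  Δ-Σ : ∀ f N → Δ N (λ n _ → f n) ≈ Σ≤ f (suc N)
  Δ-Σ f zero    = sym (+-identityˡ _)
  Δ-Σ f (suc N) = +-congʳ (Δ-Σ f N)

  Σ-converges : ∀ f → O id f → ∃[ l ] Σ≤ f ⇝ l
  Σ-converges f a = converges₁ (Σ≤ f) (O-≈ (λ n → solve 2 (λ s f → f := s :+ f :- s) refl _ _) a)

  -- A termwise limit may be taken under the sum: the deviation of the N-th sum is Σ_{n ≤ N} O(r^(2n) r^(N-n)) = O(r^N).
  tannery : ∀ {f : ℕ → Carrier} {g : ℕ → ℕ → Carrier} {l m} → O (λ n → n ℕ.+ n) f → O {ℕ × ℕ} proj₂ (λ
      (n , k) → g n k - l) → Σ≤ f ⇝ m →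
    (λ N → Δ N (λ n k → f n * g n k)) ⇝ m * l
  tannery {f} {g} {l} {m} (mkO c 0≤c bf) (mkO d 0≤d bg) Σf =
    O-≈ (λ N → begin
      E N + (S N - m) * l
        ≈⟨ solve 4 (λ a s m l → a :+ (s :- m) :* l := a :+ l :* s :- m :* l) refl (E N) (S N) m l ⟩
      E N + l * S N - m * l
        ≈⟨ +-congʳ (trans (+-congˡ (Δ-*ˡ N l (λ n _ → f n))) (trans (sym (Δ-+ N (λ n k → f n * (g n k - l))
            (λ n _ → l * f n)))
             (Δ-cong N (λ n k _ → solve 3 (λ f g l → f :* (g :- l) :+ l :* f := f :* g) refl (f n) (g n k) l)))) ⟩
      Δ N (λ n k → f n * g n k) - m * l ∎)
    (O-+ deviation (O-*ʳ (⇝-≈ (λ N → sym (Δ-Σ f N)) (⇝-∘ suc ℕ.n≤1+n Σf)) (O-const l)))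
    where
    E S : ℕ → Carrier
    E N = Δ N (λ n k → f n * (g n k - l))
    S N = Δ N (λ n _ → f n)
    deviation : O id E
    deviation = mkO (c ℚ.* d ℚ.* κ) (0≤-* (0≤-* 0≤c 0≤d) 0≤κ) (λ N → bound-mono
      (ℚ.≤-reflexive (solveℚ 3 (λ x t k → x ⊛ t ⊛ k ⊜ x ⊛ k ⊛ t) ≡.refl (c ℚ.* d) (r ^ℚ N) κ))
      (bound-Δ N (λ n k → f n * (g n k - l)) (0≤-* (0≤-* 0≤c 0≤d) (0≤r^ N)) (λ n k e → bound-mono (ℚ.≤-reflexive
        (≡.trans (≡.cong (λ x → c ℚ.* x ℚ.* (d ℚ.* r ^ℚ k)) (^ℚ-+ r n n)) (≡.trans
          (solveℚ 4 (λ c d t s → c ⊛ (t ⊛ t) ⊛ (d ⊛ s) ⊜ c ⊛ d ⊛ (t ⊛ s) ⊛ t) ≡.refl c d (r ^ℚ n) (r ^ℚ k))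
          (≡.cong (λ x → c ℚ.* d ℚ.* x ℚ.* r ^ℚ n) (≡.trans (≡.sym (^ℚ-+ r n k)) (≡.cong (r ^ℚ_) e))))))
        (bound-* (0≤-* 0≤c (0≤r^ (n ℕ.+ n))) (0≤-* 0≤d (0≤r^ k)) (bf n) (bg (n , k))))))

  O-unshift : ∀ N {s : ℕ → Carrier} → O (λ _ → 0) (λ n → s (n ℕ.+ N)) → O (λ _ → 0) s
  O-unshift zero {s} a = O-≈ (λ n → reflexive (≡.cong s (ℕ.+-identityʳ n))) a
  O-unshift (suc N) {s} a = unshift₁ (O-unshift N (O-≈ (λ n → reflexive (≡.cong s (ℕ.+-suc n N))) a))
    where
    unshift₁ : O (λ _ → 0) (s ∘ suc) → O (λ _ → 0) s
    unshift₁ (mkO c 0≤c b) = let d , 0≤d , b₀ = bounded (s 0) in mkO (d ℚ.+ c) (0≤-+ 0≤d 0≤c) λ where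
      zero    → bound-mono (≤-+-nonNeg (ℚ.*-identityʳ (d ℚ.+ c)) 0≤c) b₀
      (suc n) → bound-mono (≤-+-nonNeg (solveℚ 2 (λ c d → (d ⊕ c) ⊛ conℚ 1ℚ ⊜ c ⊛ conℚ 1ℚ ⊕ d) ≡.refl c d) 0≤d) (b n)

  module Products (s e : ℕ → Carrier) (s-suc : ∀ n → s (suc n) ≈ s n * (1# + e n)) (small : O id e) where

    -- Once κ c r^N ≤ ½, the bound 2B (1 - κ c r^n) on the partial products from N on is inherited,
    -- since (1 - κ t)(1 + t) ≤ 1 - κ r t for t = c r^n.
    product-bounded : O (λ _ → 0) s
    product-bounded = O-unshift N (mkO A 0≤A (λ n → bound-mono (ℚ.≤-trans
        (≤-+-nonNeg (solveℚ 2 (λ a t → a ⊜ a ⊛ (conℚ 1ℚ ⊖ t) ⊕ a ⊛ t) ≡.refl A (T n)) (0≤-* 0≤A (0≤T n)))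
        (ℚ.≤-reflexive (≡.sym (ℚ.*-identityʳ A)))) (go n)))
      where
      c = const small
      0≤c = 0≤const small
      threshold : ∃[ N ] c ℚ.* κ ℚ.* r ^ℚ N ℚ.≤ ½
      threshold =
        let δ , 0<δ , Dδ≡½ = divide ½ (c ℚ.* κ ℚ.+ 1ℚ) (ℚ.positive⁻¹ ½) (ℚ.+-mono-≤-< (0≤-* 0≤c 0≤κ) (ℚ.positive⁻¹ 1ℚ))
            N , h = ^ℚ-vanishes δ 0<δ
        in N , ℚ.≤-trans (ℚ.*-monoˡ-≤-nonNeg (c ℚ.* κ) {{ℚ.nonNegative (0≤-* 0≤c 0≤κ)}} (ℚ.<⇒≤ (h N ℕ.≤-refl)))
            (≤-+-nonNeg (≡.trans (≡.sym Dδ≡½) (solveℚ 2 (λ c d → (c ⊕ conℚ 1ℚ) ⊛ d ⊜ c ⊛ d ⊕ d) ≡.refl (c ℚ.* κ) δ))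
                (ℚ.<⇒≤ 0<δ))
      N = proj₁ threshold
      B A : ℚ
      B = proj₁ (bounded (s N))
      A = B ℚ.+ B
      0≤A : 0ℚ ℚ.≤ A
      0≤A = 0≤-+ (proj₁ (proj₂ (bounded (s N)))) (proj₁ (proj₂ (bounded (s N))))
      T : ℕ → ℚ
      T n = c ℚ.* κ ℚ.* r ^ℚ (n ℕ.+ N)
      0≤T : ∀ n → 0ℚ ℚ.≤ T n
      0≤T n = 0≤-* (0≤-* 0≤c 0≤κ) (0≤r^ (n ℕ.+ N))
      T≤½ : ∀ n → T n ℚ.≤ ½
      T≤½ n = ℚ.≤-trans (ℚ.*-monoˡ-≤-nonNeg (c ℚ.* κ) {{ℚ.nonNegative (0≤-* 0≤c 0≤κ)}} (^ℚ-antitone (ℕ.m≤n+m N n)))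
          (proj₂ threshold)
      0≤1-T : ∀ n → 0ℚ ℚ.≤ 1ℚ ℚ.- T n
      0≤1-T n = ℚ.≤-trans (0≤-+ (ℚ.<⇒≤ (ℚ.positive⁻¹ ½)) (∸-nonNeg (T≤½ n)))
        (ℚ.≤-reflexive (solveℚ 1 (λ t → conℚ ½ ⊕ (conℚ ½ ⊖ t) ⊜ conℚ 1ℚ ⊖ t) ≡.refl (T n)))
      inheritance : ∀ a c t → a ℚ.* (1ℚ ℚ.- c ℚ.* κ ℚ.* (r ℚ.* t)) ≡
        a ℚ.* (1ℚ ℚ.- c ℚ.* κ ℚ.* t) ℚ.* (1ℚ ℚ.+ c ℚ.* t) ℚ.+ a ℚ.* (c ℚ.* κ ℚ.* t) ℚ.* (c ℚ.* t)
      inheritance a c t = ≡.trans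
        (solveℚ 5 (λ a c k r t → a ⊛ (conℚ 1ℚ ⊖ c ⊛ k ⊛ (r ⊛ t)) ⊜
          a ⊛ (conℚ 1ℚ ⊖ c ⊛ k ⊛ t) ⊛ (conℚ 1ℚ ⊕ c ⊛ t ⊛ ((conℚ 1ℚ ⊖ r) ⊛ k))
            ⊕ a ⊛ (c ⊛ k ⊛ t) ⊛ (c ⊛ t ⊛ ((conℚ 1ℚ ⊖ r) ⊛ k))) ≡.refl a c κ r t)
        (≡.trans (≡.cong (λ w → a ℚ.* (1ℚ ℚ.- c ℚ.* κ ℚ.* t) ℚ.* (1ℚ ℚ.+ c ℚ.* t ℚ.* w) ℚ.+ a ℚ.* (c ℚ.* κ ℚ.* t) ℚ.*
            (c ℚ.* t ℚ.* w)) [1-r]κ≡1)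
          (≡.cong (λ x → a ℚ.* (1ℚ ℚ.- c ℚ.* κ ℚ.* t) ℚ.* (1ℚ ℚ.+ x) ℚ.+ a ℚ.* (c ℚ.* κ ℚ.* t) ℚ.* x) (ℚ.*-identityʳ
              (c ℚ.* t))))
      go : ∀ n → Bound (s (n ℕ.+ N)) (A ℚ.* (1ℚ ℚ.- T n))
      go zero = bound-mono (≤-+-nonNeg
        (solveℚ 2 (λ b t → (b ⊕ b) ⊛ (conℚ 1ℚ ⊖ t) ⊜ b ⊕ (b ⊕ b) ⊛ (conℚ ½ ⊖ t)) ≡.refl B (T 0))
        (0≤-* 0≤A (∸-nonNeg (T≤½ 0)))) (proj₂ (proj₂ (bounded (s N))))
      go (suc n) = bound-≈ (sym (s-suc (n ℕ.+ N))) (bound-mono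
        (≤-+-nonNeg (inheritance A c (r ^ℚ (n ℕ.+ N))) (0≤-* (0≤-* 0≤A (0≤T n)) (0≤-* 0≤c (0≤r^ (n ℕ.+ N)))))
        (bound-* (0≤-* 0≤A (0≤1-T n)) (0≤-+ 0≤1 (0≤-* 0≤c (0≤r^ (n ℕ.+ N)))) (go n)
          (bound-+ bound-one (bound small (n ℕ.+ N)))))

    product-converges : ∃[ l ] s ⇝ l
    product-converges = converges₁ s (O-≈
      (λ n → trans (solve 2 (λ s e → s :* e := s :* (:1 :+ e) :- s) refl (s n) (e n)) (+-congʳ (sym (s-suc n))))
      (O-*ˡ product-bounded small))

-- Infinite products, theta series and the limit of Bailey's lemma

module QSeries (R : CommutativeRing 0ℓ 0ℓ) (norm : CompleteNormOn R)
  (r : ℚ) (0<r : 0ℚ ℚ.< r) (r<1 : r ℚ.< 1ℚ) where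
  open CommutativeRing R
  open IntegerSolver R
  open FiniteIdentities R
  open GeometricConvergence R norm r 0<r r<1
  open CompleteNorm norm using (bound-≈; bound-mono; bound-zero; bound-one)
  open RationalBounds using (0≤-*)
  open import Algebra.Properties.CommutativeSemiring.Exp commutativeSemiring
    using (_^_; ^-congˡ; ^-homo-*; ^-assocʳ)
  open import Relation.Binary.Reasoning.Setoid setoid

  Invertible : Carrier → Set
  Invertible z = ∃[ w ] z * w ≈ 1#

  -- The way in which denominators are seen to be units: each is built from divisors of some
  -- (Q;Q)_n.
  invertible-factor : ∀ {x y z} → x * y ≈ z → Invertible z → Invertible x
  invertible-factor {x} {y} xy≈z (w , zw≈1) = y * w , trans (sym (*-assoc x y w)) (trans (*-congʳ xy≈z) zw≈1)

  invertible-* : ∀ {x y} → Invertible x → Invertible y → Invertible (x * y)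
  invertible-* (v , xv≈1) (w , yw≈1) = v * w , trans
    (solve 4 (λ x y v w → x :* y :* (v :* w) := x :* v :* (y :* w)) refl _ _ _ _)
    (trans (*-cong xv≈1 yw≈1) (*-identityˡ 1#))

  invertible-cancel : ∀ {z x y} → Invertible z → z * x ≈ z * y → x ≈ y
  invertible-cancel {z} {x} {y} (w , zw≈1) h = trans (sym (expand x)) (trans (*-congˡ h) (expand y))
    where
    expand : ∀ t → w * (z * t) ≈ t
    expand t = trans (solve 3 (λ w z t → w :* (z :* t) := z :* w :* t) refl w z t) (trans (*-congʳ zw≈1)
        (*-identityˡ t))

  module _ (q : Carrier) (q-small : O id (λ n → q ^ n)) where

    O-power : ∀ {I : Set} {w : I → ℕ} (φ : I → ℕ) → (∀ i → w i ℕ.≤ φ i) → O w (λ i → q ^ φ i)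
    O-power φ h = O-weaken h (O-∘ φ q-small)

    Q-small : ∀ k → O id (λ n → (q ^ suc k) ^ n)
    Q-small k = O-≈ (λ n → sym (^-assocʳ q (suc k) n)) (O-power (λ n → suc k ℕ.* n) (λ n → ℕ.m≤m+n n (k ℕ.* n)))

    abstract
      -- The inverses of 1 - q^(m+1), all approached at a common rate.
      geometric-series : Σ[ G ∈ (ℕ → Carrier) ] O {ℕ × ℕ} proj₂ (λ (m , n) → Σ≤ (λ j → (q ^ suc m) ^ j) n - G m)
      geometric-series = converges (λ m → Σ≤ (λ j → (q ^ suc m) ^ j)) (O-≈
        (λ (m , n) → trans (sym (^-assocʳ q (suc m) n)) (solve 2 (λ s t → t := s :+ t :- s) refl (Σ≤ (λ j →
            (q ^ suc m) ^ j) n) _))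
        (O-power (λ (m , n) → suc m ℕ.* n) (λ (m , n) → ℕ.m≤m+n n (m ℕ.* n))))

    G : ℕ → Carrier
    G = proj₁ geometric-series

    -- The uniform error estimate at n = 0, where the partial sum is empty.
    G-bounded : O (λ _ → 0) G
    G-bounded = O-≈ (λ m → solve 1 (λ g → :- (:0 :- g) := g) refl (G m)) (O-neg (O-∘ (λ m → m , 0)
        (proj₂ geometric-series)))

    -- The partial sums satisfy (1 - x) S_n = 1 - x^n. Hence the constant G_m (1 - x) - 1 is O(r^n)
    -- for every n, and so it vanishes.
    G-inverse : ∀ m → G m * (1# - q ^ suc m) ≈ 1#
    G-inverse m = O-vanishes (O-≈ (λ n → begin
        (x - 1#) * (S n - G m) + - x ^ n
          ≈⟨ +-congˡ (-‿cong (sym (partial n))) ⟩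
        (x - 1#) * (S n - G m) + - (1# - (1# - x) * S n)
          ≈⟨ solve 3 (λ x s g → (x :- :1) :* (s :- g) :+ :- (:1 :- (:1 :- x) :* s) := g :* (:1 :- x) :- :1) refl x
              (S n) (G m) ⟩
        G m * (1# - x) - 1# ∎)
      (O-+ (O-*ˡ (O-const (x - 1#)) (O-∘ (λ n → m , n) (proj₂ geometric-series))) (O-neg (Q-small m))))
      where
      x = q ^ suc m
      S = Σ≤ (λ j → x ^ j)
      partial : ∀ n → 1# - (1# - x) * S n ≈ x ^ n
      partial zero    = solve 1 (λ x → :1 :- (:1 :- x) :* :0 := :1) refl x
      partial (suc n) = begin
        1# - (1# - x) * (S n + x ^ n)          ≈⟨ solve 3 (λ x s t → :1 :- (:1 :- x) :* (s :+ t) := (:1 :-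
            (:1 :- x) :* s) :- t :+ x :* t) refl x (S n) (x ^ n) ⟩
        1# - (1# - x) * S n - x ^ n + x * x ^ n ≈⟨ +-congʳ (+-congʳ (partial n)) ⟩
        x ^ n - x ^ n + x * x ^ n              ≈⟨ solve 2 (λ x t → t :- t :+ x :* t := x :* t) refl x (x ^ n) ⟩
        x ^ suc n ∎

    abstract
      poch-converges : ∀ x k → ∃[ l ] poch x (q ^ suc k) ⇝ l
      poch-converges x k = Products.product-converges (poch x (q ^ suc k)) (λ n → - (x * (q ^ suc k) ^ n)) (λ _ → refl)
        (O-neg (O-*ˡ (O-const x) (Q-small k)))

    poch-bounded : ∀ x k → O (λ _ → 0) (poch x (q ^ suc k))
    poch-bounded x k = ⇝-bounded (proj₂ (poch-converges x k))

    -- u k n = 1 / (q^(k+1); q^(k+1))_n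
    u : ℕ → ℕ → Carrier
    u k zero    = 1#
    u k (suc n) = u k n * G (n ℕ.+ k ℕ.* suc n)

    -- The argument of `G` is chosen so that its successor computes to (k+1)(n+1), the exponent of q
    -- in Q^(n+1).
    u-suc : ∀ k n → u k (suc n) * (1# - (q ^ suc k) ^ suc n) ≈ u k n
    u-suc k n = trans (*-congˡ (+-congˡ (-‿cong (^-assocʳ q (suc k) (suc n)))))
      (trans (*-assoc _ _ _) (trans (*-congˡ (G-inverse (n ℕ.+ k ℕ.* suc n))) (*-identityʳ _)))

    abstract
      -- 1 / (1 - y) = 1 + y / (1 - y), so that the factors are 1 + O(r^n), the inverses `G` being
      -- bounded.
      u-converges : ∀ k → ∃[ l ] u k ⇝ l
      u-converges k = Products.product-converges (u k) (λ n → q ^ suc (φ n) * G (φ n)) (λ n → *-congˡ (step n))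
        (O-*ʳ (O-power (suc ∘ φ) (λ n → ℕ.≤-trans (ℕ.m≤m+n n (k ℕ.* suc n)) (ℕ.n≤1+n (φ n)))) (O-∘ φ G-bounded))
        where
        φ : ℕ → ℕ
        φ n = n ℕ.+ k ℕ.* suc n
        step : ∀ n → G (φ n) ≈ 1# + q ^ suc (φ n) * G (φ n)
        step n = trans (solve 2 (λ g x → g := g :* (:1 :- x) :+ x :* g) refl (G (φ n)) (q ^ suc (φ n))) (+-congʳ
            (G-inverse (φ n)))

    -- The argument is one less than the exponent: `Base 1`, `Base 3`, `Base 5` and `Base 7` are the
    -- bases q^2, q^4, q^6 and q^8. This excludes the base q^0 = 1, where 1 - Q^n is 0.
    module Base (k : ℕ) where
      Q u∞ Q∞ : Carrier
      Q = q ^ suc k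
      u∞ = proj₁ (u-converges k)
      Q∞ = proj₁ (poch-converges Q k)

      u⇝ : u k ⇝ u∞
      u⇝ = proj₂ (u-converges k)

      Q⇝ : poch Q Q ⇝ Q∞
      Q⇝ = proj₂ (poch-converges Q k)

      open Reciprocals Q (u k) refl (u-suc k) public

      u∞Q∞≈1 : u∞ * Q∞ ≈ 1#
      u∞Q∞≈1 = ⇝-unique (⇝-* u⇝ Q⇝) (⇝-≈ (λ n → sym (u-inverse n)) (⇝-const 1#))

      u∞-invertible : Invertible u∞
      u∞-invertible = Q∞ , u∞Q∞≈1

      Q∞-invertible : Invertible Q∞
      Q∞-invertible = u∞ , trans (*-comm Q∞ u∞) u∞Q∞≈1

      poch-invertible : ∀ n → Invertible (poch Q Q n)
      poch-invertible n = u k n , trans (*-comm _ _) (u-inverse n)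

      -- The error is uniform in i, as `tannery` requires.
      u-pair : ∀ s → O {ℕ × ℕ} proj₂ (λ (i , m) → u k m * u k (m ℕ.+ (s ℕ.+ 2 ℕ.* i)) - u∞ * u∞)
      u-pair s = O-≈ (λ (i , m) → solve 3 (λ a b c → (a :- c) :* b :+ c :* (b :- c) := a :* b :- c :* c) refl
          (u k m) (u k (m ℕ.+ (s ℕ.+ 2 ℕ.* i))) u∞)
        (O-+ (O-*ʳ (O-∘ proj₂ u⇝) (O-∘ (λ (i , m) → m ℕ.+ (s ℕ.+ 2 ℕ.* i)) (⇝-bounded u⇝)))
          (O-*ˡ (O-const u∞) (O-weaken (λ (i , m) → ℕ.m≤m+n m (s ℕ.+ 2 ℕ.* i)) (O-∘ (λ (i , m) → m ℕ.+
              (s ℕ.+ 2 ℕ.* i)) u⇝))))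

      -- As n → ∞ the folded finite triple product becomes Θ u∞^2 = u∞ t, and 1 / u∞ = (Q;Q)_∞.
      theta-limit : ∀ s {θ T Θ t} → O (λ n → n ℕ.+ n) θ → Σ≤ θ ⇝ Θ → T ⇝ t →
        (∀ n → Δ n (λ i m → θ i * (u k m * u k (m ℕ.+ (s ℕ.+ 2 ℕ.* i)))) ≈ u k (s ℕ.+ 2 ℕ.* n) * T n) →
        Θ ≈ t * Q∞
      theta-limit s {θ} {T} {Θ} {t} θ-small Σθ T⇝ h = invertible-cancel u∞-invertible (invertible-cancel u∞-invertible
          (begin
        u∞ * (u∞ * Θ)        ≈⟨ solve 2 (λ u x → u :* (u :* x) := x :* (u :* u)) refl u∞ Θ ⟩
        Θ * (u∞ * u∞)        ≈⟨ ⇝-unique (tannery θ-small (u-pair s) Σθ) (⇝-≈ (λ n → sym (h n))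
                                  (⇝-* (⇝-∘ (λ n → s ℕ.+ 2 ℕ.* n) (λ n → ℕ.≤-trans (ℕ.m≤m+n n (n ℕ.+ 0)) (ℕ.m≤n+m
                                      (2 ℕ.* n) s)) u⇝) T⇝)) ⟩
        u∞ * t               ≈⟨ trans (sym (*-identityʳ _)) (*-congˡ (sym u∞Q∞≈1)) ⟩
        u∞ * t * (u∞ * Q∞)   ≈⟨ solve 3 (λ u t c → u :* t :* (u :* c) := u :* (u :* (t :* c))) refl u∞ t Q∞ ⟩
        u∞ * (u∞ * (t * Q∞)) ∎))

      module BaileyLimit (s : ℕ) (ρ σ : Carrier) (ρσ≈Q^1+s : ρ * σ ≈ Q ^ suc s) where
        open Bailey s ρ σ ρσ≈Q^1+s public

        -- The last hypothesis asks that the shifted factorials in δ_i and (σ Q^i)_m merge into a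
        -- factor depending on i + m alone. On the antidiagonal i + m = N it leaves the sum, and
        -- Bailey's lemma tends to S u∞ = z Θ u∞^2.
        bailey-limit : ∀ α {Z θ z Θ S} →
          O (λ n → n ℕ.+ n) (λ n → δ n * β α n) → Σ≤ (λ n → δ n * β α n) ⇝ S →
          O (λ n → n ℕ.+ n) θ → Σ≤ θ ⇝ Θ → Z ⇝ z →
          (∀ i m → α i * δ i * poch (σ * Q ^ i) Q m ≈ Z (i ℕ.+ m) * θ i) →
          S ≈ z * Θ * u∞
        bailey-limit α {Z} {θ} {z} {Θ} {S} δβ-small Σδβ θ-small Σθ Z⇝ h = invertible-cancel u∞-invertible (begin
          u∞ * S              ≈⟨ *-comm _ _ ⟩
          S * u∞              ≈⟨ ⇝-unique (⇝-≈ (λ N → bailey α N) (tannery δβ-small (O-∘ proj₂ u⇝) Σδβ))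
                                   (⇝-≈ (λ N → sym (factor N)) (⇝-* Z⇝ (tannery θ-small (u-pair s) Σθ))) ⟩
          z * (Θ * (u∞ * u∞)) ≈⟨ solve 3 (λ z t u → z :* (t :* (u :* u)) := u :* (z :* t :* u)) refl z Θ u∞ ⟩
          u∞ * (z * Θ * u∞)   ∎)
          where
          factor : ∀ N → Δ N (λ i m → α i * δ i * poch (σ * Q ^ i) Q m * (u k m * u k (m ℕ.+ (s ℕ.+ 2 ℕ.* i)))) ≈
            Z N * Δ N (λ i m → θ i * (u k m * u k (m ℕ.+ (s ℕ.+ 2 ℕ.* i))))
          factor N = trans
            (Δ-cong N (λ i m e → trans (*-congʳ (trans (h i m) (*-congʳ (reflexive (≡.cong Z e))))) (*-assoc _ _ _)))
            (sym (Δ-*ˡ N (Z N) _))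

    -- Powers of q

    -- a n + m n(n-1)/2, given recursively so that nothing has to be halved.
    expo : ℕ → ℕ → ℕ → ℕ
    expo a m zero    = 0
    expo a m (suc n) = expo a m n ℕ.+ (a ℕ.+ m ℕ.* n)

    wt-neg-power : ∀ a m n → wt (- (q ^ a)) (q ^ m) n ≈ q ^ expo a m n
    wt-neg-power a m zero    = refl
    wt-neg-power a m (suc n) = begin
      wt (- (q ^ a)) (q ^ m) n * (- - (q ^ a) * (q ^ m) ^ n)
        ≈⟨ *-cong (wt-neg-power a m n) (trans (*-congʳ (solve 1 (λ x → :- :- x := x) refl (q ^ a)))
             (trans (*-congˡ (^-assocʳ q m n)) (sym (^-homo-* q a (m ℕ.* n))))) ⟩
      q ^ expo a m n * q ^ (a ℕ.+ m ℕ.* n)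
        ≈⟨ ^-homo-* q (expo a m n) (a ℕ.+ m ℕ.* n) ⟨
      q ^ expo a m (suc n) ∎

    wt-power : ∀ a m n → wt (q ^ a) (q ^ m) n ≈ (- 1#) ^ n * q ^ expo a m n
    wt-power a m n = begin
      wt (q ^ a) (q ^ m) n                    ≈⟨ wt-cong (q ^ m) n (solve 1 (λ x → x := :- x :* :- :1) refl (q ^ a)) ⟩
      wt (- (q ^ a) * - 1#) (q ^ m) n         ≈⟨ wt-scale (- (q ^ a)) (- 1#) (q ^ m) n ⟩
      (- 1#) ^ n * wt (- (q ^ a)) (q ^ m) n   ≈⟨ *-congˡ (wt-neg-power a m n) ⟩
      (- 1#) ^ n * q ^ expo a m n             ∎

    sign-bounded : O (λ _ → 0) (λ n → (- 1#) ^ n)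
    sign-bounded = (mkO 1ℚ (ℚ.<⇒≤ (ℚ.positive⁻¹ 1ℚ)) (λ n → bound-sign n))
      where
      open CompleteNorm norm using (Bound; bound-neg)
      bound-sign : ∀ n → Bound ((- 1#) ^ n) (1ℚ ℚ.* 1ℚ)
      bound-sign zero    = bound-one
      bound-sign (suc n) = bound-≈ (solve 1 (λ x → :- x := :- :1 :* x) refl _) (bound-neg (bound-sign n))

    -- n^2 is `expo 1 2 n`, and the exponent grows with both parameters.
    square≤expo : ∀ a m n → n ℕ.* n ℕ.≤ expo (suc a) (2 ℕ.+ m) n
    square≤expo a m zero    = ℕ.z≤n
    square≤expo a m (suc n) = ℕ.≤-trans
      (ℕ.≤-reflexive (square n))
      (ℕ.+-mono-≤ (square≤expo a m n) (ℕ.+-mono-≤ (ℕ.m≤m+n 1 a) (ℕ.*-monoˡ-≤ n (ℕ.m≤m+n 2 m))))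
      where
      square : ∀ n → suc n ℕ.* suc n ≡ n ℕ.* n ℕ.+ (1 ℕ.+ 2 ℕ.* n)
      square = solve-∀

    -- (n - 1)^2 ≥ 0. Without the successor it fails at n = 1, which is what `O-weaken-suc` makes up
    -- for.
    double≤suc-square : ∀ n → n ℕ.+ n ℕ.≤ suc (n ℕ.* n)
    double≤suc-square zero          = ℕ.z≤n
    double≤suc-square (suc zero)    = ℕ.≤-refl
    double≤suc-square (suc (suc n)) = ℕ.≤-trans
      (ℕ.m≤m+n (suc (suc n) ℕ.+ suc (suc n)) (n ℕ.* suc (suc n)))
      (ℕ.≤-trans (ℕ.≤-reflexive (square n)) (ℕ.n≤1+n (suc (suc n) ℕ.* suc (suc n))))
      where
      square : ∀ n → suc (suc n) ℕ.+ suc (suc n) ℕ.+ n ℕ.* suc (suc n) ≡ suc (suc n) ℕ.* suc (suc n)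
      square = solve-∀

    wt-neg-small : ∀ a m → O (λ n → n ℕ.+ n) (wt (- (q ^ suc a)) (q ^ (2 ℕ.+ m)))
    wt-neg-small a m = O-≈ (λ n → sym (wt-neg-power (suc a) (2 ℕ.+ m) n))
      (O-weaken-suc double≤suc-square (O-power (expo (suc a) (2 ℕ.+ m)) (square≤expo a m)))

    wt-small : ∀ a m → O (λ n → n ℕ.+ n) (wt (q ^ suc a) (q ^ (2 ℕ.+ m)))
    wt-small a m = O-≈ (λ n → trans (*-congˡ (wt-neg-power (suc a) (2 ℕ.+ m) n)) (sym (wt-power (suc a) (2 ℕ.+ m) n)))
      (O-*ˡ sign-bounded (wt-neg-small a m))

    -- Corrects the sum of two weights at index 0, where it is 2 while `θ-even` is 1.
    kronecker : ℕ → Carrier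
    kronecker zero    = 1#
    kronecker (suc _) = 0#

    kronecker-small : O (λ n → n ℕ.+ n) kronecker
    kronecker-small = mkO 1ℚ (ℚ.<⇒≤ (ℚ.positive⁻¹ 1ℚ)) λ where
      zero    → bound-one
      (suc n) → bound-mono (0≤-* (ℚ.<⇒≤ (ℚ.positive⁻¹ 1ℚ)) (0≤r^ (suc n ℕ.+ suc n))) bound-zero

    expo-closed : ∀ {a m} (E : ℕ → ℕ) → E 0 ≡ 0 → (∀ n → E (suc n) ≡ E n ℕ.+ (a ℕ.+ m ℕ.* n)) → ∀ n → expo a m n ≡ E n
    expo-closed E E-zero E-suc zero    = ≡.sym E-zero
    expo-closed {a} {m} E E-zero E-suc (suc n) =
      ≡.trans (≡.cong (ℕ._+ (a ℕ.+ m ℕ.* n)) (expo-closed E E-zero E-suc n)) (≡.sym (E-suc n))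

    q≈q^1 : q ≈ q ^ 1
    q≈q^1 = sym (*-identityʳ q)

    u₀-inverse : ∀ n → u 0 n * poch q q n ≈ 1#
    u₀-inverse n = trans (*-congˡ (poch-cong₂ n q≈q^1 q≈q^1)) (Base.u-inverse 0 n)

    u₀-suc : ∀ n → u 0 (suc n) * (1# - q ^ suc n) ≈ u 0 n
    u₀-suc n = trans (*-congˡ (+-congˡ (-‿cong (^-congˡ (suc n) q≈q^1)))) (u-suc 0 n)

    -- (q;q)_{2n+1} = (q;q^2)_{n+1} (q^2;q^2)_n by parity of the exponents.
    u₀-odd : ∀ n → u 0 (suc (2 ℕ.* n)) * poch q (q ^ 2) (suc n) ≈ u 1 n
    u₀-odd n = begin
      u 0 (suc (2 ℕ.* n)) * poch q (q ^ 2) (suc n)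
        ≈⟨ trans (sym (*-identityʳ _)) (*-congˡ (sym (Base.u-inverse 1 n))) ⟩
      u 0 (suc (2 ℕ.* n)) * poch q (q ^ 2) (suc n) * (u 1 n * poch (q ^ 2) (q ^ 2) n)
        ≈⟨ solve 4 (λ a b c d → a :* b :* (c :* d) := a :* (b :* d) :* c) refl _ _ _ _ ⟩
      u 0 (suc (2 ℕ.* n)) * (poch q (q ^ 2) (suc n) * poch (q ^ 2) (q ^ 2) n) * u 1 n
        ≈⟨ *-congʳ (*-congˡ (trans (*-congˡ (poch-cong (q ^ 2) n (*-congˡ (sym q≈q^1)))) (sym (poch-odd q q n)))) ⟩
      u 0 (suc (2 ℕ.* n)) * poch q q (suc (2 ℕ.* n)) * u 1 n
        ≈⟨ trans (*-congʳ (u₀-inverse (suc (2 ℕ.* n)))) (*-identityˡ _) ⟩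
      u 1 n ∎

    u₀-even : ∀ n → u 0 (2 ℕ.* n) * (poch q (q ^ 2) n * poch (q ^ 2) (q ^ 2) n) ≈ 1#
    u₀-even n = trans (*-congˡ (trans (*-congˡ (poch-cong (q ^ 2) n (*-congˡ (sym q≈q^1)))) (sym (poch-even q q n))))
        (u₀-inverse (2 ℕ.* n))

    Sums : Carrier → (ℕ → Carrier) → (ℕ → Carrier) → Set
    Sums S a b = Σ[ t ∈ (ℕ → Carrier) ] (∀ n → Invertible (b n) × t n * b n ≈ a n) × Σ≤ t ⇝ S

    double-≤ : ∀ n → n ℕ.≤ 2 ℕ.* n
    double-≤ n = ℕ.m≤m+n n (n ℕ.+ 0)

    -- First identity

    module First where
      open Base 1

      a b t : ℕ → Carrier
      a n = poch (- (q ^ 2)) (q ^ 2) n * q ^ (n ℕ.^ 2)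
      b n = poch q q (2 ℕ.* n ℕ.+ 1)
      t n = poch (- (q ^ 2)) (q ^ 2) n * q ^ (n ℕ.^ 2) * u 0 (suc (2 ℕ.* n))

      -- Chu-Vandermonde in base Q = q^2 with a = -q^2 and x = -q. On k + l = M the factor
      -- (q;Q)_{M+1} splits after k + 1 factors: the first part turns 1 / (q;q)_{2k+1} into 1 /
      -- (Q;Q)_k, and the rest is (a x Q^k)_l because a x = q Q.
      finite : ∀ M → poch q Q (suc M) * Δ M (λ k l → t k * u 1 l) ≈ u 1 M * poch (- q) Q M
      finite M = begin
        poch q Q (suc M) * Δ M (λ k l → t k * u 1 l)
          ≈⟨ Δ-*ˡ M _ _ ⟩
        Δ M (λ k l → poch q Q (suc M) * (t k * u 1 l))
          ≈⟨ Δ-cong M (λ k l e → trans (*-congʳ (reflexive (≡.cong (λ m → poch q Q (suc m)) (≡.sym e)))) (term k l)) ⟩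
        Γ M (λ k l → poch (- Q) Q k * wt (- q) Q k * poch (- Q * - q * Q ^ k) Q l)
          ≈⟨ chu-vandermonde (- Q) (- q) M ⟩
        u 1 M * poch (- q) Q M ∎
        where
        q^n² : ∀ n → q ^ (n ℕ.^ 2) ≈ wt (- q) Q n
        q^n² n = trans (reflexive (≡.cong (q ^_) (≡.sym (expo-closed {1} {2} (ℕ._^ 2) ≡.refl square n))))
          (trans (sym (wt-neg-power 1 2 n)) (wt-cong Q n (-‿cong (sym q≈q^1))))
          where
          square : ∀ n → suc n ℕ.* (suc n ℕ.* 1) ≡ n ℕ.* (n ℕ.* 1) ℕ.+ (1 ℕ.+ 2 ℕ.* n)
          square = solve-∀
        term : ∀ k l → poch q Q (suc k ℕ.+ l) * (t k * u 1 l) ≈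
          u 1 k * u 1 l * (poch (- Q) Q k * wt (- q) Q k * poch (- Q * - q * Q ^ k) Q l)
        term k l = begin
          poch q Q (suc k ℕ.+ l) * (t k * u 1 l)
            ≈⟨ *-congʳ (trans (poch-+ q Q (suc k) l) (*-congˡ (poch-cong Q l
                 (solve 3 (λ x y t → x :* (y :* t) := :- y :* :- x :* t) refl q Q (Q ^ k))))) ⟩
          poch q Q (suc k) * poch (- Q * - q * Q ^ k) Q l * (poch (- Q) Q k * q ^ (k ℕ.^ 2) * u 0 (suc
              (2 ℕ.* k)) * u 1 l)
            ≈⟨ solve 6 (λ p c a w v y → p :* c :* (a :* w :* v :* y) := v :* p :* y :* (a :* w :* c)) refl _ _ _ _ _ _ ⟩
          u 0 (suc (2 ℕ.* k)) * poch q Q (suc k) * u 1 l * (poch (- Q) Q k * q ^ (k ℕ.^ 2) * poch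
              (- Q * - q * Q ^ k) Q l)
            ≈⟨ *-cong (*-congʳ (u₀-odd k)) (*-congʳ (*-congˡ (q^n² k))) ⟩
          u 1 k * u 1 l * (poch (- Q) Q k * wt (- q) Q k * poch (- Q * - q * Q ^ k) Q l) ∎

      t-small : O (λ n → n ℕ.+ n) t
      t-small = O-*ʳ (O-*ˡ (poch-bounded (- (q ^ 2)) 1)
          (O-weaken-suc double≤suc-square (O-power (ℕ._^ 2) (λ n → ℕ.≤-reflexive (≡.cong (n ℕ.*_) (≡.sym
              (ℕ.*-identityʳ n)))))))
        (O-∘ (λ n → suc (2 ℕ.* n)) (⇝-bounded (Base.u⇝ 0)))

      first : ∃[ S ] ∃[ A ] ∃[ B ] Sums S a b × (poch (- q) (q ^ 2) ⇝ A) × (poch q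
          (q ^ 2) ⇝ B) × Invertible B × S * B ≈ A
      first = S , A , B , (t , (λ n → invertible n , quotient n) , Σt) , A⇝ , B⇝ , B-invertible , S*B≈A
        where
        SΣ = Σ-converges t (O-weaken (λ n → ℕ.m≤m+n n n) t-small)
        S = proj₁ SΣ
        Σt = proj₂ SΣ
        A = proj₁ (poch-converges (- q) 1)
        A⇝ = proj₂ (poch-converges (- q) 1)
        B = proj₁ (poch-converges q 1)
        B⇝ = proj₂ (poch-converges q 1)
        odd : ∀ n → 2 ℕ.* n ℕ.+ 1 ≡ suc (2 ℕ.* n)
        odd n = ℕ.+-comm (2 ℕ.* n) 1
        invertible : ∀ n → Invertible (b n)
        invertible n = u 0 (2 ℕ.* n ℕ.+ 1) , trans (*-comm _ _) (u₀-inverse (2 ℕ.* n ℕ.+ 1))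
        quotient : ∀ n → t n * b n ≈ a n
        quotient n = trans (*-assoc _ _ _) (trans (*-congˡ (trans
          (*-congˡ (reflexive (≡.cong (poch q q) (odd n)))) (u₀-inverse (suc (2 ℕ.* n))))) (*-identityʳ _))
        B-invertible : Invertible B
        -- 1 / (q;q^2)_∞ = (q^2;q^2)_∞ / (q;q)_∞.
        B-invertible = Q∞ * Base.u∞ 0 , ⇝-unique
          (⇝-* B⇝ (⇝-* Q⇝ (⇝-∘ (2 ℕ.*_) double-≤ (Base.u⇝ 0))))
          (⇝-≈ (λ n → trans (sym (u₀-even n)) (solve 3 (λ a b c → a :* (b :* c) := b :* (c :* a)) refl _ _ _))
              (⇝-const 1#))
        S*B≈A : S * B ≈ A
        S*B≈A = invertible-cancel u∞-invertible (begin
          u∞ * (S * B)   ≈⟨ solve 3 (λ u s b → u :* (s :* b) := b :* (s :* u)) refl u∞ S B ⟩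
          B * (S * u∞)   ≈⟨ ⇝-unique (⇝-* (⇝-∘ suc ℕ.n≤1+n B⇝) (tannery t-small (O-∘ proj₂ u⇝) Σt))
                              (⇝-≈ (λ M → sym (finite M)) (⇝-* u⇝ A⇝)) ⟩
          u∞ * A         ∎)

    -- Second identity

    module Second where
      open Base 1
      open BaileyLimit 0 (- 1#) (- (q ^ 2)) (solve 1 (λ q → :- :1 :* :- (q :^ 2) := q :^ 2 :* :1) refl q)
      open TriangularPair q (u 1) refl (u-suc 1) (u 0) refl u₀-suc

      open Base.TripleProduct 5 (- (q ^ 3)) (- (q ^ 3)) (solve 1 (λ q → :- (q :^ 3) :* :- (q :^ 3) := q :^ 6) refl q)
        using (θ-even; triple-product-even)

      a b t : ℕ → Carrier
      a n = poch (- 1#) q (2 ℕ.* n) * q ^ (n ℕ.^ 2 ℕ.+ n)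
      b n = poch (q ^ 2) (q ^ 2) n * poch (q ^ 2) (q ^ 4) n
      t n = δ n * β τ-even n

      β≈ : ∀ n → β τ-even n ≈ u 0 (2 ℕ.* n)
      β≈ = τ-sum-even

      τ≈ : ∀ n → τ n ≈ q ^ expo 1 1 n
      τ≈ zero    = refl
      τ≈ (suc n) = begin
        τ n * q ^ suc n                        ≈⟨ *-cong (τ≈ n) (reflexive (≡.cong (λ m → q ^ suc m) (≡.sym
            (ℕ.*-identityˡ n)))) ⟩
        q ^ expo 1 1 n * q ^ (1 ℕ.+ 1 ℕ.* n)   ≈⟨ ^-homo-* q (expo 1 1 n) (1 ℕ.+ 1 ℕ.* n) ⟨
        q ^ expo 1 1 (suc n)                   ∎

      -- With r = i + 1 the exponents add up as T(2r-1) + (r^2 + r) = r(2r-1) + r^2 + r = 3r^2. The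
      -- argument of `τ` is what the predecessor of 2r computes to.
      wt-merge : ∀ i → τ (i ℕ.+ 1 ℕ.* suc i) * wt (- (q ^ 2)) (q ^ 2) (suc i) ≈ wt (- (q ^ 3)) (q ^ 6) (suc i)
      wt-merge i = begin
        τ (i ℕ.+ 1 ℕ.* suc i) * wt (- (q ^ 2)) (q ^ 2) (suc i)
          ≈⟨ *-cong (τ≈ (i ℕ.+ 1 ℕ.* suc i)) (wt-neg-power 2 2 (suc i)) ⟩
        q ^ expo 1 1 (i ℕ.+ 1 ℕ.* suc i) * q ^ expo 2 2 (suc i)
          ≈⟨ ^-homo-* q (expo 1 1 (i ℕ.+ 1 ℕ.* suc i)) (expo 2 2 (suc i)) ⟨
        q ^ (expo 1 1 (i ℕ.+ 1 ℕ.* suc i) ℕ.+ expo 2 2 (suc i))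
          ≡⟨ ≡.cong (q ^_) (≡.trans (≡.cong₂ ℕ._+_ odd-triangle (expo-closed (λ n → n ℕ.* n ℕ.+ n) ≡.refl pronic
              (suc i)))
               (≡.trans (total i) (≡.sym (expo-closed (λ n → 3 ℕ.* (n ℕ.* n)) ≡.refl triple (suc i))))) ⟩
        q ^ expo 3 6 (suc i)
          ≈⟨ wt-neg-power 3 6 (suc i) ⟨
        wt (- (q ^ 3)) (q ^ 6) (suc i) ∎
        where
        2* : ∀ n → 2 ℕ.* expo 1 1 n ≡ n ℕ.* suc n
        2* zero    = ≡.refl
        2* (suc n) = ≡.trans (ℕ.*-distribˡ-+ 2 (expo 1 1 n) (1 ℕ.+ 1 ℕ.* n)) (≡.trans (≡.cong (ℕ._+ 2 ℕ.*
            (1 ℕ.+ 1 ℕ.* n)) (2* n)) (next n))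
          where
          next : ∀ n → n ℕ.* suc n ℕ.+ 2 ℕ.* (1 ℕ.+ 1 ℕ.* n) ≡ suc n ℕ.* suc (suc n)
          next = solve-∀
        odd-triangle : expo 1 1 (i ℕ.+ 1 ℕ.* suc i) ≡ (2 ℕ.* i ℕ.+ 1) ℕ.* suc i
        odd-triangle = ℕ.*-cancelˡ-≡ (expo 1 1 (i ℕ.+ 1 ℕ.* suc i)) ((2 ℕ.* i ℕ.+ 1) ℕ.* suc i) 2
          (≡.trans (2* (i ℕ.+ 1 ℕ.* suc i)) (expand i))
          where
          expand : ∀ i → (i ℕ.+ 1 ℕ.* suc i) ℕ.* suc (i ℕ.+ 1 ℕ.* suc i) ≡ 2 ℕ.* ((2 ℕ.* i ℕ.+ 1) ℕ.* suc i)
          expand = solve-∀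
        pronic : ∀ n → suc n ℕ.* suc n ℕ.+ suc n ≡ n ℕ.* n ℕ.+ n ℕ.+ (2 ℕ.+ 2 ℕ.* n)
        pronic = solve-∀
        triple : ∀ n → 3 ℕ.* (suc n ℕ.* suc n) ≡ 3 ℕ.* (n ℕ.* n) ℕ.+ (3 ℕ.+ 6 ℕ.* n)
        triple = solve-∀
        total : ∀ i → (2 ℕ.* i ℕ.+ 1) ℕ.* suc i ℕ.+ (suc i ℕ.* suc i ℕ.+ suc i) ≡ 3 ℕ.* (suc i ℕ.* suc i)
        total = solve-∀

      -- For r = i + 1 the pair contributes 1 + Q^r times `τ` at 2r - 1, and (-1;Q)_r = 2
      -- (-Q;Q)_{r-1}. The factor 1 + Q^r completes the latter to (-Q;Q)_r, which joins the
      -- remaining factorial; the 2 accounts for the two equal theta terms.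
      separation : ∀ i m → τ-even i * δ i * poch (- (q ^ 2) * Q ^ i) Q m ≈ poch (- (q ^ 2)) Q (i ℕ.+ m) * θ-even i
      separation zero m = begin
        1# * (1# * 1#) * poch (- (q ^ 2) * 1#) Q m ≈⟨ *-congˡ (poch-cong Q m (*-identityʳ _)) ⟩
        1# * (1# * 1#) * poch (- (q ^ 2)) Q m      ≈⟨ solve 1 (λ p → :1 :* (:1 :* :1) :* p := p :* :1) refl _ ⟩
        poch (- (q ^ 2)) Q m * 1#                  ∎
      separation (suc i) m = begin
        (h * q ^ (2 ℕ.* suc i) + h) * (poch (- 1#) Q (suc i) * w) * poch (- (q ^ 2) * Q ^ suc i) Q m
          ≈⟨ *-congʳ (*-cong (+-congʳ (*-congˡ (^-2* q (suc i)))) (*-congʳ (trans (poch-suc (- 1#) Q i)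
               (*-congˡ (poch-cong Q i (solve 1 (λ x → :- :1 :* x := :- x) refl (q ^ 2))))))) ⟩
        (h * (Q * Q ^ i) + h) * ((1# - - 1#) * poch (- Q) Q i * w) * poch (- (q ^ 2) * Q ^ suc i) Q m
          ≈⟨ solve 6 (λ h Q t p w r → (h :* (Q :* t) :+ h) :* ((:1 :- :- :1) :* p :* w) :* r :=
               p :* (:1 :- :- Q :* t) :* r :* (h :* w :+ h :* w)) refl h Q (Q ^ i) (poch (- Q) Q i) w _ ⟩
        poch (- Q) Q (suc i) * poch (- (q ^ 2) * Q ^ suc i) Q m * (h * w + h * w)
          ≈⟨ *-cong (sym (poch-+ (- Q) Q (suc i) m)) (+-cong (wt-merge i) (wt-merge i)) ⟩
        poch (- (q ^ 2)) Q (suc i ℕ.+ m) * θ-even (suc i) ∎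
        where
        h = τ (i ℕ.+ 1 ℕ.* suc i)
        w = wt (- (q ^ 2)) Q (suc i)

      θ-small : O (λ n → n ℕ.+ n) θ-even
      θ-small = O-≈ θ≈ (O-+ (O-+ (wt-neg-small 2 4) (wt-neg-small 2 4)) (O-neg kronecker-small))
        where
        θ≈ : ∀ n → wt (- (q ^ 3)) (q ^ 6) n + wt (- (q ^ 3)) (q ^ 6) n + - kronecker n ≈ θ-even n
        θ≈ zero    = solve 0 (:1 :+ :1 :+ :- :1 := :1) refl
        θ≈ (suc n) = solve 1 (λ x → x :+ :- :0 := x) refl _

      t-small : O (λ n → n ℕ.+ n) t
      t-small = O-*ʳ (O-*ˡ (poch-bounded (- 1#) 1) (wt-neg-small 1 0))
        (O-≈ (λ n → sym (β≈ n)) (O-∘ (2 ℕ.*_) (⇝-bounded (Base.u⇝ 0))))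

      second : ∃[ S ] ∃[ A ] ∃[ B ] ∃[ C ] ∃[ D ] Sums S a b × (poch (- (q ^ 3)) (q ^ 6) ⇝ A) × (poch (q ^ 6)
          (q ^ 6) ⇝ B) ×
        (poch (- (q ^ 2)) (q ^ 2) ⇝ C) × (poch (q ^ 2) (q ^ 2) ⇝ D) × Invertible D × S * D ≈ A ^ 2 * B * C
      second = S , A , B , C , Q∞ , (t ,
          (λ n → invertible n , quotient n) , Σt) , A⇝ , Base.Q⇝ 5 , C⇝ , Q⇝ , Q∞-invertible , SD≈
        where
        SΣ = Σ-converges t (O-weaken (λ n → ℕ.m≤m+n n n) t-small)
        S = proj₁ SΣ
        Σt = proj₂ SΣ
        ΘΣ = Σ-converges θ-even (O-weaken (λ n → ℕ.m≤m+n n n) θ-small)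
        Θ = proj₁ ΘΣ
        A = proj₁ (poch-converges (- (q ^ 3)) 5)
        A⇝ = proj₂ (poch-converges (- (q ^ 3)) 5)
        B = Base.Q∞ 5
        C = proj₁ (poch-converges (- (q ^ 2)) 1)
        C⇝ = proj₂ (poch-converges (- (q ^ 2)) 1)
        Θ≈ : Θ ≈ A * A * B
        Θ≈ = Base.theta-limit 5 0 θ-small (proj₂ ΘΣ) (⇝-* A⇝ A⇝) triple-product-even
        SD≈ : S * Q∞ ≈ A ^ 2 * B * C
        SD≈ = begin
          S * Q∞                ≈⟨ *-congʳ (bailey-limit τ-even t-small Σt θ-small (proj₂ ΘΣ) C⇝ separation) ⟩
          C * Θ * u∞ * Q∞       ≈⟨ trans (*-assoc _ _ _) (trans (*-congˡ u∞Q∞≈1) (*-identityʳ _)) ⟩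
          C * Θ                 ≈⟨ *-congˡ Θ≈ ⟩
          C * (A * A * B)       ≈⟨ solve 3 (λ a b c → c :* (a :* a :* b) := a :^ 2 :* b :* c) refl A B C ⟩
          A ^ 2 * B * C         ∎
        q⁴ : (q ^ 2) ^ 2 ≈ q ^ 4
        q⁴ = solve 1 (λ q → (q :^ 2) :^ 2 := q :^ 4) refl q
        invertible : ∀ n → Invertible (b n)
        invertible n = invertible-* (poch-invertible n)
          -- (q^2;q^4)_n divides (q^2;q^2)_{2n}.
          (invertible-factor (trans (*-congʳ (poch-cong₂ n refl (sym q⁴))) (sym (poch-even (q ^ 2) (q ^ 2) n)))
              (poch-invertible (2 ℕ.* n)))
        quotient : ∀ n → t n * b n ≈ a n
        quotient n = begin
          δ n * β τ-even n * (poch (q ^ 2) (q ^ 2) n * poch (q ^ 2) (q ^ 4) n)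
            -- (q^2;q^4)_n = (q;q^2)_n (-q;q^2)_n. The first factor, together with (q^2;q^2)_n,
            -- cancels β_n; the second completes (-1;q^2)_n to (-1;q)_{2n}.
            ≈⟨ *-cong (*-congˡ (β≈ n)) (*-congˡ (sym (trans (poch-square q (q ^ 2) n) (poch-cong₂ n refl q⁴)))) ⟩
          poch (- 1#) Q n * wt (- (q ^ 2)) Q n * u 0 (2 ℕ.* n) * (poch Q Q n * (poch q Q n * poch (- q) Q n))
            ≈⟨ solve 6 (λ m w v x y z → m :* w :* v :* (x :* (y :* z)) := m :* z :* w :* (v :*
                (y :* x))) refl _ _ _ _ _ _ ⟩
          poch (- 1#) Q n * poch (- q) Q n * wt (- (q ^ 2)) Q n * (u 0 (2 ℕ.* n) * (poch q Q n * poch Q Q n))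
            ≈⟨ trans (*-congˡ (u₀-even n)) (*-identityʳ _) ⟩
          poch (- 1#) Q n * poch (- q) Q n * wt (- (q ^ 2)) Q n
            ≈⟨ *-cong (trans (*-congˡ (poch-cong Q n (solve 1 (λ q → :- q := :- :1 :* q) refl q))) (sym (poch-even
                (- 1#) q n)))
                 (trans (wt-neg-power 2 2 n) (reflexive (≡.cong (q ^_) (expo-closed
                     (λ n → n ℕ.^ 2 ℕ.+ n) ≡.refl pronic n)))) ⟩
          a n ∎
          where
          pronic : ∀ n → suc n ℕ.* (suc n ℕ.* 1) ℕ.+ suc n ≡ n ℕ.* (n ℕ.* 1) ℕ.+ n ℕ.+ (2 ℕ.+ 2 ℕ.* n)
          pronic = solve-∀

    -- Factorisations in base q^4 for the last two identities

    merge : ∀ {x y z} n → - (x * y) ≈ z → wt x (q ^ 4) n * wt y (q ^ 4) n ≈ wt z (q ^ 8) n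
    merge n h = trans (wt-* _ _ (q ^ 4) n) (wt-cong₂ n h (solve 1 (λ q → (q :^ 4) :^ 2 := q :^ 8) refl q))

    q-q³ : ∀ n → poch q (q ^ 4) n * poch (q ^ 3) (q ^ 4) n ≈ poch q (q ^ 2) (2 ℕ.* n)
    q-q³ n = sym (trans (poch-even q (q ^ 2) n) (*-cong
      (poch-cong₂ n refl (solve 1 (λ q → (q :^ 2) :^ 2 := q :^ 4) refl q))
      (poch-cong₂ n (solve 1 (λ q → q :* q :^ 2 := q :^ 3) refl q) (solve 1 (λ q → (q :^ 2) :^ 2 := q :^ 4) refl q))))

    ±q² : ∀ n → poch (q ^ 2) (q ^ 4) n * poch (- (q ^ 2)) (q ^ 4) n ≈ poch (q ^ 4) ((q ^ 4) ^ 2) n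
    ±q² n = trans (poch-square (q ^ 2) (q ^ 4) n) (poch-cong ((q ^ 4) ^ 2) n (solve 1 (λ q →
        (q :^ 2) :^ 2 := q :^ 4) refl q))

    q⁸ : ∀ n → poch (q ^ 8) (q ^ 8) n ≈ poch (q ^ 4 * q ^ 4) ((q ^ 4) ^ 2) n
    q⁸ n = poch-cong₂ n (solve 1 (λ q → q :^ 8 := q :^ 4 :* q :^ 4) refl q) (solve 1 (λ q → q :^ 8 :=
        (q :^ 4) :^ 2) refl q)

    -- Fourth identity

    module Fourth where
      open Base 3
      open BaileyLimit 0 (q ^ 2) (q ^ 2) (solve 1 (λ q → q :^ 2 :* q :^ 2 := q :^ 4 :* :1) refl q)
      module α = TripleProduct (q ^ 3) q (solve 1 (λ q → q :^ 3 :* q := q :^ 4) refl q)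
      open Base.TripleProduct 7 (- (q ^ 5)) (- (q ^ 3)) (solve 1 (λ q → :- (q :^ 5) :* :- (q :^ 3) := q :^ 8) refl q)
        using (θ-even; triple-product-even)

      a b t : ℕ → Carrier
      a n = poch q (q ^ 2) (2 ℕ.* n) * q ^ (2 ℕ.* n ℕ.^ 2) * (- 1#) ^ n
      b n = poch (q ^ 8) (q ^ 8) n * poch (- (q ^ 2)) (q ^ 4) n
      t n = δ n * β α.θ-even n

      -- As ρ = σ = q^2, the two factorials join directly. The weight of δ_i turns the parameters
      -- q^3 and q in base q^4 into -q^5 and -q^3 in base q^8.
      separation : ∀ i m → α.θ-even i * δ i * poch (q ^ 2 * Q ^ i) Q m ≈ poch (q ^ 2) Q (i ℕ.+ m) * θ-even i
      separation zero m = begin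
        1# * (1# * 1#) * poch (q ^ 2 * 1#) Q m     ≈⟨ *-congˡ (poch-cong Q m (*-identityʳ _)) ⟩
        1# * (1# * 1#) * poch (q ^ 2) Q m          ≈⟨ solve 1 (λ p → :1 :* (:1 :* :1) :* p := p :* :1) refl _ ⟩
        poch (q ^ 2) Q m * 1#                      ∎
      separation (suc i) m = begin
        (wt (q ^ 3) Q (suc i) + wt q Q (suc i)) * (poch (q ^ 2) Q (suc i) * wt (q ^ 2) Q (suc i)) * poch
            (q ^ 2 * Q ^ suc i) Q m
          ≈⟨ solve 5 (λ x y p w r → (x :+ y) :* (p :* w) :* r := p :* r :* (x :* w :+ y :* w)) refl _ _ _ _ _ ⟩
        poch (q ^ 2) Q (suc i) * poch (q ^ 2 * Q ^ suc i) Q m *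
          (wt (q ^ 3) Q (suc i) * wt (q ^ 2) Q (suc i) + wt q Q (suc i) * wt (q ^ 2) Q (suc i))
          ≈⟨ *-cong (sym (poch-+ (q ^ 2) Q (suc i) m)) (+-cong
               (merge (suc i) (solve 1 (λ q → :- (q :^ 3 :* q :^ 2) := :- (q :^ 5)) refl q))
               (merge (suc i) (solve 1 (λ q → :- (q :* q :^ 2) := :- (q :^ 3)) refl q))) ⟩
        poch (q ^ 2) Q (suc i ℕ.+ m) * θ-even (suc i) ∎

      θ-small : O (λ n → n ℕ.+ n) θ-even
      θ-small = O-≈ θ≈ (O-+ (O-+ (wt-neg-small 4 6) (wt-neg-small 2 6)) (O-neg kronecker-small))
        where
        θ≈ : ∀ n → wt (- (q ^ 5)) (q ^ 8) n + wt (- (q ^ 3)) (q ^ 8) n + - kronecker n ≈ θ-even n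
        θ≈ zero    = solve 0 (:1 :+ :1 :+ :- :1 := :1) refl
        θ≈ (suc n) = solve 2 (λ x y → x :+ y :+ :- :0 := x :+ y) refl _ _

      t-small : O (λ n → n ℕ.+ n) t
      t-small = O-*ʳ (O-*ˡ (poch-bounded (q ^ 2) 3) (wt-small 1 2))
        (O-≈ (λ n → sym (α.triple-product-even n)) (O-*ʳ (O-∘ (2 ℕ.*_) (⇝-bounded u⇝))
          (O-*ʳ (poch-bounded (q ^ 3) 3) (poch-bounded q 3))))

      fourth : ∃[ S ] ∃[ A₁ ] ∃[ A₂ ] ∃[ A₃ ] ∃[ B ] ∃[ C ] ∃[ R ] Sums S a b ×
        (poch (- (q ^ 3)) (q ^ 8) ⇝ A₁) × (poch (- (q ^ 5)) (q ^ 8) ⇝ A₂) × (poch (q ^ 8) (q ^ 8) ⇝ A₃) ×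
        (poch (q ^ 2) (q ^ 4) ⇝ B) × (poch (q ^ 4) (q ^ 4) ⇝ C) × Invertible C × R * C ≈ B ×
        S ≈ A₁ * (A₂ * (A₃ * 1#)) * R
      fourth = S , A₁ , A₂ , A₃ , B , Q∞ , B * u∞ , (t , (λ n → invertible n , quotient n) , Σt) ,
          A₁⇝ , A₂⇝ , Base.Q⇝ 7 , B⇝ , Q⇝ , Q∞-invertible , trans (*-assoc _ _ _) (trans (*-congˡ u∞Q∞≈1)
              (*-identityʳ _)) , S≈
        where
        SΣ = Σ-converges t (O-weaken (λ n → ℕ.m≤m+n n n) t-small)
        S = proj₁ SΣ
        Σt = proj₂ SΣ
        ΘΣ = Σ-converges θ-even (O-weaken (λ n → ℕ.m≤m+n n n) θ-small)
        Θ = proj₁ ΘΣ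
        A₁ = proj₁ (poch-converges (- (q ^ 3)) 7)
        A₁⇝ = proj₂ (poch-converges (- (q ^ 3)) 7)
        A₂ = proj₁ (poch-converges (- (q ^ 5)) 7)
        A₂⇝ = proj₂ (poch-converges (- (q ^ 5)) 7)
        A₃ = Base.Q∞ 7
        B = proj₁ (poch-converges (q ^ 2) 3)
        B⇝ = proj₂ (poch-converges (q ^ 2) 3)
        Θ≈ : Θ ≈ A₂ * A₁ * A₃
        Θ≈ = Base.theta-limit 7 0 θ-small (proj₂ ΘΣ) (⇝-* A₂⇝ A₁⇝) triple-product-even
        S≈ : S ≈ A₁ * (A₂ * (A₃ * 1#)) * (B * u∞)
        S≈ = begin
          S                                     ≈⟨ bailey-limit α.θ-even t-small Σt θ-small (proj₂ ΘΣ) B⇝ separation ⟩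
          B * Θ * u∞                            ≈⟨ *-congʳ (*-congˡ Θ≈) ⟩
          B * (A₂ * A₁ * A₃) * u∞               ≈⟨ solve 5 (λ a b c d u → d :* (b :* a :* c) :* u := a :* (b :*
              (c :* :1)) :* (d :* u)) refl A₁ A₂ A₃ B u∞ ⟩
          A₁ * (A₂ * (A₃ * 1#)) * (B * u∞)      ∎
        -- (q^2;q^4)_n (-q^2;q^4)_n = (q^4;q^8)_n, which with (q^8;q^8)_n makes up (q^4;q^4)_{2n}.
        -- The extra factor (q^2;q^4)_n is the one that δ_n brings along.
        denominator : ∀ n → b n * poch (q ^ 2) Q n ≈ poch Q Q (2 ℕ.* n)
        denominator n = begin
          poch (q ^ 8) (q ^ 8) n * poch (- (q ^ 2)) Q n * poch (q ^ 2) Q n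
            ≈⟨ solve 3 (λ a b c → a :* b :* c := c :* b :* a) refl _ _ _ ⟩
          poch (q ^ 2) Q n * poch (- (q ^ 2)) Q n * poch (q ^ 8) (q ^ 8) n
            ≈⟨ *-cong (±q² n) (q⁸ n) ⟩
          poch Q (Q ^ 2) n * poch (Q * Q) (Q ^ 2) n
            ≈⟨ poch-even Q Q n ⟨
          poch Q Q (2 ℕ.* n) ∎
        invertible : ∀ n → Invertible (b n)
        invertible n = invertible-factor (denominator n) (poch-invertible (2 ℕ.* n))
        quotient : ∀ n → t n * b n ≈ a n
        quotient n = begin
          poch (q ^ 2) Q n * wt (q ^ 2) Q n * β α.θ-even n * b n
            ≈⟨ *-congʳ (*-congˡ (α.triple-product-even n)) ⟩
          poch (q ^ 2) Q n * wt (q ^ 2) Q n * (u 3 (2 ℕ.* n) * (poch (q ^ 3) Q n * poch q Q n)) * b n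
            ≈⟨ solve 6 (λ p w v x y d → p :* w :* (v :* (x :* y)) :* d := v :* (d :* p) :*
                (y :* x :* w)) refl _ _ _ _ _ _ ⟩
          u 3 (2 ℕ.* n) * (b n * poch (q ^ 2) Q n) * (poch q Q n * poch (q ^ 3) Q n * wt (q ^ 2) Q n)
            ≈⟨ trans (*-congʳ (trans (*-congˡ (denominator n)) (u-inverse (2 ℕ.* n)))) (*-identityˡ _) ⟩
          poch q Q n * poch (q ^ 3) Q n * wt (q ^ 2) Q n
            ≈⟨ *-cong (q-q³ n) (trans (wt-power 2 4 n) (trans (*-comm _ _) (*-congʳ (reflexive (≡.cong (q ^_)
                 (expo-closed (λ n → 2 ℕ.* n ℕ.^ 2) ≡.refl square n)))))) ⟩
          poch q (q ^ 2) (2 ℕ.* n) * (q ^ (2 ℕ.* n ℕ.^ 2) * (- 1#) ^ n)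
            ≈⟨ *-assoc _ _ _ ⟨
          a n ∎
          where
          square : ∀ n → 2 ℕ.* (suc n ℕ.* (suc n ℕ.* 1)) ≡ 2 ℕ.* (n ℕ.* (n ℕ.* 1)) ℕ.+ (2 ℕ.+ 4 ℕ.* n)
          square = solve-∀

    -- Third identity

    Σ≤-*ˡ : ∀ c f n → Σ≤ (λ i → c * f i) n ≈ c * Σ≤ f n
    Σ≤-*ˡ c f zero    = sym (zeroʳ c)
    Σ≤-*ˡ c f (suc n) = trans (+-congʳ (Σ≤-*ˡ c f n)) (sym (distribˡ c _ _))

    module Third where
      open Base 3
      open BaileyLimit 1 (q ^ 2) (q ^ 6) (solve 1 (λ q → q :^ 2 :* q :^ 6 := (q :^ 4) :^ 2) refl q)
      module α₁ = TripleProduct (q ^ 3) q (solve 1 (λ q → q :^ 3 :* q := q :^ 4) refl q)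
      module α₂ = TripleProduct q (q ^ 3) (solve 1 (λ q → q :* q :^ 3 := q :^ 4) refl q)
      open Base.TripleProduct 7 (- (q ^ 7)) (- q) (solve 1 (λ q → :- (q :^ 7) :* :- q := q :^ 8) refl q)
        using (θ-odd; triple-product-odd)

      -- 1 / (1 + q), written as (1 - q) / (1 - q^2) since explicit inverses are at hand for the
      -- factors 1 - q^m.
      w : Carrier
      w = (1# - q) * G 1

      [1+q]w≈1 : (1# + q) * w ≈ 1#
      [1+q]w≈1 = trans (solve 2 (λ q g → (:1 :+ q) :* ((:1 :- q) :* g) := g :* (:1 :- q :^ 2)) refl q (G 1))
          (G-inverse 1)

      a b α t : ℕ → Carrier
      a n = poch q (q ^ 2) (2 ℕ.* n) * q ^ (2 ℕ.* n ℕ.^ 2 ℕ.+ 4 ℕ.* n) * (- 1#) ^ n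
      b n = poch (q ^ 8) (q ^ 8) n * poch (- (q ^ 2)) (q ^ 4) (n ℕ.+ 1)
      -- With t = Q^n the two triple products have the extra factors 1 - q t and 1 - q^3 t. This
      -- combination has q (1 - q t) + (1 - q^3 t) = (1 + q) (1 - q^2 t), of which the second factor
      -- extends (q^2;Q)_n to (q^2;Q)_{n+1}.
      α n = q * α₁.θ-odd n + α₂.θ-odd n
      t n = w * (δ n * β α n)

      β≈ : ∀ n → β α n ≈ u 3 (suc (2 ℕ.* n)) * ((1# + q) * (1# - q ^ 2 * Q ^ n) * (poch q Q n * poch (q ^ 3) Q n))
      β≈ n = begin
        Δ n (λ r k → (q * α₁.θ-odd r + α₂.θ-odd r) * (u 3 k * u 3 (k ℕ.+ suc (2 ℕ.* r))))
          ≈⟨ Δ-cong n (λ r k _ → solve 4 (λ q x y v → (q :* x :+ y) :* v := q :* (x :* v) :+ y :* v) refl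
               q (α₁.θ-odd r) (α₂.θ-odd r) (u 3 k * u 3 (k ℕ.+ suc (2 ℕ.* r)))) ⟩
        Δ n (λ r k → q * (α₁.θ-odd r * (u 3 k * u 3 (k ℕ.+ suc (2 ℕ.* r)))) + α₂.θ-odd r * (u 3 k * u 3 (k ℕ.+ suc
            (2 ℕ.* r))))
          ≈⟨ trans (Δ-+ n (λ r k → q * (α₁.θ-odd r * (u 3 k * u 3 (k ℕ.+ suc (2 ℕ.* r))))) (λ r k → α₂.θ-odd r *
              (u 3 k * u 3 (k ℕ.+ suc (2 ℕ.* r)))))
               (+-cong (trans (sym (Δ-*ˡ n q _)) (*-congˡ (α₁.triple-product-odd n))) (α₂.triple-product-odd n)) ⟩
        q * (u 3 (suc (2 ℕ.* n)) * (poch (q ^ 3) Q n * (poch q Q n * (1# - q * Q ^ n))))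
          + u 3 (suc (2 ℕ.* n)) * (poch q Q n * (poch (q ^ 3) Q n * (1# - q ^ 3 * Q ^ n)))
          ≈⟨ solve 5 (λ q v x y t → q :* (v :* (y :* (x :* (:1 :- q :* t)))) :+ v :* (x :* (y :*
              (:1 :- q :^ 3 :* t))) :=
               v :* ((:1 :+ q) :* (:1 :- q :^ 2 :* t) :* (x :* y))) refl q (u 3 (suc (2 ℕ.* n))) (poch q Q n) (poch
                   (q ^ 3) Q n) (Q ^ n) ⟩
        u 3 (suc (2 ℕ.* n)) * ((1# + q) * (1# - q ^ 2 * Q ^ n) * (poch q Q n * poch (q ^ 3) Q n)) ∎

      θ≈ : ∀ n → wt (- (q ^ 7)) (q ^ 8) n + q * wt (- (q ^ 9)) (q ^ 8) n ≈ θ-odd n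
      θ≈ n = +-congˡ (sym (trans (wt-suc (- q) (q ^ 8) n) (*-cong (solve 1 (λ q → :- :- q := q) refl q)
        (wt-cong (q ^ 8) n (solve 1 (λ q → :- q :* q :^ 8 := :- (q :^ 9)) refl q)))))

      -- α_i also has the factor 1 - q^2 Q^i. It is the one missing between (q^2;Q)_i and (q^6
      -- Q^i;Q)_m = (q^2 Q^(i+1);Q)_m.
      separation : ∀ i m → α i * δ i * poch (q ^ 6 * Q ^ i) Q m ≈ poch (q ^ 2) Q (suc (i ℕ.+ m)) * θ-odd i
      separation i m = begin
        (q * (wt (q ^ 3) Q i + wt q Q i * (- q * Q ^ i)) + (wt q Q i + wt (q ^ 3) Q i * (- (q ^ 3) * Q ^ i)))
          * (poch (q ^ 2) Q i * wt (q ^ 6) Q i) * poch (q ^ 6 * Q ^ i) Q m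
          ≈⟨ *-congˡ (poch-cong Q m (solve 2 (λ q t → q :^ 6 :* t := q :^ 2 :* (q :^ 4 :* t)) refl q (Q ^ i))) ⟩
        (q * (wt (q ^ 3) Q i + wt q Q i * (- q * Q ^ i)) + (wt q Q i + wt (q ^ 3) Q i * (- (q ^ 3) * Q ^ i)))
          * (poch (q ^ 2) Q i * wt (q ^ 6) Q i) * poch (q ^ 2 * Q ^ suc i) Q m
          ≈⟨ solve 7 (λ q x y t p v r →
               (q :* (x :+ y :* (:- q :* t)) :+ (y :+ x :* (:- (q :^ 3) :* t))) :* (p :* v) :* r :=
               p :* (:1 :- q :^ 2 :* t) :* r :* (y :* v :+ q :* (x :* v))) refl
               q (wt (q ^ 3) Q i) (wt q Q i) (Q ^ i) (poch (q ^ 2) Q i) (wt (q ^ 6) Q i) (poch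
                   (q ^ 2 * Q ^ suc i) Q m) ⟩
        poch (q ^ 2) Q (suc i) * poch (q ^ 2 * Q ^ suc i) Q m *
          (wt q Q i * wt (q ^ 6) Q i + q * (wt (q ^ 3) Q i * wt (q ^ 6) Q i))
          ≈⟨ *-cong (sym (poch-+ (q ^ 2) Q (suc i) m)) (trans (+-cong
               (merge i (solve 1 (λ q → :- (q :* q :^ 6) := :- (q :^ 7)) refl q))
               (*-congˡ (merge i (solve 1 (λ q → :- (q :^ 3 :* q :^ 6) := :- (q :^ 9)) refl q)))) (θ≈ i)) ⟩
        poch (q ^ 2) Q (suc (i ℕ.+ m)) * θ-odd i ∎

      θ-small : O (λ n → n ℕ.+ n) θ-odd
      θ-small = O-≈ θ≈ (O-+ (wt-neg-small 6 6) (O-*ˡ (O-const q) (wt-neg-small 8 6)))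

      δβ-small : O (λ n → n ℕ.+ n) (λ n → δ n * β α n)
      δβ-small = O-*ʳ (O-*ˡ (poch-bounded (q ^ 2) 3) (wt-small 5 2))
        (O-≈ (λ n → sym (β≈ n)) (O-*ʳ (O-∘ (λ n → suc (2 ℕ.* n)) (⇝-bounded u⇝))
          (O-*ʳ (O-*ʳ (O-const (1# + q)) (O-+ (O-const 1#) (O-neg (O-*ˡ (O-const (q ^ 2)) (O-bounded (Q-small 3))))))
            (O-*ʳ (poch-bounded q 3) (poch-bounded (q ^ 3) 3)))))

      third : ∃[ S ] ∃[ A₁ ] ∃[ A₂ ] ∃[ A₃ ] ∃[ B ] ∃[ C ] ∃[ R ] Sums S a b ×
        (poch (- (q ^ 9)) (q ^ 8) ⇝ A₁) × (poch (- (q ^ 7)) (q ^ 8) ⇝ A₂) × (poch (q ^ 8) (q ^ 8) ⇝ A₃) ×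
        (poch (q ^ 2) (q ^ 4) ⇝ B) × (poch (q ^ 4) (q ^ 4) ⇝ C) × Invertible C × R * C ≈ B ×
        S ≈ A₁ * (A₂ * (A₃ * 1#)) * R
      third = w * S , A₁ , A₂ , A₃ , B , Q∞ , B * u∞ , (t , (λ n → invertible n , quotient n) , Σt) ,
          A₁⇝ , A₂⇝ , Base.Q⇝ 7 , B⇝ , Q⇝ , Q∞-invertible , trans (*-assoc _ _ _) (trans (*-congˡ u∞Q∞≈1)
              (*-identityʳ _)) , S≈
        where
        SΣ = Σ-converges (λ n → δ n * β α n) (O-weaken (λ n → ℕ.m≤m+n n n) δβ-small)
        S = proj₁ SΣ
        Σt : Σ≤ t ⇝ w * S
        Σt = ⇝-≈ (λ n → sym (Σ≤-*ˡ w (λ n → δ n * β α n) n)) (⇝-* (⇝-const w) (proj₂ SΣ))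
        ΘΣ = Σ-converges θ-odd (O-weaken (λ n → ℕ.m≤m+n n n) θ-small)
        Θ = proj₁ ΘΣ
        A₁ = proj₁ (poch-converges (- (q ^ 9)) 7)
        A₁⇝ = proj₂ (poch-converges (- (q ^ 9)) 7)
        A₂ = proj₁ (poch-converges (- (q ^ 7)) 7)
        A₂⇝ = proj₂ (poch-converges (- (q ^ 7)) 7)
        A₃ = Base.Q∞ 7
        B = proj₁ (poch-converges (q ^ 2) 3)
        B⇝ = proj₂ (poch-converges (q ^ 2) 3)
        -- The theta series yields (-q;q^8)_∞ = (1 + q) (-q^9;q^8)_∞, whose factor 1 + q cancels
        -- against `w`.
        -q⇝ : (λ n → poch (- q) (q ^ 8) (suc n)) ⇝ (1# + q) * A₁
        -q⇝ = ⇝-≈ (λ n → sym (trans (poch-suc (- q) (q ^ 8) n) (*-cong (solve 1 (λ q → :1 :- :- q := :1 :+ q) refl q)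
          (poch-cong (q ^ 8) n (solve 1 (λ q → :- q :* q :^ 8 := :- (q :^ 9)) refl q))))) (⇝-* (⇝-const (1# + q)) A₁⇝)
        Θ≈ : Θ ≈ A₂ * ((1# + q) * A₁) * A₃
        Θ≈ = Base.theta-limit 7 1 θ-small (proj₂ ΘΣ) (⇝-* A₂⇝ -q⇝) triple-product-odd
        S≈ : w * S ≈ A₁ * (A₂ * (A₃ * 1#)) * (B * u∞)
        S≈ = begin
          w * S                                      ≈⟨ *-congˡ (bailey-limit α δβ-small (proj₂ SΣ) θ-small (proj₂ ΘΣ)
              (⇝-∘ suc ℕ.n≤1+n B⇝) separation) ⟩
          w * (B * Θ * u∞)                           ≈⟨ *-congˡ (*-congʳ (*-congˡ Θ≈)) ⟩
          w * (B * (A₂ * ((1# + q) * A₁) * A₃) * u∞) ≈⟨ solve 7 (λ a b c d u w q → w :* (d :* (b :*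
              ((:1 :+ q) :* a) :* c) :* u) :=
                                                          (:1 :+ q) :* w :* (a :* (b :* (c :* :1)) :*
                                                              (d :* u))) refl A₁ A₂ A₃ B u∞ w q ⟩
          (1# + q) * w * (A₁ * (A₂ * (A₃ * 1#)) * (B * u∞)) ≈⟨ trans (*-congʳ [1+q]w≈1) (*-identityˡ _) ⟩
          A₁ * (A₂ * (A₃ * 1#)) * (B * u∞)           ∎
        b≈ : ∀ n → b n ≈ poch (q ^ 8) (q ^ 8) n * poch (- (q ^ 2)) Q (suc n)
        b≈ n = *-congˡ (reflexive (≡.cong (poch (- (q ^ 2)) Q) (ℕ.+-comm n 1)))
        denominator : ∀ n → b n * poch (q ^ 2) Q (suc n) ≈ poch Q Q (suc (2 ℕ.* n))
        denominator n = begin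
          b n * poch (q ^ 2) Q (suc n)
            ≈⟨ *-congʳ (b≈ n) ⟩
          poch (q ^ 8) (q ^ 8) n * poch (- (q ^ 2)) Q (suc n) * poch (q ^ 2) Q (suc n)
            ≈⟨ solve 3 (λ a b c → a :* b :* c := c :* b :* a) refl (poch (q ^ 8) (q ^ 8) n) (poch (- (q ^ 2)) Q
                (suc n)) (poch (q ^ 2) Q (suc n)) ⟩
          poch (q ^ 2) Q (suc n) * poch (- (q ^ 2)) Q (suc n) * poch (q ^ 8) (q ^ 8) n
            ≈⟨ *-cong (±q² (suc n)) (q⁸ n) ⟩
          poch Q (Q ^ 2) (suc n) * poch (Q * Q) (Q ^ 2) n
            ≈⟨ poch-odd Q Q n ⟨
          poch Q Q (suc (2 ℕ.* n)) ∎
        invertible : ∀ n → Invertible (b n)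
        invertible n = invertible-factor (denominator n) (poch-invertible (suc (2 ℕ.* n)))
        quotient : ∀ n → t n * b n ≈ a n
        quotient n = begin
          w * (poch (q ^ 2) Q n * wt (q ^ 6) Q n * β α n) * b n
            ≈⟨ *-congʳ (*-congˡ (*-congˡ (β≈ n))) ⟩
          w * (poch (q ^ 2) Q n * wt (q ^ 6) Q n * (v * ((1# + q) * (1# - q ^ 2 * Q ^ n) * (poch q Q n * poch
              (q ^ 3) Q n)))) * b n
            ≈⟨ solve 9 (λ w p h v q t x y d → w :* (p :* h :* (v :* ((:1 :+ q) :* (:1 :- q :^ 2 :* t) :*
                (x :* y)))) :* d :=
                 (:1 :+ q) :* w :* (v :* (d :* (p :* (:1 :- q :^ 2 :* t)))) :* (x :* y :* h)) refl
                 w (poch (q ^ 2) Q n) (wt (q ^ 6) Q n) v q (Q ^ n) (poch q Q n) (poch (q ^ 3) Q n) (b n) ⟩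
          (1# + q) * w * (v * (b n * poch (q ^ 2) Q (suc n))) * (poch q Q n * poch (q ^ 3) Q n * wt (q ^ 6) Q n)
            ≈⟨ trans (*-congʳ (trans (*-cong [1+q]w≈1 (trans (*-congˡ (denominator n)) (u-inverse (suc (2 ℕ.* n)))))
                (*-identityˡ 1#))) (*-identityˡ _) ⟩
          poch q Q n * poch (q ^ 3) Q n * wt (q ^ 6) Q n
            ≈⟨ *-cong (q-q³ n) (trans (wt-power 6 4 n) (trans (*-comm _ _) (*-congʳ (reflexive (≡.cong (q ^_)
                 (expo-closed (λ n → 2 ℕ.* n ℕ.^ 2 ℕ.+ 4 ℕ.* n) ≡.refl square n)))))) ⟩
          poch q (q ^ 2) (2 ℕ.* n) * (q ^ (2 ℕ.* n ℕ.^ 2 ℕ.+ 4 ℕ.* n) * (- 1#) ^ n)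
            ≈⟨ *-assoc _ _ _ ⟨
          a n ∎
          where
          v = u 3 (suc (2 ℕ.* n))
          square : ∀ n → 2 ℕ.* (suc n ℕ.* (suc n ℕ.* 1)) ℕ.+ 4 ℕ.* suc n ≡
            2 ℕ.* (n ℕ.* (n ℕ.* 1)) ℕ.+ 4 ℕ.* n ℕ.+ (6 ℕ.+ 4 ℕ.* n)
          square = solve-∀

-- Transfer to separately given operations

bundle : {A : Set} {_≈_ : A → A → Set} {_+_ _*_ : A → A → A} { -_ : A → A} {0# 1# : A} →
  IsCommutativeRing _≈_ _+_ _*_ -_ 0# 1# → CommutativeRing 0ℓ 0ℓ
bundle isCR = record { isCommutativeRing = isCR }

-- The operations are separate parameters, so that the statements specialise to ones that literally
-- mention the operations on ℂ: to identify these with the projections of a ring bundle, the type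
-- checker would have to unfold Cauchy proofs.
module Identities
  {A : Set} {_≈_ : A → A → Set} {_+_ _*_ : A → A → A} { -_ : A → A} {0# 1# : A}
  (isCR : IsCommutativeRing _≈_ _+_ _*_ -_ 0# 1#) (norm : CompleteNorm _≈_ _+_ _*_ -_ 0# 1#)
  (_^_ : A → ℕ → A) (^-zero : ∀ x → (x ^ 0) ≈ 1#) (^-suc : ∀ x n → (x ^ suc n) ≈ (x * (x ^ n)))
  (Σ Π : (ℕ → A) → ℕ → A)
  (Σ-zero : ∀ f → Σ f 0 ≈ 0#) (Σ-suc : ∀ f n → Σ f (suc n) ≈ (f 0 + Σ (f ∘ suc) n))
  (Π-zero : ∀ f → Π f 0 ≈ 1#) (Π-suc : ∀ f n → Π f (suc n) ≈ (f 0 * Π (f ∘ suc) n))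
  (⟨_⨾_⟩ : A → A → ℕ → A) (⟨⟩≈Π : ∀ x y n → ⟨ x ⨾ y ⟩ n ≈ Π (λ j → 1# + (- (x * (y ^ j)))) n)
  (r : ℚ) (0<r : 0ℚ ℚ.< r) (r<1 : r ℚ.< 1ℚ)
  (q : A) (q-bound : ∀ n → CompleteNorm.Bound norm (q ^ n) (r ^ℚ n ℚ.+ r ^ℚ n)) where

  private
    R = bundle isCR
    module R = CommutativeRing R
  open CompleteNorm norm using (Bound; bound-mono)
  open import Algebra.Properties.CommutativeSemiring.Exp R.commutativeSemiring
    using () renaming (_^_ to _^ᴿ_; ^-congˡ to ^ᴿ-congˡ)
  open FiniteIdentities R using (poch; poch-cong₂; poch-suc)
  open GeometricConvergence R norm r 0<r r<1 using (O; mkO; O-≈; _⇝_; ⇝-≈; O-eventually; Σ≤)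
  open QSeries R norm r 0<r r<1 using (Sums; module First; module Second; module Third; module Fourth)

  ^≈ : ∀ x n → (x ^ᴿ n) ≈ (x ^ n)
  ^≈ x zero    = R.sym (^-zero x)
  ^≈ x (suc n) = R.trans (R.*-congˡ (^≈ x n)) (R.sym (^-suc x n))

  q-small : O id (λ n → q ^ᴿ n)
  q-small = O-≈ (λ n → R.sym (^≈ q n)) (mkO (1ℚ ℚ.+ 1ℚ) (ℚ.<⇒≤ (ℚ.positive⁻¹ (1ℚ ℚ.+ 1ℚ))) (λ n → bound-mono
    (ℚ.≤-reflexive (≡.sym (≡.trans (ℚ.*-distribʳ-+ (r ^ℚ n) 1ℚ 1ℚ)
      (≡.cong₂ ℚ._+_ (ℚ.*-identityˡ (r ^ℚ n)) (ℚ.*-identityˡ (r ^ℚ n)))))) (q-bound n)))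

  Π-cong : ∀ n {f g : ℕ → A} → (∀ j → f j ≈ g j) → Π f n ≈ Π g n
  Π-cong zero    h = R.trans (Π-zero _) (R.sym (Π-zero _))
  Π-cong (suc n) h = R.trans (Π-suc _ n) (R.trans (R.*-cong (h 0) (Π-cong n (h ∘ suc))) (R.sym (Π-suc _ n)))

  -- `poch` grows at its last factor and `Π` at its first, so the induction goes through `poch-suc`,
  -- which replaces x by x y.
  poch≈Π : ∀ x y n → poch x y n ≈ Π (λ j → 1# + (- (x * (y ^ j)))) n
  poch≈Π x y zero    = R.sym (Π-zero _)
  poch≈Π x y (suc n) = R.trans (poch-suc x y n) (R.trans
    (R.*-cong (R.+-congˡ (R.-‿cong (R.sym (R.trans (R.*-congˡ (^-zero y)) (R.*-identityʳ x)))))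
      (R.trans (poch≈Π (x * y) y n) (Π-cong n (λ j → R.+-congˡ (R.-‿cong
        (R.trans (R.*-assoc x y (y ^ j)) (R.*-congˡ (R.sym (^-suc y j)))))))))
    (R.sym (Π-suc _ n)))

  poch≈⟨⟩ : ∀ {x x′ y y′} n → x ≈ x′ → y ≈ y′ → poch x y n ≈ ⟨ x′ ⨾ y′ ⟩ n
  poch≈⟨⟩ {x′ = x′} {y′ = y′} n h k = R.trans (poch-cong₂ n h k) (R.trans (poch≈Π x′ y′ n) (R.sym (⟨⟩≈Π x′ y′ n)))

  Σ≤-suc : ∀ f n → Σ≤ f (suc n) ≈ (f 0 + Σ≤ (f ∘ suc) n)
  Σ≤-suc f zero    = R.+-comm _ _
  Σ≤-suc f (suc n) = R.trans (R.+-congʳ (Σ≤-suc f n)) (R.+-assoc _ _ _)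

  Σ≤≈Σ : ∀ f n → Σ≤ f n ≈ Σ f n
  Σ≤≈Σ f zero    = R.sym (Σ-zero f)
  Σ≤≈Σ f (suc n) = R.trans (Σ≤-suc f n) (R.trans (R.+-congˡ (Σ≤≈Σ (f ∘ suc) n)) (R.sym (Σ-suc f n)))

  Limit : (ℕ → A) → A → Set
  Limit s l = ∀ ε → 0ℚ ℚ.< ε → ∃[ N ] (∀ n → N ℕ.≤ n → Bound (s n + (- l)) ε)

  Invertible : A → Set
  Invertible z = ∃[ w ] ((z * w) ≈ 1#)

  SumOf : A → (ℕ → A) → (ℕ → A) → Set
  SumOf S a b = ∃[ t ] ((∀ n → Invertible (b n) × ((t n * b n) ≈ a n)) × Limit (Σ t) S)

  limit : ∀ {s t : ℕ → A} {l} → (∀ n → s n ≈ t n) → s ⇝ l → Limit t l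
  limit h s⇝l = O-eventually (⇝-≈ h s⇝l)

  sumOf : ∀ {S a b c d} → (∀ n → a n ≈ c n) → (∀ n → b n ≈ d n) → Sums q q-small S a b → SumOf S c d
  sumOf h k (t , quotients , Σt) = t
    , (λ n → let (w , bw≈1) , tb≈a = quotients n in
        (w , R.trans (R.*-congʳ (R.sym (k n))) bw≈1) , R.trans (R.*-congˡ (R.sym (k n))) (R.trans tb≈a (h n)))
    , limit (Σ≤≈Σ t) Σt

  -^≈ : ∀ n → (R.- (q ^ᴿ n)) ≈ (- (q ^ n))
  -^≈ n = R.-‿cong (^≈ q n)

  abstract
    identity₁ : ∃[ S ] ∃[ A ] ∃[ B ]
      SumOf S (λ n → (⟨ - (q ^ 2) ⨾ q ^ 2 ⟩ n) * (q ^ (n ℕ.^ 2))) (λ n → ⟨ q ⨾ q ⟩ (2 ℕ.* n ℕ.+ 1)) ×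
      Limit ⟨ - q ⨾ q ^ 2 ⟩ A × Limit ⟨ q ⨾ q ^ 2 ⟩ B × Invertible B × (S * B) ≈ A
    identity₁ = let S , A , B , s , A⇝ , B⇝ , rest = First.first q q-small in
      S , A , B
      , sumOf (λ n → R.*-cong (poch≈⟨⟩ n (-^≈ 2) (^≈ q 2)) (^≈ q (n ℕ.^ 2))) (λ n → poch≈⟨⟩
          (2 ℕ.* n ℕ.+ 1) R.refl R.refl) s
      , limit (λ n → poch≈⟨⟩ n R.refl (^≈ q 2)) A⇝ , limit (λ n → poch≈⟨⟩ n R.refl (^≈ q 2)) B⇝ , rest

    identity₂ : ∃[ S ] ∃[ A ] ∃[ B ] ∃[ C ] ∃[ D ]
      SumOf S (λ n → (⟨ - 1# ⨾ q ⟩ (2 ℕ.* n)) * (q ^ (n ℕ.^ 2 ℕ.+ n)))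
        (λ n → (⟨ q ^ 2 ⨾ q ^ 2 ⟩ n) * (⟨ q ^ 2 ⨾ q ^ 4 ⟩ n)) ×
      Limit ⟨ - (q ^ 3) ⨾ q ^ 6 ⟩ A × Limit ⟨ q ^ 6 ⨾ q ^ 6 ⟩ B × Limit ⟨ - (q ^ 2) ⨾ q ^ 2 ⟩ C ×
      Limit ⟨ q ^ 2 ⨾ q ^ 2 ⟩ D × Invertible D × (S * D) ≈ (((A ^ 2) * B) * C)
    identity₂ = let S , A , B , C , D , s , A⇝ , B⇝ , C⇝ , D⇝ , D-inv , eq = Second.second q q-small in
      S , A , B , C , D
      , sumOf (λ n → R.*-cong (poch≈⟨⟩ (2 ℕ.* n) R.refl R.refl) (^≈ q (n ℕ.^ 2 ℕ.+ n)))
          (λ n → R.*-cong (poch≈⟨⟩ n (^≈ q 2) (^≈ q 2)) (poch≈⟨⟩ n (^≈ q 2) (^≈ q 4))) s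
      , limit (λ n → poch≈⟨⟩ n (-^≈ 3) (^≈ q 6)) A⇝ , limit (λ n → poch≈⟨⟩ n (^≈ q 6) (^≈ q 6)) B⇝
      , limit (λ n → poch≈⟨⟩ n (-^≈ 2) (^≈ q 2)) C⇝ , limit (λ n → poch≈⟨⟩ n (^≈ q 2) (^≈ q 2)) D⇝
      , D-inv , R.trans eq (R.*-congʳ (R.*-congʳ (^≈ A 2)))

    identity₃ : ∃[ S ] ∃[ A₁ ] ∃[ A₂ ] ∃[ A₃ ] ∃[ B ] ∃[ C ] ∃[ R ]
      SumOf S (λ n → ((⟨ q ⨾ q ^ 2 ⟩ (2 ℕ.* n)) * (q ^ (2 ℕ.* n ℕ.^ 2 ℕ.+ 4 ℕ.* n))) * ((- 1#) ^ n))
        (λ n → (⟨ q ^ 8 ⨾ q ^ 8 ⟩ n) * (⟨ - (q ^ 2) ⨾ q ^ 4 ⟩ (n ℕ.+ 1))) ×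
      Limit ⟨ - (q ^ 9) ⨾ q ^ 8 ⟩ A₁ × Limit ⟨ - (q ^ 7) ⨾ q ^ 8 ⟩ A₂ × Limit ⟨ q ^ 8 ⨾ q ^ 8 ⟩ A₃ ×
      Limit ⟨ q ^ 2 ⨾ q ^ 4 ⟩ B × Limit ⟨ q ^ 4 ⨾ q ^ 4 ⟩ C ×
      Invertible C × (R * C) ≈ B × S ≈ ((A₁ * (A₂ * (A₃ * 1#))) * R)
    identity₃ = let S , A₁ , A₂ , A₃ , B , C , R , s , A₁⇝ , A₂⇝ , A₃⇝ , B⇝ , C⇝ , rest = Third.third q q-small in
      S , A₁ , A₂ , A₃ , B , C , R
      , sumOf (λ n → R.*-cong (R.*-cong (poch≈⟨⟩ (2 ℕ.* n) R.refl (^≈ q 2)) (^≈ q (2 ℕ.* n ℕ.^ 2 ℕ.+ 4 ℕ.* n))) (^≈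
          (- 1#) n))
          (λ n → R.*-cong (poch≈⟨⟩ n (^≈ q 8) (^≈ q 8)) (poch≈⟨⟩ (n ℕ.+ 1) (-^≈ 2) (^≈ q 4))) s
      , limit (λ n → poch≈⟨⟩ n (-^≈ 9) (^≈ q 8)) A₁⇝ , limit (λ n → poch≈⟨⟩ n (-^≈ 7) (^≈ q 8)) A₂⇝
      , limit (λ n → poch≈⟨⟩ n (^≈ q 8) (^≈ q 8)) A₃⇝
      , limit (λ n → poch≈⟨⟩ n (^≈ q 2) (^≈ q 4)) B⇝ , limit (λ n → poch≈⟨⟩ n (^≈ q 4) (^≈ q 4)) C⇝ , rest

    identity₄ : ∃[ S ] ∃[ A₁ ] ∃[ A₂ ] ∃[ A₃ ] ∃[ B ] ∃[ C ] ∃[ R ]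
      SumOf S (λ n → ((⟨ q ⨾ q ^ 2 ⟩ (2 ℕ.* n)) * (q ^ (2 ℕ.* n ℕ.^ 2))) * ((- 1#) ^ n))
        (λ n → (⟨ q ^ 8 ⨾ q ^ 8 ⟩ n) * (⟨ - (q ^ 2) ⨾ q ^ 4 ⟩ n)) ×
      Limit ⟨ - (q ^ 3) ⨾ q ^ 8 ⟩ A₁ × Limit ⟨ - (q ^ 5) ⨾ q ^ 8 ⟩ A₂ × Limit ⟨ q ^ 8 ⨾ q ^ 8 ⟩ A₃ ×
      Limit ⟨ q ^ 2 ⨾ q ^ 4 ⟩ B × Limit ⟨ q ^ 4 ⨾ q ^ 4 ⟩ C ×
      Invertible C × (R * C) ≈ B × S ≈ ((A₁ * (A₂ * (A₃ * 1#))) * R)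
    identity₄ = let S , A₁ , A₂ , A₃ , B , C , R , s , A₁⇝ , A₂⇝ , A₃⇝ , B⇝ , C⇝ , rest = Fourth.fourth q q-small in
      S , A₁ , A₂ , A₃ , B , C , R
      , sumOf (λ n → R.*-cong (R.*-cong (poch≈⟨⟩ (2 ℕ.* n) R.refl (^≈ q 2)) (^≈ q (2 ℕ.* n ℕ.^ 2))) (^≈ (- 1#) n))
          (λ n → R.*-cong (poch≈⟨⟩ n (^≈ q 8) (^≈ q 8)) (poch≈⟨⟩ n (-^≈ 2) (^≈ q 4))) s
      , limit (λ n → poch≈⟨⟩ n (-^≈ 3) (^≈ q 8)) A₁⇝ , limit (λ n → poch≈⟨⟩ n (-^≈ 5) (^≈ q 8)) A₂⇝
      , limit (λ n → poch≈⟨⟩ n (^≈ q 8) (^≈ q 8)) A₃⇝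
      , limit (λ n → poch≈⟨⟩ n (^≈ q 2) (^≈ q 4)) B⇝ , limit (λ n → poch≈⟨⟩ n (^≈ q 4) (^≈ q 4)) C⇝ , rest

open import Defs

-- The ℓ¹ norm on ℂ

module ComplexBounds where
  open RationalBounds
  open +-*-Solver

  size : ℂ → ℕ → ℚ
  size z n = ℓ¹ (seq (re z) n) (seq (im z) n)

  -- Compares rational approximations at two independent indices, as the diagonal argument for
  -- completeness demands.
  dist : ℂ → ℕ → ℂ → ℕ → ℚ
  dist z i w j = ℓ¹ (seq (re z) i ℚ.- seq (re w) j) (seq (im z) i ℚ.- seq (im w) j)

  dist-sym : ∀ z i w j → dist z i w j ≡ dist w j z i
  dist-sym z i w j = ≡.trans (≡.cong₂ ℓ¹ (flip (seq (re z) i) (seq (re w) j)) (flip (seq (im z) i) (seq (im w) j)))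
    (ℓ¹-neg (seq (re w) j ℚ.- seq (re z) i) (seq (im w) j ℚ.- seq (im z) i))
    where
    flip : ∀ a b → a ℚ.- b ≡ ℚ.- (b ℚ.- a)
    flip = solve 2 (λ a b → a :- b := :- (b :- a)) ≡.refl

  dist-triangle : ∀ z i w j v k → dist z i w j ℚ.≤ dist z i v k ℚ.+ dist v k w j
  dist-triangle z i w j v k = ℚ.≤-trans
    (ℚ.≤-reflexive (≡.cong₂ ℓ¹ (via (seq (re z) i) (seq (re v) k) (seq (re w) j)) (via (seq (im z) i) (seq (im v) k)
        (seq (im w) j))))
    (ℓ¹-+ (seq (re z) i ℚ.- seq (re v) k) (seq (im z) i ℚ.- seq (im v) k) (seq (re v) k ℚ.- seq (re w) j) (seq
        (im v) k ℚ.- seq (im w) j))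
    where
    via : ∀ a b c → a ℚ.- c ≡ (a ℚ.- b) ℚ.+ (b ℚ.- c)
    via = solve 3 (λ a b c → a :- c := (a :- b) :+ (b :- c)) ≡.refl

  dist-cauchy : ∀ z ε → 0ℚ ℚ.< ε → ∃[ N ] (∀ m n → N ℕ.≤ m → N ℕ.≤ n → dist z m z n ℚ.≤ ε)
  dist-cauchy z ε 0<ε
    with cauchy (re z) (½ ℚ.* ε) (half-pos 0<ε) | cauchy (im z) (½ ℚ.* ε) (half-pos 0<ε)
  ... | M , hM | N , hN = M ℕ.⊔ N , λ m n p q → ℚ.≤-trans
    (ℚ.<⇒≤ (ℚ.+-mono-< (hM m n (ℕ.m⊔n≤o⇒m≤o M N p) (ℕ.m⊔n≤o⇒m≤o M N q))
                       (hN m n (ℕ.m⊔n≤o⇒n≤o M N p) (ℕ.m⊔n≤o⇒n≤o M N q))))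
    (ℚ.≤-reflexive (halves ε))

  -- |re z| + |im z| ≤ c. The ℓ¹ norm is submultiplicative and, unlike the modulus, rational on rationals.
  record Bound (z : ℂ) (c : ℚ) : Set where
    constructor mkBound
    field
      eventually : ∀ ε → 0ℚ ℚ.< ε → ∃[ N ] (∀ n → N ℕ.≤ n → size z n ℚ.≤ c ℚ.+ ε)
  open Bound

  bound-pointwise : ∀ {z c} → (∀ n → size z n ℚ.≤ c) → Bound z c
  bound-pointwise h = mkBound λ ε 0<ε → 0 , λ n _ → ℚ.≤-trans (h n) (≤-+-nonNeg ≡.refl (ℚ.<⇒≤ 0<ε))

  bound-size : ∀ {z w c} → (∀ n → size w n ℚ.≤ size z n) → Bound z c → Bound w c
  bound-size h b = mkBound λ ε 0<ε → let N , hN = eventually b ε 0<ε in N , λ n p → ℚ.≤-trans (h n) (hN n p)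

  bound-rearrange : ∀ {z w c} → (∀ n → seq (re z) n ≡ seq (re w) n) → (∀ n → seq (im z) n ≡ seq (im w) n) →
    Bound z c → Bound w c
  bound-rearrange hr hi = bound-size (λ n → ℚ.≤-reflexive (≡.cong₂ ℓ¹ (≡.sym (hr n)) (≡.sym (hi n))))

  bound-mono : ∀ {z c d} → c ℚ.≤ d → Bound z c → Bound z d
  bound-mono c≤d b = mkBound λ ε 0<ε → let N , hN = eventually b ε 0<ε in N , λ n p → ℚ.≤-trans (hN n p) (ℚ.+-monoˡ-≤ ε c≤d)

  bound-zero : Bound 0ℂ 0ℚ
  bound-zero = bound-pointwise {0ℂ} (λ _ → ℚ.≤-refl)

  bound-one : Bound 1ℂ 1ℚ
  bound-one = bound-pointwise {1ℂ} (λ _ → ℚ.≤-refl)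

  bound-neg : ∀ {z c} → Bound z c → Bound (- z) c
  bound-neg {z} = bound-size (λ n → ℚ.≤-reflexive (ℓ¹-neg (seq (re z) n) (seq (im z) n)))

  bound-+ : ∀ {z w c d} → Bound z c → Bound w d → Bound (z + w) (c ℚ.+ d)
  eventually (bound-+ {z} {w} {c} {d} bz bw) ε 0<ε
    with eventually bz (½ ℚ.* ε) (half-pos 0<ε) | eventually bw (½ ℚ.* ε) (half-pos 0<ε)
  ... | M , hM | N , hN = M ℕ.⊔ N , λ n p → begin
      size (z + w) n
        ≤⟨ ℓ¹-+ (seq (re z) n) (seq (im z) n) (seq (re w) n) (seq (im w) n) ⟩
      size z n ℚ.+ size w n
        ≤⟨ ℚ.+-mono-≤ (hM n (ℕ.m⊔n≤o⇒m≤o M N p)) (hN n (ℕ.m⊔n≤o⇒n≤o M N p)) ⟩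
      (c ℚ.+ ½ ℚ.* ε) ℚ.+ (d ℚ.+ ½ ℚ.* ε)
        ≡⟨ solve 3 (λ c d h → (c :+ h) :+ (d :+ h) := (c :+ d) :+ (h :+ h)) ≡.refl c d (½ ℚ.* ε) ⟩
      (c ℚ.+ d) ℚ.+ (½ ℚ.* ε ℚ.+ ½ ℚ.* ε)
        ≡⟨ ≡.cong (c ℚ.+ d ℚ.+_) (halves ε) ⟩
      c ℚ.+ d ℚ.+ ε ∎
    where open ℚ.≤-Reasoning

  bound-* : ∀ {z w c d} → 0ℚ ℚ.≤ c → 0ℚ ℚ.≤ d → Bound z c → Bound w d → Bound (z * w) (c ℚ.* d)
  -- η = ε / (c + d + 1 + ε) is at most 1, hence η (c + d + η) ≤ η (c + d + 1) ≤ ε.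
  eventually (bound-* {z} {w} {c} {d} 0≤c 0≤d bz bw) ε 0<ε
    with divide ε (c ℚ.+ d ℚ.+ 1ℚ ℚ.+ ε) 0<ε (ℚ.+-mono-≤-< (0≤-+ (0≤-+ 0≤c 0≤d) (ℚ.<⇒≤ (ℚ.positive⁻¹ 1ℚ))) 0<ε)
  ... | η , 0<η , Dη≡ε with eventually bz η 0<η | eventually bw η 0<η
  ... | M , hM | N , hN = M ℕ.⊔ N , λ n p → begin
      size (z * w) n
        ≤⟨ ℓ¹-* (seq (re z) n) (seq (im z) n) (seq (re w) n) (seq (im w) n) ⟩
      size z n ℚ.* size w n
        ≤⟨ *-mono-≤ (0≤-+ 0≤c 0≤η) (ℓ¹-nonNeg (seq (re w) n) (seq (im w) n))
             (hM n (ℕ.m⊔n≤o⇒m≤o M N p)) (hN n (ℕ.m⊔n≤o⇒n≤o M N p)) ⟩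
      (c ℚ.+ η) ℚ.* (d ℚ.+ η)
        ≤⟨ ≤-+-nonNeg {d = η ℚ.* (1ℚ ℚ.- η) ℚ.+ η ℚ.* ε}
             (≡.trans (≡.cong (c ℚ.* d ℚ.+_) (≡.sym Dη≡ε)) (solve 4 (λ c d e h →
               c :* d :+ (c :+ d :+ con 1ℚ :+ e) :* h := (c :+ h) :* (d :+ h) :+ (h :*
                   (con 1ℚ :- h) :+ h :* e)) ≡.refl c d ε η))
             (0≤-+ (0≤-* 0≤η (∸-nonNeg η≤1)) (0≤-* 0≤η (ℚ.<⇒≤ 0<ε))) ⟩
      c ℚ.* d ℚ.+ ε ∎
    where
    open ℚ.≤-Reasoning
    0≤η = ℚ.<⇒≤ 0<η
    D = c ℚ.+ d ℚ.+ 1ℚ ℚ.+ ε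
    0<D : 0ℚ ℚ.< D
    0<D = ℚ.+-mono-≤-< (0≤-+ (0≤-+ 0≤c 0≤d) (ℚ.<⇒≤ (ℚ.positive⁻¹ 1ℚ))) 0<ε
    η≤1 : η ℚ.≤ 1ℚ
    η≤1 = ℚ.*-cancelˡ-≤-pos D {{ℚ.positive 0<D}} (ℚ.≤-trans (ℚ.≤-reflexive Dη≡ε)
      (≤-+-nonNeg (solve 3 (λ c d e → (c :+ d :+ con 1ℚ :+ e) :* con 1ℚ := e :+ (c :+ d :+ con 1ℚ)) ≡.refl c d ε)
        (0≤-+ (0≤-+ 0≤c 0≤d) (ℚ.<⇒≤ (ℚ.positive⁻¹ 1ℚ)))))

  bounded : ∀ z → ∃[ c ] 0ℚ ℚ.≤ c × Bound z c
  bounded z with dist-cauchy z 1ℚ (ℚ.positive⁻¹ 1ℚ)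
  ... | N , h = 1ℚ ℚ.+ size z N , 0≤-+ (ℚ.<⇒≤ (ℚ.positive⁻¹ 1ℚ)) (ℓ¹-nonNeg (seq (re z) N) (seq (im z) N)) , mkBound
      λ ε 0<ε → N , λ n p → begin
      size z n
        ≡⟨ ≡.cong₂ ℓ¹ (via (seq (re z) n) (seq (re z) N)) (via (seq (im z) n) (seq (im z) N)) ⟩
      ℓ¹ ((seq (re z) n ℚ.- seq (re z) N) ℚ.+ seq (re z) N) ((seq (im z) n ℚ.- seq (im z) N) ℚ.+ seq (im z) N)
        ≤⟨ ℓ¹-+ (seq (re z) n ℚ.- seq (re z) N) (seq (im z) n ℚ.- seq (im z) N) (seq (re z) N) (seq (im z) N) ⟩
      dist z n z N ℚ.+ size z N   ≤⟨ ℚ.+-monoˡ-≤ (size z N) (h n N p ℕ.≤-refl) ⟩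
      1ℚ ℚ.+ size z N             ≤⟨ ≤-+-nonNeg ≡.refl (ℚ.<⇒≤ 0<ε) ⟩
      1ℚ ℚ.+ size z N ℚ.+ ε       ∎
    where
    open ℚ.≤-Reasoning
    via : ∀ a b → a ≡ (a ℚ.- b) ℚ.+ b
    via = CauchyLemmas.split

  ≈⇒bound : ∀ {z w} → z ≈ w → Bound (z - w) 0ℚ
  eventually (≈⇒bound (r , i)) ε 0<ε with r (½ ℚ.* ε) (half-pos 0<ε) | i (½ ℚ.* ε) (half-pos 0<ε)
  ... | M , hM | N , hN = M ℕ.⊔ N , λ n p → ℚ.≤-trans
    (ℚ.<⇒≤ (ℚ.+-mono-< (hM n (ℕ.m⊔n≤o⇒m≤o M N p)) (hN n (ℕ.m⊔n≤o⇒n≤o M N p))))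
    (ℚ.≤-reflexive (≡.trans (halves ε) (≡.sym (ℚ.+-identityˡ ε))))

  half-< : ∀ {ε} → 0ℚ ℚ.< ε → ½ ℚ.* ε ℚ.< ε
  half-< {ε} 0<ε = <-+-pos (≡.sym (halves ε)) (half-pos 0<ε)

  bound⇒≈ : ∀ {z w} → Bound (z - w) 0ℚ → z ≈ w
  bound⇒≈ {z} {w} b =
      (λ ε 0<ε → let N , h = eventually b (½ ℚ.* ε) (half-pos 0<ε) in N , λ n p →
        ℚ.≤-<-trans (ℚ.≤-trans (∣fst∣≤ℓ¹ _ (seq (im z) n ℚ.- seq (im w) n)) (h n p)) (small 0<ε))
    , (λ ε 0<ε → let N , h = eventually b (½ ℚ.* ε) (half-pos 0<ε) in N , λ n p →
        ℚ.≤-<-trans (ℚ.≤-trans (∣snd∣≤ℓ¹ (seq (re z) n ℚ.- seq (re w) n) _) (h n p)) (small 0<ε))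
    where
    small : ∀ {ε} → 0ℚ ℚ.< ε → 0ℚ ℚ.+ ½ ℚ.* ε ℚ.< ε
    small 0<ε = ℚ.≤-<-trans (ℚ.≤-reflexive (ℚ.+-identityˡ _)) (half-< 0<ε)

  -- Reduces each ring law of ℂ to an identity between rationals at every index.
  pointwise : ∀ {z w} → (∀ n → seq (re z) n ≡ seq (re w) n) → (∀ n → seq (im z) n ≡ seq (im w) n) → z ≈ w
  pointwise {z} {w} hr hi = bound⇒≈ {z} {w} (bound-pointwise {z - w} (λ n → ℚ.≤-reflexive (≡.cong₂ ℓ¹
    (≡.trans (≡.cong (ℚ._- seq (re w) n) (hr n)) (ℚ.+-inverseʳ (seq (re w) n)))
    (≡.trans (≡.cong (ℚ._- seq (im w) n) (hi n)) (ℚ.+-inverseʳ (seq (im w) n))))))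

  bound-≈ : ∀ {z w c} → z ≈ w → Bound z c → Bound w c
  bound-≈ {z} {w} {c} z≈w b = bound-rearrange {z + - (z - w)} {w}
    (λ n → cancel (seq (re z) n) (seq (re w) n)) (λ n → cancel (seq (im z) n) (seq (im w) n))
    (bound-mono {z + - (z - w)} (ℚ.≤-reflexive (ℚ.+-identityʳ c)) (bound-+ {z} { - (z - w)} b (bound-neg {z - w}
        (≈⇒bound {z} {w} z≈w))))
    where
    cancel : ∀ a b → a ℚ.+ ℚ.- (a ℚ.- b) ≡ b
    cancel = solve 2 (λ a b → a :+ :- (a :- b) := b) ≡.refl

  bound-separated : ∀ {z w} → (∀ ε → 0ℚ ℚ.< ε → Bound (z - w) ε) → z ≈ w
  bound-separated {z} {w} h = bound⇒≈ {z} {w} (mkBound λ ε 0<ε →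
    let N , hN = eventually (h (½ ℚ.* ε) (half-pos 0<ε)) (½ ℚ.* ε) (half-pos 0<ε)
    in N , λ n p → ℚ.≤-trans (hN n p) (ℚ.≤-reflexive (≡.trans (halves ε) (≡.sym (ℚ.+-identityˡ ε)))))

  ≈-refl : ∀ {z} → z ≈ z
  ≈-refl {z} = pointwise {z} {z} (λ _ → ≡.refl) (λ _ → ≡.refl)

  ≈-sym : ∀ {z w} → z ≈ w → w ≈ z
  ≈-sym {z} {w} h = bound⇒≈ {w} {z} (bound-size {z - w} {w - z} (λ n → ℚ.≤-reflexive (dist-sym w n z n))
      (≈⇒bound {z} {w} h))

  ≈-trans : ∀ {z w v} → z ≈ w → w ≈ v → z ≈ v
  ≈-trans {z} {w} {v} h k = bound⇒≈ {z} {v} (bound-≈ {z - w + (w - v)} {z - v}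
    (pointwise {z - w + (w - v)} {z - v} (λ n → via (seq (re z) n) (seq (re w) n) (seq (re v) n)) (λ n → via (seq
        (im z) n) (seq (im w) n) (seq (im v) n)))
    (bound-+ {z - w} {w - v} (≈⇒bound {z} {w} h) (≈⇒bound {w} {v} k)))
    where
    via : ∀ a b c → (a ℚ.- b) ℚ.+ (b ℚ.- c) ≡ a ℚ.- c
    via = solve 3 (λ a b c → (a :- b) :+ (b :- c) := a :- c) ≡.refl

  +-cong : ∀ {x y u v} → x ≈ y → u ≈ v → x + u ≈ y + v
  +-cong {x} {y} {u} {v} h k = bound⇒≈ {x + u} {y + v} (bound-rearrange {x - y + (u - v)} {x + u - (y + v)}
    (λ n → mid (seq (re x) n) (seq (re y) n) (seq (re u) n) (seq (re v) n))
    (λ n → mid (seq (im x) n) (seq (im y) n) (seq (im u) n) (seq (im v) n))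
    (bound-+ {x - y} {u - v} (≈⇒bound {x} {y} h) (≈⇒bound {u} {v} k)))
    where
    mid : ∀ a b c d → (a ℚ.- b) ℚ.+ (c ℚ.- d) ≡ (a ℚ.+ c) ℚ.- (b ℚ.+ d)
    mid = solve 4 (λ a b c d → (a :- b) :+ (c :- d) := (a :+ c) :- (b :+ d)) ≡.refl

  neg-cong : ∀ {x y} → x ≈ y → - x ≈ - y
  neg-cong {x} {y} h = bound⇒≈ { - x } { - y } (bound-rearrange { - (x - y) } { - x - - y }
    (λ n → dis (seq (re x) n) (seq (re y) n)) (λ n → dis (seq (im x) n) (seq (im y) n)) (bound-neg {x - y}
        (≈⇒bound {x} {y} h)))
    where
    dis : ∀ a b → ℚ.- (a ℚ.- b) ≡ (ℚ.- a) ℚ.- (ℚ.- b)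
    dis = solve 2 (λ a b → :- (a :- b) := (:- a) :- (:- b)) ≡.refl

  *-cong : ∀ {x y u v} → x ≈ y → u ≈ v → x * u ≈ y * v
  *-cong {x} {y} {u} {v} h k =
    let c , 0≤c , bu = bounded u
        d , 0≤d , by = bounded y
    in bound⇒≈ {x * u} {y * v} (bound-rearrange {(x - y) * u + y * (u - v)} {x * u - y * v}
      (λ n → mid₁ (seq (re x) n) (seq (im x) n) (seq (re y) n) (seq (im y) n) (seq (re u) n) (seq (im u) n) (seq
          (re v) n) (seq (im v) n))
      (λ n → mid₂ (seq (re x) n) (seq (im x) n) (seq (re y) n) (seq (im y) n) (seq (re u) n) (seq (im u) n) (seq
          (re v) n) (seq (im v) n))
      (bound-mono {(x - y) * u + y * (u - v)} (ℚ.≤-reflexive (solve 2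
          (λ c d → con 0ℚ :* c :+ d :* con 0ℚ := con 0ℚ) ≡.refl c d))
        (bound-+ {(x - y) * u} {y * (u - v)}
          (bound-* {x - y} {u} ℚ.≤-refl 0≤c (≈⇒bound {x} {y} h) bu)
          (bound-* {y} {u - v} 0≤d ℚ.≤-refl by (≈⇒bound {u} {v} k)))))
    where
    mid₁ : ∀ x x′ y y′ u u′ v v′ →
      ((x ℚ.- y) ℚ.* u ℚ.- (x′ ℚ.- y′) ℚ.* u′) ℚ.+ (y ℚ.* (u ℚ.- v) ℚ.- y′ ℚ.* (u′ ℚ.- v′)) ≡
      (x ℚ.* u ℚ.- x′ ℚ.* u′) ℚ.- (y ℚ.* v ℚ.- y′ ℚ.* v′)
    mid₁ = solve 8 (λ x x′ y y′ u u′ v v′ →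
      ((x :- y) :* u :- (x′ :- y′) :* u′) :+ (y :* (u :- v) :- y′ :* (u′ :- v′)) :=
      (x :* u :- x′ :* u′) :- (y :* v :- y′ :* v′)) ≡.refl
    mid₂ : ∀ x x′ y y′ u u′ v v′ →
      ((x ℚ.- y) ℚ.* u′ ℚ.+ (x′ ℚ.- y′) ℚ.* u) ℚ.+ (y ℚ.* (u′ ℚ.- v′) ℚ.+ y′ ℚ.* (u ℚ.- v)) ≡
      (x ℚ.* u′ ℚ.+ x′ ℚ.* u) ℚ.- (y ℚ.* v′ ℚ.+ y′ ℚ.* v)
    mid₂ = solve 8 (λ x x′ y y′ u u′ v v′ →
      ((x :- y) :* u′ :+ (x′ :- y′) :* u) :+ (y :* (u′ :- v′) :+ y′ :* (u :- v)) :=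
      (x :* u′ :+ x′ :* u) :- (y :* v′ :+ y′ :* v)) ≡.refl

-- Completeness of ℂ, limits and apartness

module ComplexCompleteness where
  open RationalBounds
  open ComplexBounds
  open Bound
  open +-*-Solver

  abstract
    isCommutativeRing : IsCommutativeRing _≈_ _+_ _*_ -_ 0ℂ 1ℂ
    isCommutativeRing = record
      { isRing = record
        { +-isAbelianGroup = record
          { isGroup = record
            { isMonoid = record
              { isSemigroup = record
                { isMagma = record
                  { isEquivalence = record
                    { refl  = λ {z} → ≈-refl {z}
                    ; sym   = λ {z w} → ≈-sym {z} {w}
                    ; trans = λ {z w v} → ≈-trans {z} {w} {v}
                    }
                  ; ∙-cong = λ {x y u v} → +-cong {x} {y} {u} {v}
                  }
                ; assoc = λ x y z → pointwise {(x + y) + z} {x + (y + z)}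
                    (λ n → ℚ.+-assoc (seq (re x) n) (seq (re y) n) (seq (re z) n))
                    (λ n → ℚ.+-assoc (seq (im x) n) (seq (im y) n) (seq (im z) n))
                }
              ; identity =
                  (λ x → pointwise {0ℂ + x} {x} (λ n → ℚ.+-identityˡ (seq (re x) n)) (λ n → ℚ.+-identityˡ (seq
                      (im x) n)))
                , (λ x → pointwise {x + 0ℂ} {x} (λ n → ℚ.+-identityʳ (seq (re x) n)) (λ n → ℚ.+-identityʳ (seq
                    (im x) n)))
              }
            ; inverse =
                (λ x → pointwise { - x + x} {0ℂ} (λ n → ℚ.+-inverseˡ (seq (re x) n)) (λ n → ℚ.+-inverseˡ (seq
                    (im x) n)))
              , (λ x → pointwise {x + - x} {0ℂ} (λ n → ℚ.+-inverseʳ (seq (re x) n)) (λ n → ℚ.+-inverseʳ (seq (im x) n)))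
            ; ⁻¹-cong = λ {x y} → neg-cong {x} {y}
            }
          ; comm = +-comm
          }
        ; *-cong = λ {x y u v} → *-cong {x} {y} {u} {v}
        ; *-assoc = λ x y z → pointwise {x * y * z} {x * (y * z)}
            (λ n → solve 6 (λ x x′ y y′ z z′ →
              (x :* y :- x′ :* y′) :* z :- (x :* y′ :+ x′ :* y) :* z′ :=
              x :* (y :* z :- y′ :* z′) :- x′ :* (y :* z′ :+ y′ :* z)) ≡.refl
              (seq (re x) n) (seq (im x) n) (seq (re y) n) (seq (im y) n) (seq (re z) n) (seq (im z) n))
            (λ n → solve 6 (λ x x′ y y′ z z′ →
              (x :* y :- x′ :* y′) :* z′ :+ (x :* y′ :+ x′ :* y) :* z :=
              x :* (y :* z′ :+ y′ :* z) :+ x′ :* (y :* z :- y′ :* z′)) ≡.refl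
              (seq (re x) n) (seq (im x) n) (seq (re y) n) (seq (im y) n) (seq (re z) n) (seq (im z) n))
        ; *-identity = *-identityˡ , λ x → ≈-trans {x * 1ℂ} {1ℂ * x} {x} (*-comm x 1ℂ) (*-identityˡ x)
        ; distrib = distribˡ , λ x y z →
            ≈-trans {(y + z) * x} {x * (y + z)} {y * x + z * x} (*-comm (y + z) x)
              (≈-trans {x * (y + z)} {x * y + x * z} {y * x + z * x} (distribˡ x y z)
                (+-cong {x * y} {y * x} {x * z} {z * x} (*-comm x y) (*-comm x z)))
        }
      ; *-comm = *-comm
      }
      where
      +-comm : ∀ x y → x + y ≈ y + x
      +-comm x y = pointwise {x + y} {y + x}
        (λ n → ℚ.+-comm (seq (re x) n) (seq (re y) n)) (λ n → ℚ.+-comm (seq (im x) n) (seq (im y) n))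
      *-comm : ∀ x y → x * y ≈ y * x
      *-comm x y = pointwise {x * y} {y * x}
        (λ n → solve 4 (λ x x′ y y′ → x :* y :- x′ :* y′ := y :* x :- y′ :* x′) ≡.refl
          (seq (re x) n) (seq (im x) n) (seq (re y) n) (seq (im y) n))
        (λ n → solve 4 (λ x x′ y y′ → x :* y′ :+ x′ :* y := y :* x′ :+ y′ :* x) ≡.refl
          (seq (re x) n) (seq (im x) n) (seq (re y) n) (seq (im y) n))
      *-identityˡ : ∀ x → 1ℂ * x ≈ x
      *-identityˡ x = pointwise {1ℂ * x} {x}
        (λ n → solve 2 (λ x x′ → con 1ℚ :* x :- con 0ℚ :* x′ := x) ≡.refl (seq (re x) n) (seq (im x) n))
        (λ n → solve 2 (λ x x′ → con 1ℚ :* x′ :+ con 0ℚ :* x := x′) ≡.refl (seq (re x) n) (seq (im x) n))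
      distribˡ : ∀ x y z → x * (y + z) ≈ x * y + x * z
      distribˡ x y z = pointwise {x * (y + z)} {x * y + x * z}
        (λ n → solve 6 (λ x x′ y y′ z z′ → x :* (y :+ z) :- x′ :* (y′ :+ z′) :=
          (x :* y :- x′ :* y′) :+ (x :* z :- x′ :* z′)) ≡.refl
          (seq (re x) n) (seq (im x) n) (seq (re y) n) (seq (im y) n) (seq (re z) n) (seq (im z) n))
        (λ n → solve 6 (λ x x′ y y′ z z′ → x :* (y′ :+ z′) :+ x′ :* (y :+ z) :=
          (x :* y′ :+ x′ :* y) :+ (x :* z′ :+ x′ :* z)) ≡.refl
          (seq (re x) n) (seq (im x) n) (seq (re y) n) (seq (im y) n) (seq (re z) n) (seq (im z) n))

  0<½ : 0ℚ ℚ.< ½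
  0<½ = ℚ.positive⁻¹ ½

  ½<1 : ½ ℚ.< 1ℚ
  ½<1 = ℚ.*<* (ℤ.+<+ (ℕ.s≤s (ℕ.s≤s ℕ.z≤n)))

  -- The limit is the diagonal sequence k ↦ (s k) at an index where s k varies by at most ½^k.
  complete : (s : ℕ → ℂ) (e : ℕ → ℚ) →
    (∀ ε → 0ℚ ℚ.< ε → ∃[ N ] (∀ n → N ℕ.≤ n → e n ℚ.< ε)) →
    (∀ n k → Bound (s (k ℕ.+ n) - s n) (e n)) →
    ∃[ l ] (∀ n → Bound (s n - l) (e n))
  complete s e e→0 s-cauchy = l , λ n → mkBound λ ε 0<ε →
      let K , h = near n ε 0<ε in K , λ k p → h k k p p
    where
    open Powers ½ 0<½ ½<1

    M : ℕ → ℕ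
    M k = proj₁ (dist-cauchy (s k) (½ ^ℚ k) (^ℚ-pos k))

    near : ∀ n δ → 0ℚ ℚ.< δ → ∃[ K ] (∀ k i → K ℕ.≤ k → K ℕ.≤ i → dist (s n) i (s k) (M k) ℚ.≤ e n ℚ.+ δ)
    near n δ 0<δ = (n ℕ.⊔ K₁) ℕ.⊔ K₂ , λ k i p q →
      let n≤k = ℕ.m⊔n≤o⇒m≤o n K₁ (ℕ.m⊔n≤o⇒m≤o (n ℕ.⊔ K₁) K₂ p)
          K₁≤k = ℕ.m⊔n≤o⇒n≤o n K₁ (ℕ.m⊔n≤o⇒m≤o (n ℕ.⊔ K₁) K₂ p)
          K₂≤i = ℕ.m⊔n≤o⇒n≤o (n ℕ.⊔ K₁) K₂ q
          N , sk-sn = eventually (s-cauchy n (k ℕ.∸ n)) ¼δ 0<¼δ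
          -- An intermediate index beyond all three thresholds, since s n and s k are known to be
          -- close only eventually.
          j = (K₂ ℕ.⊔ M k) ℕ.⊔ N
          K₂≤j = ℕ.m⊔n≤o⇒m≤o K₂ (M k) (ℕ.m⊔n≤o⇒m≤o (K₂ ℕ.⊔ M k) N ℕ.≤-refl)
          M≤j = ℕ.m⊔n≤o⇒n≤o K₂ (M k) (ℕ.m⊔n≤o⇒m≤o (K₂ ℕ.⊔ M k) N ℕ.≤-refl)
          N≤j = ℕ.m⊔n≤o⇒n≤o (K₂ ℕ.⊔ M k) N ℕ.≤-refl
          middle : dist (s n) j (s k) j ℚ.≤ e n ℚ.+ ¼δ
          middle = ℚ.≤-trans (ℚ.≤-reflexive (≡.trans (dist-sym (s n) j (s k) j)
            (≡.cong (λ m → dist (s m) j (s n) j) (≡.sym (ℕ.m∸n+n≡m n≤k))))) (sk-sn j N≤j)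
      in begin
        dist (s n) i (s k) (M k)
          ≤⟨ dist-triangle (s n) i (s k) (M k) (s n) j ⟩
        dist (s n) i (s n) j ℚ.+ dist (s n) j (s k) (M k)
          ≤⟨ ℚ.+-mono-≤ (proj₂ (dist-cauchy (s n) ¼δ 0<¼δ) i j K₂≤i K₂≤j) (dist-triangle (s n) j (s k) (M k) (s k) j) ⟩
        ¼δ ℚ.+ (dist (s n) j (s k) j ℚ.+ dist (s k) j (s k) (M k))
          ≤⟨ ℚ.+-monoʳ-≤ ¼δ (ℚ.+-mono-≤ middle (ℚ.≤-trans
               (proj₂ (dist-cauchy (s k) (½ ^ℚ k) (^ℚ-pos k)) j (M k) M≤j ℕ.≤-refl) (ℚ.<⇒≤ (½^→0 k K₁≤k)))) ⟩
        ¼δ ℚ.+ ((e n ℚ.+ ¼δ) ℚ.+ ½ ℚ.* δ)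
          ≡⟨ solve 3 (λ a b c → a :+ ((b :+ a) :+ c) := b :+ ((a :+ a) :+ c)) ≡.refl ¼δ (e n) (½ ℚ.* δ) ⟩
        e n ℚ.+ ((¼δ ℚ.+ ¼δ) ℚ.+ ½ ℚ.* δ)
          ≡⟨ ≡.cong (e n ℚ.+_) (≡.trans (≡.cong (ℚ._+ ½ ℚ.* δ) (halves (½ ℚ.* δ))) (halves δ)) ⟩
        e n ℚ.+ δ ∎
      where
      open ℚ.≤-Reasoning
      ¼δ = ½ ℚ.* (½ ℚ.* δ)
      0<¼δ = half-pos (half-pos 0<δ)
      K₁ = proj₁ (^ℚ-vanishes (½ ℚ.* δ) (half-pos 0<δ))
      ½^→0 = proj₂ (^ℚ-vanishes (½ ℚ.* δ) (half-pos 0<δ))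
      K₂ = proj₁ (dist-cauchy (s n) ¼δ 0<¼δ)

    l-cauchy : ∀ ε → 0ℚ ℚ.< ε → ∃[ K ] (∀ k k′ → K ℕ.≤ k → K ℕ.≤ k′ → dist (s k) (M k) (s k′) (M k′) ℚ.< ε)
    l-cauchy ε 0<ε =
      let ¼ε = ½ ℚ.* (½ ℚ.* ε)
          0<¼ε = half-pos (half-pos 0<ε)
          -- Both approximations are compared with one fixed s n whose own error is below ε/4.
          n , e<¼ε = e→0 ¼ε 0<¼ε
          K , h = near n ¼ε 0<¼ε
          close : e n ℚ.+ ¼ε ℚ.< ½ ℚ.* ε
          close = ℚ.<-≤-trans (ℚ.+-monoˡ-< ¼ε (e<¼ε n ℕ.≤-refl)) (ℚ.≤-reflexive (halves (½ ℚ.* ε)))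
      in K , λ k k′ p q → ℚ.≤-<-trans (dist-triangle (s k) (M k) (s k′) (M k′) (s n) K)
        (ℚ.<-≤-trans (ℚ.+-mono-<
          (ℚ.≤-<-trans (ℚ.≤-trans (ℚ.≤-reflexive (dist-sym (s k) (M k) (s n) K)) (h k K p ℕ.≤-refl)) close)
          (ℚ.≤-<-trans (h k′ K q ℕ.≤-refl) close))
          (ℚ.≤-reflexive (halves ε)))

    l : ℂ
    l = mkℝ (λ k → seq (re (s k)) (M k)) (λ ε 0<ε → let K , h = l-cauchy ε 0<ε in K , λ k k′ p q →
          ℚ.≤-<-trans (∣fst∣≤ℓ¹ (seq (re (s k)) (M k) ℚ.- seq (re (s k′)) (M k′)) (seq (im (s k)) (M k) ℚ.- seq (im
              (s k′)) (M k′))) (h k k′ p q))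
     +i mkℝ (λ k → seq (im (s k)) (M k)) (λ ε 0<ε → let K , h = l-cauchy ε 0<ε in K , λ k k′ p q →
          ℚ.≤-<-trans (∣snd∣≤ℓ¹ (seq (re (s k)) (M k) ℚ.- seq (re (s k′)) (M k′)) (seq (im (s k)) (M k) ℚ.- seq (im
              (s k′)) (M k′))) (h k k′ p q))

  bound⇒⟶ : ∀ {s l} → (∀ ε → 0ℚ ℚ.< ε → ∃[ N ] (∀ n → N ℕ.≤ n → Bound (s n - l) ε)) → s ⟶ l
  bound⇒⟶ {s} {l} h ε 0<ε =
    -- For h′ = ε/2 the squared modulus is at most h′^2, and the gap in `_<ᵣ_` is taken to be h′^2
    -- too; together they stay below ε^2 = 4 h′^2. The bound k = h′/2 leaves the other half of h′ as
    -- slack.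
    let h′ = ½ ℚ.* ε
        k = ½ ℚ.* h′
        0<h = half-pos 0<ε
        0<k = half-pos 0<h
        N , hN = h k 0<k
    in N , λ n p → let K , hK = eventually (hN n p) k 0<k in
      h′ ℚ.* h′ , 0<-* 0<h 0<h , K , λ i q →
        ℚ.≤-<-trans (ℚ.+-monoˡ-≤ (h′ ℚ.* h′) (ℚ.≤-trans
          (norm²≤ℓ¹² (seq (re (s n - l)) i) (seq (im (s n - l)) i))
          (*-mono-≤ {size (s n - l) i} {h′} {size (s n - l) i} {h′} (ℚ.<⇒≤ 0<h)
            (ℓ¹-nonNeg (seq (re (s n - l)) i) (seq (im (s n - l)) i))
            (ℚ.≤-trans (hK i q) (ℚ.≤-reflexive (halves h′)))
            (ℚ.≤-trans (hK i q) (ℚ.≤-reflexive (halves h′))))))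
        (<-+-pos {h′ ℚ.* h′ ℚ.+ h′ ℚ.* h′} {ε ℚ.* ε} {h′ ℚ.* h′ ℚ.+ h′ ℚ.* h′}
          (≡.trans (≡.cong₂ ℚ._*_ (≡.sym (halves ε)) (≡.sym (halves ε)))
            (solve 1 (λ h → (h :+ h) :* (h :+ h) := (h :* h :+ h :* h) :+ (h :* h :+ h :* h)) ≡.refl h′))
          (ℚ.+-mono-< (0<-* 0<h 0<h) (0<-* 0<h 0<h)))

  -- Eventually the real part of z w exceeds ½ in absolute value and |w| ≤ C, so |z|^2 C^2 ≥ |z w|^2
  -- ≥ 1/4. Thus 1 / (8 C^2) is a uniform gap.
  invertible⇒#0 : ∀ z w → z * w ≈ 1ℂ → z #0
  invertible⇒#0 z w (zw≈1 , _) =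
    let c , 0≤c , bw = bounded w
        N₁ , h₁ = zw≈1 ½ 0<½
        N₂ , h₂ = eventually bw 1ℚ (ℚ.positive⁻¹ 1ℚ)
        C = c ℚ.+ 1ℚ
        0<C : 0ℚ ℚ.< C
        0<C = ℚ.+-mono-≤-< 0≤c (ℚ.positive⁻¹ 1ℚ)
        0<C² = 0<-* 0<C 0<C
        ⅛ = ½ ℚ.* (½ ℚ.* ½)
        δ , 0<δ , C²δ≡⅛ = divide ⅛ (C ℚ.* C) (half-pos (half-pos 0<½)) 0<C²
    in δ , 0<δ , N₁ ℕ.⊔ N₂ , λ n p →
      let a = seq (re z) n ; b = seq (im z) n ; u = seq (re w) n ; v = seq (im w) n
          x = a ℚ.* u ℚ.- b ℚ.* v
          y = a ℚ.* v ℚ.+ b ℚ.* u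
          x-1<½ : ℚ.∣ x ℚ.- 1ℚ ∣ ℚ.< ½
          x-1<½ = h₁ n (ℕ.m⊔n≤o⇒m≤o N₁ N₂ p)
          ½<∣x∣ : ½ ℚ.< ℚ.∣ x ∣
          ½<∣x∣ = ℚ.≰⇒> λ x≤½ → ℚ.<-irrefl ≡.refl (begin-strict
            ℚ.∣ 1ℚ ∣                             ≡⟨ ≡.cong ℚ.∣_∣ (solve 1 (λ x → con 1ℚ := x :-
                (x :- con 1ℚ)) ≡.refl x) ⟩
            ℚ.∣ x ℚ.- (x ℚ.- 1ℚ) ∣               ≤⟨ ℚ.∣p-q∣≤∣p∣+∣q∣ x (x ℚ.- 1ℚ) ⟩
            ℚ.∣ x ∣ ℚ.+ ℚ.∣ x ℚ.- 1ℚ ∣           <⟨ ℚ.+-mono-≤-< x≤½ x-1<½ ⟩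
            ½ ℚ.+ ½                              ∎)
          w≤C : size w n ℚ.≤ C
          w≤C = h₂ n (ℕ.m⊔n≤o⇒n≤o N₁ N₂ p)
          big : C ℚ.* C ℚ.* δ ℚ.< C ℚ.* C ℚ.* norm² a b
          big = begin-strict
            C ℚ.* C ℚ.* δ               ≡⟨ C²δ≡⅛ ⟩
            ⅛                           <⟨ half-< (half-pos 0<½) ⟩
            ½ ℚ.* ½                     ≤⟨ *-mono-≤ (ℚ.0≤∣p∣ x) (ℚ.<⇒≤ 0<½) (ℚ.<⇒≤ ½<∣x∣) (ℚ.<⇒≤ ½<∣x∣) ⟩
            ℚ.∣ x ∣ ℚ.* ℚ.∣ x ∣         ≡⟨ ∣a∣²≡a² x ⟩
            x ℚ.* x                     ≤⟨ ≤-+-nonNeg ≡.refl (square-nonNeg y) ⟩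
            norm² x y                   ≡⟨ norm²-* a b u v ⟩
            norm² a b ℚ.* norm² u v
              ≤⟨ ℚ.*-monoˡ-≤-nonNeg (norm² a b) {{ℚ.nonNegative (norm²-nonNeg a b)}}
                   (ℚ.≤-trans (norm²≤ℓ¹² u v) (*-mono-≤ (ℚ.<⇒≤ 0<C) (ℓ¹-nonNeg u v) w≤C w≤C)) ⟩
            norm² a b ℚ.* (C ℚ.* C)     ≡⟨ ℚ.*-comm (norm² a b) (C ℚ.* C) ⟩
            C ℚ.* C ℚ.* norm² a b       ∎
      in ℚ.≤-<-trans (ℚ.≤-reflexive (ℚ.+-identityˡ δ))
           (ℚ.*-cancelˡ-<-nonNeg (C ℚ.* C) {{ℚ.nonNegative (ℚ.<⇒≤ 0<C²)}} big)
    where open ℚ.≤-Reasoning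

  -- |q|^2 ≤ 1 - δ ≤ (1 - δ/2)^2 yields a rational r without a square root. The squared modulus
  -- being multiplicative, the approximations of all powers obey the bound from the same index N on.
  power-bound : ∀ q → ∣ q ∣< 1ℚ →
    ∃[ r ] 0ℚ ℚ.< r × r ℚ.< 1ℚ × (∀ n → Bound (q ^ n) (r ^ℚ n ℚ.+ r ^ℚ n))
  power-bound q (δ , 0<δ , N , h) = r , 0<r , r<1 , λ n → mkBound λ ε 0<ε → N , λ i p →
      ℚ.≤-trans (norm²≤⇒ℓ¹≤ (seq (re (q ^ n)) i) (seq (im (q ^ n)) i) (ℚ.<⇒≤ (^ℚ-pos n)) (power n i p))
        (≤-+-nonNeg {r ^ℚ n ℚ.+ r ^ℚ n} ≡.refl (ℚ.<⇒≤ 0<ε))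
    where
    r = 1ℚ ℚ.- ½ ℚ.* δ
    a b : ℕ → ℚ
    a i = seq (re q) i
    b i = seq (im q) i
    δ<1 : δ ℚ.< 1ℚ
    δ<1 = ℚ.≤-<-trans (ℚ.≤-trans (≤-+-nonNeg (ℚ.+-comm (norm² (a N) (b N)) δ) (norm²-nonNeg (a N) (b N))) ℚ.≤-refl)
      (h N ℕ.≤-refl)
    0<r : 0ℚ ℚ.< r
    0<r = ∸-pos (ℚ.<-trans (half-< 0<δ) δ<1)
    r<1 : r ℚ.< 1ℚ
    r<1 = <-+-pos (solve 1 (λ x → con 1ℚ := con 1ℚ :- x :+ x) ≡.refl (½ ℚ.* δ)) (half-pos 0<δ)
    open Powers r 0<r r<1
    base : ∀ i → N ℕ.≤ i → norm² (a i) (b i) ℚ.≤ r ℚ.* r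
    base i p = begin
      norm² (a i) (b i)            ≡⟨ solve 2 (λ x d → x := x :+ d :- d) ≡.refl (norm² (a i) (b i)) δ ⟩
      norm² (a i) (b i) ℚ.+ δ ℚ.- δ ≤⟨ ℚ.+-monoˡ-≤ (ℚ.- δ) (ℚ.<⇒≤ (h i p)) ⟩
      1ℚ ℚ.- δ                     ≡⟨ ≡.cong (λ x → 1ℚ ℚ.- x) (≡.sym (halves δ)) ⟩
      1ℚ ℚ.- (½ ℚ.* δ ℚ.+ ½ ℚ.* δ)
        ≤⟨ ≤-+-nonNeg (solve 1 (λ x → (con 1ℚ :- x) :* (con 1ℚ :- x) := con 1ℚ :- (x :+ x) :+ x :* x) ≡.refl (½ ℚ.* δ))
             (square-nonNeg (½ ℚ.* δ)) ⟩
      r ℚ.* r                      ∎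
      where open ℚ.≤-Reasoning
    power : ∀ n i → N ℕ.≤ i → norm² (seq (re (q ^ n)) i) (seq (im (q ^ n)) i) ℚ.≤ r ^ℚ n ℚ.* r ^ℚ n
    power zero    i p = ℚ.≤-refl
    power (suc n) i p = begin
      norm² (seq (re (q ^ suc n)) i) (seq (im (q ^ suc n)) i)
        ≡⟨ norm²-* (a i) (b i) (seq (re (q ^ n)) i) (seq (im (q ^ n)) i) ⟩
      norm² (a i) (b i) ℚ.* norm² (seq (re (q ^ n)) i) (seq (im (q ^ n)) i)
        ≤⟨ *-mono-≤ (square-nonNeg r) (norm²-nonNeg (seq (re (q ^ n)) i) (seq (im (q ^ n)) i)) (base i p)
            (power n i p) ⟩
      r ℚ.* r ℚ.* (r ^ℚ n ℚ.* r ^ℚ n)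
        ≡⟨ solve 2 (λ r t → r :* r :* (t :* t) := r :* t :* (r :* t)) ≡.refl r (r ^ℚ n) ⟩
      r ^ℚ suc n ℚ.* r ^ℚ suc n ∎
      where open ℚ.≤-Reasoning

-- The four identities over ℂ

ℂ-norm : CompleteNorm _≈_ _+_ _*_ -_ 0ℂ 1ℂ
ℂ-norm = record
  { Bound           = Bound
  ; bound-≈         = λ {z w} → bound-≈ {z} {w}
  ; bound-mono      = bound-mono
  ; bound-zero      = bound-zero
  ; bound-one       = bound-one
  ; bound-neg       = bound-neg
  ; bound-+         = bound-+
  ; bound-*         = bound-*
  ; bounded         = bounded
  ; bound-separated = λ {z w} → bound-separated {z} {w}
  ; complete        = complete
  }
  where
  open ComplexBounds
  open ComplexCompleteness

-- The power function is kept variable until the end, again to keep the type checker from unfolding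
-- Cauchy proofs.
Statement : (ℂ → ℕ → ℂ) → ℂ → Set
Statement _^_ q =
    (∃[ S ] ∃[ A ] ∃[ B ]
    (S ≈∑ (λ n → (⟨ - (q ^ 2) ⨾ (q ^ 2) ⟩ n) * (q ^ (n ℕ.^ 2)))
    ÷ (λ n → ⟨ q ⨾ q ⟩ (2 ℕ.* n ℕ.+ 1)))
    × (A ≈⟨ - q ⨾ (q ^ 2) ⟩∞)
    × (B ≈⟨ q ⨾ (q ^ 2) ⟩∞)
    × (S ≈ A ÷ B))
    × (∃[ S ] ∃[ A ] ∃[ B ] ∃[ C ] ∃[ D ]
    (S ≈∑ (λ n → (⟨ - 1ℂ ⨾ q ⟩ (2 ℕ.* n)) * (q ^ (n ℕ.^ 2 ℕ.+ n)))
    ÷ (λ n → (⟨ (q ^ 2) ⨾ (q ^ 2) ⟩ n) * (⟨ (q ^ 2) ⨾ (q ^ 4) ⟩ n)))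
    × (A ≈⟨ - (q ^ 3) ⨾ (q ^ 6) ⟩∞)
    × (B ≈⟨ (q ^ 6) ⨾ (q ^ 6) ⟩∞)
    × (C ≈⟨ - (q ^ 2) ⨾ (q ^ 2) ⟩∞)
    × (D ≈⟨ (q ^ 2) ⨾ (q ^ 2) ⟩∞)
    × (S ≈ (A ^ 2) * B * C ÷ D))
    × (∃[ S ] ∃[ A ] ∃[ B ] ∃[ C ] ∃[ R ]
    (S ≈∑ (λ n → (⟨ q ⨾ (q ^ 2) ⟩ (2 ℕ.* n)) * (q ^ (2 ℕ.* n ℕ.^ 2 ℕ.+ 4 ℕ.* n)) * ((- 1ℂ) ^ n))
    ÷ (λ n → (⟨ (q ^ 8) ⨾ (q ^ 8) ⟩ n) * (⟨ - (q ^ 2) ⨾ (q ^ 4) ⟩ (n ℕ.+ 1))))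
    × (A ≈⟪ - (q ^ 9) ∷ - (q ^ 7) ∷ (q ^ 8) ∷ [] ⨾ (q ^ 8) ⟫∞)
    × (B ≈⟨ (q ^ 2) ⨾ (q ^ 4) ⟩∞)
    × (C ≈⟨ (q ^ 4) ⨾ (q ^ 4) ⟩∞)
    × (R ≈ B ÷ C)
    × (S ≈ A * R))
    × (∃[ S ] ∃[ A ] ∃[ B ] ∃[ C ] ∃[ R ]
    (S ≈∑ (λ n → (⟨ q ⨾ (q ^ 2) ⟩ (2 ℕ.* n)) * (q ^ (2 ℕ.* n ℕ.^ 2)) * ((- 1ℂ) ^ n))
    ÷ (λ n → (⟨ (q ^ 8) ⨾ (q ^ 8) ⟩ n) * (⟨ - (q ^ 2) ⨾ (q ^ 4) ⟩ n)))
    × (A ≈⟪ - (q ^ 3) ∷ - (q ^ 5) ∷ (q ^ 8) ∷ [] ⨾ (q ^ 8) ⟫∞)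
    × (B ≈⟨ (q ^ 2) ⨾ (q ^ 4) ⟩∞)
    × (C ≈⟨ (q ^ 4) ⨾ (q ^ 4) ⟩∞)
    × (R ≈ B ÷ C)
    × (S ≈ A * R))

prod : (ℕ → ℂ) → ℕ → ℂ
prod f n = product {n} (λ i → f (toℕ i))

prod-suc : ∀ f n → prod f (ℕ.suc n) ≈ (f 0 * prod (λ j → f (ℕ.suc j)) n)
prod-suc f n = ComplexBounds.pointwise {prod f (ℕ.suc n)} {f 0 * prod (λ j → f (ℕ.suc j)) n} (λ _ → ≡.refl)
    (λ _ → ≡.refl)

product-pointwise : ∀ n {f : Fin n → ℂ} {g : ℕ → ℂ} → (∀ j i → seq (re (f j)) i ≡ seq (re (g (toℕ j))) i) →
  (∀ j i → seq (im (f j)) i ≡ seq (im (g (toℕ j))) i) → product {n} f ≈ prod g n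
product-pointwise ℕ.zero    hr hi = ComplexBounds.≈-refl {1ℂ}
product-pointwise (ℕ.suc n) {f} {g} hr hi =
  ≈-trans {product f} {f Fin.zero * product (λ j → f (Fin.suc j))} {prod g (ℕ.suc n)}
  (pointwise {product f} {f Fin.zero * product (λ j → f (Fin.suc j))} (λ _ → ≡.refl) (λ _ → ≡.refl))
  (≈-trans {f Fin.zero * product (λ j → f (Fin.suc j))} {g 0 * prod (λ j → g (ℕ.suc j)) n} {prod g (ℕ.suc n)}
    (*-cong {f Fin.zero} {g 0} {product (λ j → f (Fin.suc j))} {prod (λ j → g (ℕ.suc j)) n}
      (pointwise {f Fin.zero} {g 0} (hr Fin.zero) (hi Fin.zero))
      (product-pointwise n {g = λ j → g (ℕ.suc j)} (λ j → hr (Fin.suc j)) (λ j → hi (Fin.suc j))))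
    (≈-sym {prod g (ℕ.suc n)} {g 0 * prod (λ j → g (ℕ.suc j)) n} (prod-suc g n)))
  where open ComplexBounds using (≈-trans; ≈-sym; pointwise; *-cong)

module Powers (_^′_ : ℂ → ℕ → ℂ) (^′≡^ : _^′_ ≡ _^_) (q : ℂ) (∣q∣<1 : ∣ q ∣< 1ℚ) where
  open ComplexCompleteness using (isCommutativeRing; bound⇒⟶; invertible⇒#0; power-bound)
  open ComplexBounds using (Bound; ≈-refl; pointwise)

  r : ℚ
  r = proj₁ (power-bound q ∣q∣<1)

  ^′-zero : ∀ {_^′_} → _^′_ ≡ _^_ → ∀ x → (x ^′ 0) ≈ 1ℂ
  ^′-zero ≡.refl x = ≈-refl {1ℂ}

  ^-suc : ∀ x n → (x ^ ℕ.suc n) ≈ (x * (x ^ n))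
  ^-suc x n = pointwise {x ^ ℕ.suc n} {x * x ^ n} (λ _ → ≡.refl) (λ _ → ≡.refl)

  ^′-suc : ∀ {_^′_} → _^′_ ≡ _^_ → ∀ x n → (x ^′ ℕ.suc n) ≈ (x * (x ^′ n))
  ^′-suc ≡.refl = ^-suc

  q-bound : ∀ {_^′_} → _^′_ ≡ _^_ → ∀ n → Bound (q ^′ n) (r ^ℚ n ℚ.+ r ^ℚ n)
  q-bound ≡.refl = proj₂ (proj₂ (proj₂ (power-bound q ∣q∣<1)))

  ⟨⟩≈prod : ∀ x y n → ⟨ x ⨾ y ⟩ n ≈ prod (λ j → 1ℂ + (- (x * (y ^′ j)))) n
  ⟨⟩≈prod x y n = product-pointwise n {g = λ j → 1ℂ + (- (x * (y ^′ j)))}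
    (λ j → real ^′≡^ (toℕ j)) (λ j → imaginary ^′≡^ (toℕ j))
    where
    real : ∀ {_^′_} → _^′_ ≡ _^_ → ∀ j i → seq (re (1ℂ - x * y ^ j)) i ≡ seq (re (1ℂ + (- (x * (y ^′ j))))) i
    real ≡.refl j i = ≡.refl
    imaginary : ∀ {_^′_} → _^′_ ≡ _^_ → ∀ j i → seq (im (1ℂ - x * y ^ j)) i ≡ seq (im (1ℂ + (- (x * (y ^′ j))))) i
    imaginary ≡.refl j i = ≡.refl

  open Identities isCommutativeRing ℂ-norm _^′_ (^′-zero ^′≡^) (^′-suc ^′≡^)
    (λ f n → sum {n} (λ i → f (toℕ i))) prod
    (λ f → ≈-refl {0ℂ})
    (λ f n → pointwise {sum {ℕ.suc n} (λ i → f (toℕ i))} {f 0 + sum {n} (λ i → f (ℕ.suc (toℕ i)))} (λ _ → ≡.refl)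
        (λ _ → ≡.refl))
    (λ f → ≈-refl {1ℂ}) prod-suc ⟨_⨾_⟩_ ⟨⟩≈prod
    r (proj₁ (proj₂ (power-bound q ∣q∣<1))) (proj₁ (proj₂ (proj₂ (power-bound q ∣q∣<1))))
    q (q-bound ^′≡^)
    using (Limit; Invertible; SumOf; identity₁; identity₂; identity₃; identity₄)

  productLimit : ∀ x p P → Limit (⟨_⨾_⟩_ x p) P → P ≈⟨ x ⨾ p ⟩∞
  productLimit x p P h = bound⇒⟶ {λ n → ⟨ x ⨾ p ⟩ n} {P} h

  apart : ∀ z → Invertible z → z #0
  apart z (w , zw≈1) = invertible⇒#0 z w zw≈1

  sumRelation : ∀ S a b → SumOf S a b → S ≈∑ a ÷ b
  sumRelation S a b (t , quotients , Σt) =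
    t , (λ n → apart (b n) (proj₁ (quotients n)) , proj₂ (quotients n)) ,
    bound⇒⟶ {λ N → sum {N} (λ i → t (toℕ i))} {S} Σt

  triple : ∀ {x y z p} A B C → Limit (⟨_⨾_⟩_ x p) A → Limit (⟨_⨾_⟩_ y p) B → Limit (⟨_⨾_⟩_ z p) C →
    A * (B * (C * 1ℂ)) ≈⟪ x ∷ y ∷ z ∷ [] ⨾ p ⟫∞
  triple {x} {y} {z} {p} A B C A→ B→ C→ =
    A , B * (C * 1ℂ) , productLimit x p A A→ ,
    (B , C * 1ℂ , productLimit y p B B→ ,
      (C , 1ℂ , productLimit z p C C→ , ≈-refl {1ℂ} , ≈-refl {C * 1ℂ}) ,
      ≈-refl {B * (C * 1ℂ)}) ,
    ≈-refl {A * (B * (C * 1ℂ))}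

  statement : Statement _^′_ q
  statement =
    (let S , A , B , s , A→ , B→ , B-inv , eq = identity₁ in
        S , A , B , sumRelation S
        (λ n → (⟨ - (q ^′ 2) ⨾ (q ^′ 2) ⟩ n) * (q ^′ (n ℕ.^ 2)))
        (λ n → ⟨ q ⨾ q ⟩ (2 ℕ.* n ℕ.+ 1)) s , productLimit (- q) (q ^′ 2) A A→ , productLimit q
            (q ^′ 2) B B→ , apart B B-inv , eq)
    , (let S , A , B , C , D , s , A→ , B→ , C→ , D→ , D-inv , eq = identity₂ in
        S , A , B , C , D , sumRelation S
        (λ n → (⟨ - 1ℂ ⨾ q ⟩ (2 ℕ.* n)) * (q ^′ (n ℕ.^ 2 ℕ.+ n)))
        (λ n → (⟨ (q ^′ 2) ⨾ (q ^′ 2) ⟩ n) * (⟨ (q ^′ 2) ⨾ (q ^′ 4) ⟩ n)) s ,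
        productLimit (- (q ^′ 3)) (q ^′ 6) A A→ , productLimit (q ^′ 6) (q ^′ 6) B B→ ,
        productLimit (- (q ^′ 2)) (q ^′ 2) C C→ , productLimit (q ^′ 2) (q ^′ 2) D D→ , apart D D-inv , eq)
    , (let S , A₁ , A₂ , A₃ , B , C , R , s , A₁→ , A₂→ , A₃→ , B→ , C→ , C-inv , R-eq , eq = identity₃ in
        S , A₁ * (A₂ * (A₃ * 1ℂ)) , B , C , R , sumRelation S
        (λ n → (⟨ q ⨾ (q ^′ 2) ⟩ (2 ℕ.* n)) * (q ^′ (2 ℕ.* n ℕ.^ 2 ℕ.+ 4 ℕ.* n)) * ((- 1ℂ) ^′ n))
        (λ n → (⟨ (q ^′ 8) ⨾ (q ^′ 8) ⟩ n) * (⟨ - (q ^′ 2) ⨾ (q ^′ 4) ⟩ (n ℕ.+ 1))) s ,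
        triple { - (q ^′ 9)} { - (q ^′ 7)} {q ^′ 8} {q ^′ 8} A₁ A₂ A₃ A₁→ A₂→ A₃→ ,
        productLimit (q ^′ 2) (q ^′ 4) B B→ , productLimit (q ^′ 4) (q ^′ 4) C C→ , (apart C C-inv , R-eq) , eq)
    , (let S , A₁ , A₂ , A₃ , B , C , R , s , A₁→ , A₂→ , A₃→ , B→ , C→ , C-inv , R-eq , eq = identity₄ in
        S , A₁ * (A₂ * (A₃ * 1ℂ)) , B , C , R , sumRelation S
        (λ n → (⟨ q ⨾ (q ^′ 2) ⟩ (2 ℕ.* n)) * (q ^′ (2 ℕ.* n ℕ.^ 2)) * ((- 1ℂ) ^′ n))
        (λ n → (⟨ (q ^′ 8) ⨾ (q ^′ 8) ⟩ n) * (⟨ - (q ^′ 2) ⨾ (q ^′ 4) ⟩ n)) s ,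
        triple { - (q ^′ 3)} { - (q ^′ 5)} {q ^′ 8} {q ^′ 8} A₁ A₂ A₃ A₁→ A₂→ A₃→ ,
        productLimit (q ^′ 2) (q ^′ 4) B B→ , productLimit (q ^′ 4) (q ^′ 4) C C→ , (apart C C-inv , R-eq) , eq)

specialise : ∀ {_^′_} → _^′_ ≡ _^_ → ∀ q → Statement _^′_ q → Statement _^_ q
specialise ≡.refl q s = s

theorem2p1 : (q : ℂ) → ∣ q ∣< 1ℚ →
    (∃[ S ] ∃[ A ] ∃[ B ]
    (S ≈∑ (λ n → (⟨ - (q ^ 2) ⨾ q ^ 2 ⟩ n) * q ^ (n ℕ.^ 2))
    ÷ (λ n → ⟨ q ⨾ q ⟩ (2 ℕ.* n ℕ.+ 1)))
    × (A ≈⟨ - q ⨾ q ^ 2 ⟩∞)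
    × (B ≈⟨ q ⨾ q ^ 2 ⟩∞)
    × (S ≈ A ÷ B))
    × (∃[ S ] ∃[ A ] ∃[ B ] ∃[ C ] ∃[ D ]
    (S ≈∑ (λ n → (⟨ - 1ℂ ⨾ q ⟩ (2 ℕ.* n)) * q ^ (n ℕ.^ 2 ℕ.+ n))
    ÷ (λ n → (⟨ q ^ 2 ⨾ q ^ 2 ⟩ n) * (⟨ q ^ 2 ⨾ q ^ 4 ⟩ n)))
    × (A ≈⟨ - (q ^ 3) ⨾ q ^ 6 ⟩∞)
    × (B ≈⟨ q ^ 6 ⨾ q ^ 6 ⟩∞)
    × (C ≈⟨ - (q ^ 2) ⨾ q ^ 2 ⟩∞)
    × (D ≈⟨ q ^ 2 ⨾ q ^ 2 ⟩∞)
    × (S ≈ A ^ 2 * B * C ÷ D))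
    × (∃[ S ] ∃[ A ] ∃[ B ] ∃[ C ] ∃[ R ]
    (S ≈∑ (λ n → (⟨ q ⨾ q ^ 2 ⟩ (2 ℕ.* n)) * q ^ (2 ℕ.* n ℕ.^ 2 ℕ.+ 4 ℕ.* n) * (- 1ℂ) ^ n)
    ÷ (λ n → (⟨ q ^ 8 ⨾ q ^ 8 ⟩ n) * (⟨ - (q ^ 2) ⨾ q ^ 4 ⟩ (n ℕ.+ 1))))
    × (A ≈⟪ - (q ^ 9) ∷ - (q ^ 7) ∷ q ^ 8 ∷ [] ⨾ q ^ 8 ⟫∞)
    × (B ≈⟨ q ^ 2 ⨾ q ^ 4 ⟩∞)
    × (C ≈⟨ q ^ 4 ⨾ q ^ 4 ⟩∞)
    × (R ≈ B ÷ C)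
    × (S ≈ A * R))
    × (∃[ S ] ∃[ A ] ∃[ B ] ∃[ C ] ∃[ R ]
    (S ≈∑ (λ n → (⟨ q ⨾ q ^ 2 ⟩ (2 ℕ.* n)) * q ^ (2 ℕ.* n ℕ.^ 2) * (- 1ℂ) ^ n)
    ÷ (λ n → (⟨ q ^ 8 ⨾ q ^ 8 ⟩ n) * (⟨ - (q ^ 2) ⨾ q ^ 4 ⟩ n)))
    × (A ≈⟪ - (q ^ 3) ∷ - (q ^ 5) ∷ q ^ 8 ∷ [] ⨾ q ^ 8 ⟫∞)
    × (B ≈⟨ q ^ 2 ⨾ q ^ 4 ⟩∞)
    × (C ≈⟨ q ^ 4 ⨾ q ^ 4 ⟩∞)
    × (R ≈ B ÷ C)
    × (S ≈ A * R))
theorem2p1 q ∣q∣<1 = specialise ≡.refl q (Powers.statement _ ≡.refl q ∣q∣<1)
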